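{- Let $k\ge 5$ be an odd integer and let $\Gamma$ be a connected amply regular graph with diameter $d\ge 4$ and parameters $(v,k,\lambda,\mu)$, where $\mu=\frac{k-1}{2}$. Let $\Lambda$ be the unique bipartite $(0,2)$-graph with $14$ vertices and valency $4$, which is the point--block incidence graph of the square $2$-$(7,4,2)$ design. Then exactly one of the following holds: (1) $\Gamma$ is the $5$-cube. (2) $\Gamma$ is the graph $K_2\,\square\,\Lambda$, which has diameter $4$ and parameters $(28,5,0,2)$. (3) $\Gamma$ is the point--block incidence graph of a $GDDDP\left(2,k+1;\,k;\,0,\frac{k-1}{2}\right)$. (Here "is" means "is isomorphic to".)
   Context: All graphs are finite, simple and undirected. An amply regular graph with parameters $(v,k,\lambda,\mu)$ is a $k$-regular graph on $v$ vertices such that every pair of adjacent vertices has exactly $\lambda$ common neighbors and every pair of vertices at distance two has exactly $\mu$ common neighbors. A $(0,2)$-graph is a connected graph in which each pair of distinct vertices has either $0$ or $2$ common neighbors. $K_2$ is the complete graph on two vertices. The Cartesian product $\Gamma\,\square\,\Delta$ has vertex set $V(\Gamma)\times V(\Delta)$, with $(x,y)\sim(x',y')$ iff either $x=x'$ and $y\sim y'$, or $x\sim x'$ and $y=y'$. A group divisible design $GDD(n,m;k;\lambda_1,\lambda_2)$ is a triple $(\mathcal P,\mathcal G,\mathcal B)$ consisting of a set $\mathcal P$ of points, a partition $\mathcal G$ of $\mathcal P$ into $m$ subsets of size $n$ (groups), and a collection $\mathcal B$ of $k$-subsets of $\mathcal P$ (blocks), such that each pair of distinct points from the same group appears in exactly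 $\lambda_1$ blocks and each pair of points from different groups appears in exactly $\lambda_2$ blocks. Its dual incidence structure has point set $\mathcal B$ and block set $\mathcal P$, where $p\in\mathcal P$ is identified with the set of blocks $B\in\mathcal B$ containing $p$. If there is a partition $\mathcal G'$ of $\mathcal B$ such that $(\mathcal B,\mathcal G',\mathcal P)$ is a $GDD(n,m;k;\lambda_1,\lambda_2)$ (same parameters), then the design is called a group divisible design with the dual property, denoted $GDDDP(n,m;k;\lambda_1,\lambda_2)$. The point--block incidence graph of an incidence structure has vertex set $\mathcal P\cup\mathcal B$ (disjoint union), with a point and a block adjacent iff they are incident, and no other adjacencies. -}

module Defs where

open import Data.Bool.Base using (Bool; true; false; _xor_)
open import Data.Bool.Properties using (xor-comm)
open import Data.Empty using (⊥)
open import Data.Fin.Base using (Fin)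
open import Data.Fin.Properties using (inj⇒≟; *↔×; +↔⊎; 2↔Bool) renaming (_≟_ to _≟ᶠ_)
open import Data.Fin.Subset using (∣_∣)
open import Data.Nat.Base using (ℕ; zero; suc; _+_; _*_; _^_; _≤_)
open import Data.Nat.Properties using () renaming (_≟_ to _≟ⁿ_)
open import Data.Product.Base using (Σ-syntax; ∃-syntax; _×_; _,_)
open import Data.Product.Function.NonDependent.Propositional using (_×-↔_)
open import Data.Sum.Base using (_⊎_; inj₁; inj₂)
open import Data.Sum.Function.Propositional using (_⊎-↔_)
open import Data.Vec.Base using (Vec; []; _∷_; count; tabulate; zipWith)
open import Data.Vec.Properties using (zipWith-comm)
open import Function.Base using (_∘_; flip)
open import Function.Bundles using (_↔_; _⇔_; Inverse; mk↔ₛ′)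
open import Function.Construct.Composition using (_↔-∘_)
open import Function.Construct.Identity using (↔-id)
open import Function.Construct.Symmetry using (↔-sym)
open import Function.Properties.Inverse using (↔⇒↣)
open import Level using (Level; 0ℓ; _⊔_)
open import Relation.Binary.Core using (REL; Rel)
open import Relation.Binary.Definitions using (Decidable; DecidableEquality; Symmetric; Irreflexive)
open import Relation.Binary.PropositionalEquality using (_≡_; _≢_; refl; sym; trans; cong)
open import Relation.Nullary.Decidable using (no; ¬?; _×-dec_; _⊎-dec_)
open import Relation.Nullary.Negation using (¬_)
open import Relation.Unary using (Pred) renaming (Decidable to Decidable₁)

ExactlyOneOf : ∀ {a b c : Level} → Set a → Set b → Set c → Set (a ⊔ b ⊔ c)
ExactlyOneOf A B C = (A × ¬ B × ¬ C) ⊎ (¬ A × B × ¬ C) ⊎ (¬ A × ¬ B × C)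

record FiniteSet : Set₁ where
  field
    Carrier : Set
    size    : ℕ
    enum    : Carrier ↔ Fin size

  _≟_ : DecidableEquality Carrier
  _≟_ = inj⇒≟ (↔⇒↣ enum)

  elements : Vec Carrier size
  elements = tabulate (Inverse.from enum)

  # : {P : Pred Carrier 0ℓ} → Decidable₁ P → ℕ
  # P? = count P? elements

open FiniteSet using (Carrier; size)

finFS : ℕ → FiniteSet
finFS n = record { Carrier = Fin n ; size = n ; enum = ↔-id (Fin n) }

_×FS_ : FiniteSet → FiniteSet → FiniteSet
A ×FS B = record
  { Carrier = Carrier A × Carrier B
  ; size    = size A * size B
  ; enum    = ↔-sym *↔× ↔-∘ (FiniteSet.enum A ×-↔ FiniteSet.enum B)
  }

_⊎FS_ : FiniteSet → FiniteSet → FiniteSet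
A ⊎FS B = record
  { Carrier = Carrier A ⊎ Carrier B
  ; size    = size A + size B
  ; enum    = ↔-sym +↔⊎ ↔-∘ (FiniteSet.enum A ⊎-↔ FiniteSet.enum B)
  }

bitsFS : ℕ → FiniteSet
bitsFS n = record { Carrier = Vec Bool n ; size = 2 ^ n ; enum = bits↔ n }
  where
  uncons↔ : ∀ n → Vec Bool (suc n) ↔ (Bool × Vec Bool n)
  uncons↔ n = mk↔ₛ′ (λ { (b ∷ bs) → b , bs }) (λ { (b , bs) → b ∷ bs })
                     (λ _ → refl) (λ { (_ ∷ _) → refl })

  bits↔ : ∀ n → Vec Bool n ↔ Fin (2 ^ n)
  bits↔ zero    = mk↔ₛ′ (λ _ → Fin.zero) (λ _ → []) (λ { Fin.zero → refl ; (Fin.suc ()) }) (λ { [] → refl })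
  bits↔ (suc n) = (↔-sym *↔× ↔-∘ (↔-sym 2↔Bool ×-↔ bits↔ n)) ↔-∘ uncons↔ n

record Graph : Set₁ where
  field
    vertices : FiniteSet

  V : Set
  V = Carrier vertices

  order : ℕ
  order = size vertices

  field
    Adj    : Rel V 0ℓ
    adj?   : Decidable Adj
    symm   : Symmetric Adj
    irrefl : Irreflexive _≡_ Adj

  degree : V → ℕ
  degree x = FiniteSet.# vertices (adj? x)

  #commonNeighbours : V → V → ℕ
  #commonNeighbours x y = FiniteSet.# vertices (λ z → adj? x z ×-dec adj? y z)

  data Walk : V → V → ℕ → Set where
    []  : ∀ {x} → Walk x x 0
    _∷_ : ∀ {x y z n} → Adj x y → Walk y z n → Walk x z (suc n)

  Distance : V → V → ℕ → Set
  Distance x y n = Walk x y n × (∀ m → Walk x y m → n ≤ m)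

  Connected : Set
  Connected = ∀ x y → ∃[ n ] Walk x y n

  Diameter : ℕ → Set
  Diameter d = (∀ x y → ∃[ n ] (Distance x y n × n ≤ d))
             × (∃[ x ] ∃[ y ] Distance x y d)

  Regular : ℕ → Set
  Regular k = ∀ x → degree x ≡ k

  Bipartite : Set
  Bipartite = Σ[ side ∈ (V → Bool) ] (∀ x y → Adj x y → side x ≢ side y)

open Graph using (V; Adj; order; Connected; Diameter; Regular; Bipartite)

record _≅_ (Γ Δ : Graph) : Set where
  field
    bijection : V Γ ↔ V Δ
    adjacency : ∀ x y → Adj Γ x y ⇔ Adj Δ (Inverse.to bijection x) (Inverse.to bijection y)

infix 4 _≅_

record AmplyRegular (Γ : Graph) (v k lam μ : ℕ) : Set where
  open Graph Γ using (#commonNeighbours; Distance)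
  field
    order≡v  : order Γ ≡ v
    regular  : Regular Γ k
    adjacent : ∀ x y → Adj Γ x y → #commonNeighbours x y ≡ lam
    dist-two : ∀ x y → Distance x y 2 → #commonNeighbours x y ≡ μ

record ZeroTwoGraph (Γ : Graph) : Set where
  open Graph Γ using (#commonNeighbours)
  field
    connected : Connected Γ
    zero-two  : ∀ x y → x ≢ y → #commonNeighbours x y ≡ 0 ⊎ #commonNeighbours x y ≡ 2

complete : ℕ → Graph
complete n = record
  { vertices = finFS n
  ; Adj      = _≢_
  ; adj?     = λ x y → ¬? (x ≟ᶠ y)
  ; symm     = λ x≢y → x≢y ∘ sym
  ; irrefl   = λ x≡y x≢y → x≢y x≡y
  }

K₂ : Graph
K₂ = complete 2

infixr 7 _□_

_□_ : Graph → Graph → Graph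
Γ □ Δ = record
  { vertices = Graph.vertices Γ ×FS Graph.vertices Δ
  ; Adj      = λ { (x , y) (x′ , y′) → (x ≡ x′ × Adj Δ y y′) ⊎ (Adj Γ x x′ × y ≡ y′) }
  ; adj?     = λ { (x , y) (x′ , y′) →
                     ((FiniteSet._≟_ (Graph.vertices Γ) x x′) ×-dec Graph.adj? Δ y y′)
               ⊎-dec (Graph.adj? Γ x x′ ×-dec (FiniteSet._≟_ (Graph.vertices Δ) y y′)) }
  ; symm     = λ { (inj₁ (e , a)) → inj₁ (sym e , Graph.symm Δ a)
                 ; (inj₂ (a , e)) → inj₂ (Graph.symm Γ a , sym e) }
  ; irrefl   = λ { refl (inj₁ (_ , a)) → Graph.irrefl Δ refl a
                 ; refl (inj₂ (a , _)) → Graph.irrefl Γ refl a }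
  }

-- ∣_∣ counts the entries equal to true, so this is the Hamming distance.
hamming : ∀ {n} → Vec Bool n → Vec Bool n → ℕ
hamming x y = ∣ zipWith _xor_ x y ∣

cube : ℕ → Graph
cube n = record
  { vertices = bitsFS n
  ; Adj      = λ x y → hamming x y ≡ 1
  ; adj?     = λ x y → hamming x y ≟ⁿ 1
  ; symm     = λ {x} {y} → trans (cong ∣_∣ (zipWith-comm xor-comm y x))
  ; irrefl   = λ { {x} refl h≡1 → 0≢1 (trans (sym (hamming-self x)) h≡1) }
  }
  where
  0≢1 : 0 ≢ 1
  0≢1 ()

  hamming-self : ∀ {n} (x : Vec Bool n) → hamming x x ≡ 0
  hamming-self []          = refl
  hamming-self (true  ∷ x) = hamming-self x
  hamming-self (false ∷ x) = hamming-self x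

-- A block b stands for the set of points p with Inc p b; distinct blocks are
-- not required to have distinct point sets, so that the dual is always defined.
record IncidenceStructure : Set₁ where
  field
    points : FiniteSet
    blocks : FiniteSet
    Inc    : REL (Carrier points) (Carrier blocks) 0ℓ
    inc?   : Decidable Inc

  blockSize : Carrier blocks → ℕ
  blockSize b = FiniteSet.# points (λ p → inc? p b)

  #commonBlocks : Carrier points → Carrier points → ℕ
  #commonBlocks p q = FiniteSet.# blocks (λ b → inc? p b ×-dec inc? q b)

dual : IncidenceStructure → IncidenceStructure
dual S = record
  { points = blocks
  ; blocks = points
  ; Inc    = flip Inc
  ; inc?   = flip inc?
  }
  where open IncidenceStructure S

incidenceGraph : IncidenceStructure → Graph
incidenceGraph S = record
  { vertices = points ⊎FS blocks
  ; Adj      = E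
  ; adj?     = E?
  ; symm     = λ {x} {y} → E-sym x y
  ; irrefl   = λ { {inj₁ _} refl () ; {inj₂ _} refl () }
  }
  where
  open IncidenceStructure S

  E : Rel (Carrier points ⊎ Carrier blocks) 0ℓ
  E (inj₁ p) (inj₂ b) = Inc p b
  E (inj₂ b) (inj₁ p) = Inc p b
  E (inj₁ _) (inj₁ _) = ⊥
  E (inj₂ _) (inj₂ _) = ⊥

  E? : Decidable E
  E? (inj₁ p) (inj₂ b) = inc? p b
  E? (inj₂ b) (inj₁ p) = inc? p b
  E? (inj₁ _) (inj₁ _) = no λ ()
  E? (inj₂ _) (inj₂ _) = no λ ()

  E-sym : ∀ x y → E x y → E y x
  E-sym (inj₁ _) (inj₂ _) i = i
  E-sym (inj₂ _) (inj₁ _) i = i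

-- The partition into m groups is given by the map sending a point to (the
-- label of) its group.
record GDD (n m k λ₁ λ₂ : ℕ) (S : IncidenceStructure) : Set where
  open IncidenceStructure S
  field
    group      : Carrier points → Fin m
    group-size : ∀ j → FiniteSet.# points (λ p → group p ≟ᶠ j) ≡ n
    block-size : ∀ b → blockSize b ≡ k
    same-group : ∀ p q → p ≢ q → group p ≡ group q → #commonBlocks p q ≡ λ₁
    diff-group : ∀ p q → group p ≢ group q → #commonBlocks p q ≡ λ₂

GDDDP : (n m k λ₁ λ₂ : ℕ) → IncidenceStructure → Set
GDDDP n m k λ₁ λ₂ S = GDD n m k λ₁ λ₂ S × GDD n m k λ₁ λ₂ (dual S)

record SquareTwoDesign (v k lam : ℕ) (S : IncidenceStructure) : Set where
  open IncidenceStructure S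
  field
    #points    : size points ≡ v
    #blocks    : size blocks ≡ v
    block-size : ∀ b → blockSize b ≡ k
    balanced   : ∀ p q → p ≢ q → #commonBlocks p q ≡ lam

record BipartiteZeroTwo (v k : ℕ) (Λ : Graph) : Set where
  field
    bipartite : Bipartite Λ
    zeroTwo   : ZeroTwoGraph Λ
    #vertices : order Λ ≡ v
    valency   : Regular Λ k

{-# OPTIONS --safe #-}
-- Write k = 2μ + 1 and let d(x, u) = 4.  A vertex y with d(x, y) = d(y, u) = 2 has μ neighbours adjacent to x, μ adjacent to
-- u, and a single further one.  This rigidity forces λ = 0, so that any two vertices with a common neighbour have exactly μ.
-- If every neighbour of x at distance 3 from u has x as its only neighbour outside Γ₂(u), and likewise with x and u
-- exchanged, then Γ is bipartite with halves of size 2k + 2, and in each half a vertex has a common neighbour with all but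
-- one of the others: this is the GDDDP.  Otherwise a count gives μ = 2 and k = 5.  Then the interval between some a and u at
-- distance 3 is a 3-cube, and the quadrangles around it determine Γ up to six signs ε(i, j) saying how the second layers of
-- neighbours on the two sides are matched.  The signs can be twisted at no more than one index on either side; no twist
-- gives the 5-cube, and a twist at the same index on both sides gives K₂ □ Λ.
module Submission where

open import Defs
open import Data.Bool.Base using (Bool; true; false; not; if_then_else_; _xor_) renaming (T to IsTrue)
open import Data.Bool.Properties using (T?; ¬-not) renaming (_≟_ to _≟ᵇ_)
open import Data.Empty using (⊥; ⊥-elim)
open import Data.Fin.Base using (Fin; toℕ)
open import Data.Fin.Patterns using (0F; 1F; 2F; 3F; 4F; 5F; 6F)
open import Data.Fin.Permutation using (↔⇒≡)
open import Data.Fin.Properties using (toℕ-injective; all?; any?) renaming (_≟_ to _≟ᶠ_)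
open import Data.List.Base as List using (List; []; _∷_; length; filter; _++_)
open import Data.List.Membership.Propositional using (_∈_; _∉_)
open import Data.List.Membership.Propositional.Properties using (∈-filter⁺; ∈-filter⁻; ∈-tabulate⁺; ∈-++⁺ˡ; ∈-++⁺ʳ; ∈-++⁻; ∈-∃++; ∈-map⁺; ∈-map⁻; ∈-lookup)
open import Data.List.Properties using (length-++; length-map; map-∘; map-cong)
open import Data.List.Relation.Unary.All as All using (All; []; _∷_)
open import Data.List.Relation.Unary.AllPairs using ([]; _∷_)
open import Data.List.Relation.Unary.Any as Any using (here; there)
open import Data.List.Relation.Unary.Any.Properties using (lookup-index)
open import Data.List.Relation.Unary.Unique.Propositional using (Unique)
import Data.List.Relation.Unary.Unique.Propositional.Properties as Unique
open import Data.Nat.Base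
open import Data.Nat.DivMod using (_/_; m/n*n≡m)
open import Data.Nat.Divisibility using (_∣_; divides)
open import Data.Nat.Properties renaming (_≟_ to _≟ⁿ_)
open import Data.Product.Base using (Σ-syntax; ∃-syntax; _×_; _,_; proj₁; proj₂)
open import Data.Sum.Base using (_⊎_; inj₁; inj₂)
open import Data.Unit.Base using (⊤; tt)
open import Data.Vec.Base as Vec using (Vec; []; _∷_)
open import Function.Base using (_∘_; id)
open import Function.Bundles using (Inverse; Equivalence; mk⇔; mk↔ₛ′)
open import Function.Construct.Composition using (_↔-∘_)
open import Function.Construct.Symmetry using (↔-sym)
open import Level using (0ℓ)
open import Relation.Binary.Core using (REL)
open import Relation.Binary.Definitions using (tri<; tri≈; tri>)
open import Relation.Binary.PropositionalEquality
open import Relation.Nullary.Decidable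
open import Relation.Nullary.Negation using (¬_; contradiction)
open import Relation.Unary using (Pred) renaming (Decidable to Decidable₁)
open import Algebra.Properties.Semiring.Sum +-*-semiring using (sum; sum-cong-≗; ∑-comm; ∑-distrib-+; *-distribˡ-sum; *-distribʳ-sum)

open FiniteSet using (Carrier; size)

-- After λ = 0, one device carries almost every step: two vertices that share a neighbour share a
-- second one, since μ ≥ 2, and a complete list of the neighbours of one of them shows which vertex
-- that is. For μ = 2 a third common neighbour is excluded, which gives the nonadjacencies. The
-- signs obey a parity law: when ε(i, j) is linked to the signs with the same i or the same j, the
-- six of them form a hexagon, and a twist is a change along one of its edges. Hence the number of
-- twists is even, and as each side has at most one, there is either none or one on each side.
-- Twists at different indices need a separate contradiction. The neighbour lists found in this way
-- give a map from the model to Γ that is bijective on neighbourhoods. It is a covering, so one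
-- fibre with a single point makes it an isomorphism. The three cases exclude one another because
-- the first two have k = 5, and then the orders are 32, 28 and 24.

pattern 2nd e = there (here e)
pattern 3rd e = there (2nd e)
pattern 4th e = there (3rd e)
pattern 5th e = there (4th e)

-- Lists without repetitions

module _ {A : Set} where

  lookup-injective : ∀ {xs : List A} → Unique xs → ∀ i j → List.lookup xs i ≡ List.lookup xs j → i ≡ j
  lookup-injective {x ∷ xs} _          Fin.zero    Fin.zero    _ = refl
  lookup-injective {x ∷ xs} (x∉ ∷ _)   Fin.zero    (Fin.suc j) e = contradiction e (All.lookup x∉ (∈-lookup j))
  lookup-injective {x ∷ xs} (x∉ ∷ _)   (Fin.suc i) Fin.zero    e = contradiction (sym e) (All.lookup x∉ (∈-lookup i))
  lookup-injective {x ∷ xs} (_ ∷ xs!)  (Fin.suc i) (Fin.suc j) e = cong Fin.suc (lookup-injective xs! i j e)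

  ∈-∷-≢ : ∀ {x y : A} {zs} → x ∈ y ∷ zs → x ≢ y → x ∈ zs
  ∈-∷-≢ (here e)  x≢y = contradiction e x≢y
  ∈-∷-≢ (there i) _   = i

  -- Pigeonhole by induction on `xs`: the head is cut out of `ys`, and the rest of `xs`, which
  -- avoids the head, still lies in what remains. `unique⇒≤#` and `cover⇒#≤` reduce to this.
  length-⊆ : ∀ {xs ys : List A} → Unique xs → (∀ {x} → x ∈ xs → x ∈ ys) → length xs ≤ length ys
  length-⊆ {[]}     _          _ = z≤n
  length-⊆ {x ∷ xs} (x∉ ∷ xs!) i with ∈-∃++ (i (here refl))
  ... | us , vs , refl = begin
    suc (length xs)  ≤⟨ s≤s (length-⊆ xs! sub) ⟩
    suc (length (us ++ vs))  ≡⟨ cong suc (length-++ us) ⟩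
    suc (length us + length vs) ≡⟨ +-suc (length us) (length vs) ⟨
    length us + suc (length vs) ≡⟨ length-++ us ⟨
    length (us ++ x ∷ vs)  ∎
    where
    open ≤-Reasoning
    sub : ∀ {z} → z ∈ xs → z ∈ us ++ vs
    sub z∈ with ∈-++⁻ us (i (there z∈))
    ... | inj₁ p = ∈-++⁺ˡ p
    ... | inj₂ p = ∈-++⁺ʳ us (∈-∷-≢ p λ z≡x → All.lookup x∉ z∈ (sym z≡x))

-- Cardinalities of decidable subsets and double counting

⟦_⟧ : ∀ {P : Set} → Dec P → ℕ
⟦ p ⟧ = if does p then 1 else 0

∑ : (A : FiniteSet) → (Carrier A → ℕ) → ℕ
∑ A f = sum (λ i → f (Inverse.from (FiniteSet.enum A) i))

module Counting (A : FiniteSet) where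

  open FiniteSet A using (#; enum)

  private
    el : Fin (size A) → Carrier A
    el = Inverse.from enum

  ∑-cong : ∀ {f g : Carrier A → ℕ} → (∀ x → f x ≡ g x) → ∑ A f ≡ ∑ A g
  ∑-cong e = sum-cong-≗ (λ i → e (el i))

  ∑-mono : ∀ {f g : Carrier A → ℕ} → (∀ x → f x ≤ g x) → ∑ A f ≤ ∑ A g
  ∑-mono {f} {g} e = go (λ i → e (el i))
    where
    go : ∀ {n} {f g : Fin n → ℕ} → (∀ i → f i ≤ g i) → sum f ≤ sum g
    go {zero}  _ = z≤n
    go {suc n} h = +-mono-≤ (h Fin.zero) (go (h ∘ Fin.suc))

  ∑-+ : ∀ (f g : Carrier A → ℕ) → ∑ A (λ x → f x + g x) ≡ ∑ A f + ∑ A g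
  ∑-+ f g = ∑-distrib-+ (λ i → f (el i)) (λ i → g (el i))

  ∑-*ˡ : ∀ c (f : Carrier A → ℕ) → ∑ A (λ x → c * f x) ≡ c * ∑ A f
  ∑-*ˡ c f = sym (*-distribˡ-sum c (λ i → f (el i)))

  ∑-*ʳ : ∀ c (f : Carrier A → ℕ) → ∑ A (λ x → f x * c) ≡ ∑ A f * c
  ∑-*ʳ c f = sym (*-distribʳ-sum c (λ i → f (el i)))

  #≡∑ : ∀ {P : Pred (Carrier A) 0ℓ} (P? : Decidable₁ P) → # P? ≡ ∑ A (λ x → ⟦ P? x ⟧)
  #≡∑ P? = go (Inverse.from enum)
    where
    go : ∀ {n} (f : Fin n → Carrier A) → Vec.count P? (Vec.tabulate f) ≡ sum (λ i → ⟦ P? (f i) ⟧)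
    go {zero}  f = refl
    go {suc n} f with does (P? (f Fin.zero))
    ... | true = cong suc (go (f ∘ Fin.suc))
    ... | false = go (f ∘ Fin.suc)

  members : ∀ {P : Pred (Carrier A) 0ℓ} → Decidable₁ P → List (Carrier A)
  members P? = filter P? (List.tabulate (Inverse.from enum))

  module _ {P : Pred (Carrier A) 0ℓ} (P? : Decidable₁ P) where

    members-unique : Unique (members P?)
    members-unique = Unique.filter⁺ P? (Unique.tabulate⁺ (λ {i} {j} e →
      trans (sym (Inverse.strictlyInverseˡ enum i)) (trans (cong (Inverse.to enum) e) (Inverse.strictlyInverseˡ enum j))))

    ∈-members⁺ : ∀ {x} → P x → x ∈ members P?
    ∈-members⁺ {x} px = ∈-filter⁺ P?
      (subst (_∈ List.tabulate el) (Inverse.strictlyInverseʳ enum x) (∈-tabulate⁺ {f = el} (Inverse.to enum x))) px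

    ∈-members⁻ : ∀ {x} → x ∈ members P? → P x
    ∈-members⁻ i = proj₂ (∈-filter⁻ P? {xs = List.tabulate (Inverse.from enum)} i)

    length-members : length (members P?) ≡ # P?
    length-members = go (Inverse.from enum)
      where
      go : ∀ {n} (f : Fin n → Carrier A) → length (filter P? (List.tabulate f)) ≡ Vec.count P? (Vec.tabulate f)
      go {zero}  f = refl
      go {suc n} f with does (P? (f Fin.zero))
      ... | true = cong suc (go (f ∘ Fin.suc))
      ... | false = go (f ∘ Fin.suc)

    unique⇒≤# : ∀ {xs} → Unique xs → (∀ {x} → x ∈ xs → P x) → length xs ≤ # P?
    unique⇒≤# xs! h = ≤-trans (length-⊆ xs! (∈-members⁺ ∘ h)) (≤-reflexive length-members)

    cover⇒#≤ : ∀ {xs} → (∀ {x} → P x → x ∈ xs) → # P? ≤ length xs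
    cover⇒#≤ h = ≤-trans (≤-reflexive (sym length-members)) (length-⊆ members-unique (h ∘ ∈-members⁻))

    #≡0 : (∀ {x} → ¬ P x) → # P? ≡ 0
    #≡0 none = n≤0⇒n≡0 (cover⇒#≤ {[]} (λ px → contradiction px none))

    #>0 : ∀ {x} → P x → 1 ≤ # P?
    #>0 px = unique⇒≤# ([] ∷ []) λ { (here refl) → px ; (there ()) }

    #>0⁻ : 1 ≤ # P? → ∃[ x ] P x
    #>0⁻ le with members P? in eq | ∈-members⁻
    ... | []    | _ = contradiction (≤-trans le (≤-reflexive (trans (sym length-members) (cong length eq)))) λ ()
    ... | x ∷ _ | h = x , h (here refl)

    #≡1⁻ : # P? ≡ 1 → ∃[ x ] (P x × ∀ y → P y → y ≡ x)
    #≡1⁻ e with #>0⁻ (≤-reflexive (sym e))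
    ... | x , px = x , px , λ y py → decidable-stable (FiniteSet._≟_ A y x) λ y≢x →
      contradiction (≤-trans (unique⇒≤# ((y≢x ∷ []) ∷ [] ∷ []) λ
        { (here refl) → py ; (2nd refl) → px ; (there (there ())) }) (≤-reflexive e)) λ { (s≤s ()) }

  another : ∀ {P : Pred (Carrier A) 0ℓ} (P? : Decidable₁ P) → 2 ≤ # P? → ∀ x → ∃[ y ] (P y × y ≢ x)
  another P? le x with members P? in eq | ∈-members⁻ P? | members-unique P?
  ... | [] | _ | _ = contradiction (≤-trans le (≤-reflexive (trans (sym (length-members P?)) (cong length eq)))) λ ()
  ... | _ ∷ [] | _ | _ = contradiction (≤-trans le (≤-reflexive (trans (sym (length-members P?)) (cong length eq)))) λ { (s≤s ()) }
  ... | y ∷ z ∷ _ | h | (y≢z ∷ _) ∷ _ with FiniteSet._≟_ A y x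
  ...   | no y≢x = y , h (here refl) , y≢x
  ...   | yes refl = z , h (2nd refl) , ≢-sym y≢z

  module _ {P Q : Pred (Carrier A) 0ℓ} (P? : Decidable₁ P) (Q? : Decidable₁ Q) where

    #-split : # P? ≡ # (λ x → P? x ×-dec Q? x) + # (λ x → P? x ×-dec ¬? (Q? x))
    #-split = trans (#≡∑ P?) (trans (∑-cong pt) (trans (∑-+ (λ x → ⟦ P? x ×-dec Q? x ⟧) (λ x → ⟦ P? x ×-dec ¬? (Q? x) ⟧)) (sym (cong₂ _+_ (#≡∑ _) (#≡∑ _)))))
      where
      pt : ∀ x → ⟦ P? x ⟧ ≡ ⟦ P? x ×-dec Q? x ⟧ + ⟦ P? x ×-dec ¬? (Q? x) ⟧
      pt x with does (P? x) | does (Q? x)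
      ... | true  | true = refl
      ... | true  | false = refl
      ... | false | _ = refl

    #-∪∩ : # P? + # Q? ≡ # (λ x → P? x ⊎-dec Q? x) + # (λ x → P? x ×-dec Q? x)
    #-∪∩ = trans (cong₂ _+_ (#≡∑ P?) (#≡∑ Q?)) (trans (sym (∑-+ (λ x → ⟦ P? x ⟧) (λ x → ⟦ Q? x ⟧)))
      (trans (∑-cong pt) (trans (∑-+ (λ x → ⟦ P? x ⊎-dec Q? x ⟧) (λ x → ⟦ P? x ×-dec Q? x ⟧)) (sym (cong₂ _+_ (#≡∑ _) (#≡∑ _))))))
      where
      pt : ∀ x → ⟦ P? x ⟧ + ⟦ Q? x ⟧ ≡ ⟦ P? x ⊎-dec Q? x ⟧ + ⟦ P? x ×-dec Q? x ⟧
      pt x with does (P? x) | does (Q? x)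
      ... | true  | true = refl
      ... | true  | false = refl
      ... | false | true = refl
      ... | false | false = refl

    -- The usual source of sharp bounds below: `xs` collects known elements of `Q` outside `P`, and
    -- it is concatenated with the members of `P` without repetition.
    #-mono-+ : ∀ {xs} → Unique xs → (∀ {x} → x ∈ xs → Q x × ¬ P x) → (∀ {x} → P x → Q x) → length xs + # P? ≤ # Q?
    #-mono-+ {xs} xs! h i = ≤-trans (≤-reflexive (trans (cong (length xs +_) (sym (length-members P?))) (sym (length-++ xs))))
      (unique⇒≤# Q? (Unique.++⁺ xs! (members-unique P?) λ { (p , q) → proj₂ (h p) (∈-members⁻ P? q) })
        λ m → case (∈-++⁻ xs m))
      where
      case : ∀ {x} → x ∈ xs ⊎ x ∈ members P? → Q x
      case (inj₁ p) = proj₁ (h p)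
      case (inj₂ p) = i (∈-members⁻ P? p)

    #-≤-suc : ∀ {a} → (∀ {x} → P x → x ≡ a ⊎ Q x) → # P? ≤ suc (# Q?)
    #-≤-suc {a} h = ≤-trans (cover⇒#≤ P? {a ∷ members Q?} (λ px → case (h px))) (s≤s (≤-reflexive (length-members Q?)))
      where
      case : ∀ {x} → x ≡ a ⊎ Q x → x ∈ a ∷ members Q?
      case (inj₁ e)  = here e
      case (inj₂ qx) = there (∈-members⁺ Q? qx)

    #-mono : (∀ {x} → P x → Q x) → # P? ≤ # Q?
    #-mono = #-mono-+ [] λ ()

  #-cong : ∀ {P Q : Pred (Carrier A) 0ℓ} (P? : Decidable₁ P) (Q? : Decidable₁ Q) → (∀ {x} → P x → Q x) → (∀ {x} → Q x → P x) → # P? ≡ # Q?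
  #-cong P? Q? f g = ≤-antisym (#-mono P? Q? f) (#-mono Q? P? g)

  #-all : # {λ _ → ⊤} (λ _ → yes tt) ≡ size A
  #-all = go (Inverse.from enum)
    where
    go : ∀ {n} (f : Fin n → Carrier A) → Vec.count {P = λ _ → ⊤} (λ _ → yes tt) (Vec.tabulate f) ≡ n
    go {zero}  f = refl
    go {suc n} f = cong suc (go (f ∘ Fin.suc))

  #-complement : {P : Pred (Carrier A) 0ℓ} (P? : Decidable₁ P) → # P? + # (λ x → ¬? (P? x)) ≡ size A
  #-complement P? = trans (sym (cong₂ _+_ (drop⊤ P?) (drop⊤ (λ x → ¬? (P? x))))) (trans (sym (#-split (λ _ → yes tt) P?)) #-all)
    where
    drop⊤ : {P : Pred (Carrier A) 0ℓ} (P? : Decidable₁ P) → # (λ x → yes tt ×-dec P? x) ≡ # P?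
    drop⊤ P? = #-cong (λ x → yes tt ×-dec P? x) P? proj₂ (tt ,_)

module Counting₂ (A B : FiniteSet) where

  private
    module A = Counting A
    module B = Counting B
  open FiniteSet A using () renaming (# to #ᴬ)
  open FiniteSet B using () renaming (# to #ᴮ)

  #-injective : {P : Pred (Carrier A) 0ℓ} {Q : Pred (Carrier B) 0ℓ} (P? : Decidable₁ P) (Q? : Decidable₁ Q) →
                (f : Carrier A → Carrier B) → (∀ {x} → P x → Q (f x)) → (∀ {x y} → P x → P y → f x ≡ f y → x ≡ y) →
                #ᴬ P? ≤ #ᴮ Q?
  #-injective {P} {Q} P? Q? f h inj = subst (_≤ #ᴮ Q?) (trans (length-map f (A.members P?)) (A.length-members P?))
    (B.unique⇒≤# Q? (map-unique (A.members P?) (A.∈-members⁻ P?) (A.members-unique P?)) (image (A.members P?) (A.∈-members⁻ P?)))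
    where
    image : ∀ xs → (∀ {x} → x ∈ xs → P x) → ∀ {y} → y ∈ List.map f xs → Q y
    image (x ∷ xs) g (here refl) = h (g (here refl))
    image (x ∷ xs) g (there i)   = image xs (g ∘ there) i

    fresh : ∀ {x} → P x → ∀ xs → (∀ {x} → x ∈ xs → P x) → All (x ≢_) xs → All (f x ≢_) (List.map f xs)
    fresh px []       g []         = []
    fresh px (y ∷ ys) g (x≢y ∷ ne) = (λ e → x≢y (inj px (g (here refl)) e)) ∷ fresh px ys (g ∘ there) ne

    map-unique : ∀ xs → (∀ {x} → x ∈ xs → P x) → Unique xs → Unique (List.map f xs)
    map-unique []       g []         = []
    map-unique (x ∷ xs) g (x∉ ∷ xs!) = fresh (g (here refl)) xs (g ∘ there) x∉ ∷ map-unique xs (g ∘ there) xs!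

  #-surjective : {P : Pred (Carrier A) 0ℓ} {Q : Pred (Carrier B) 0ℓ} (P? : Decidable₁ P) (Q? : Decidable₁ Q) →
                 (f : Carrier A → Carrier B) → (∀ {y} → Q y → ∃[ x ] (P x × f x ≡ y)) → #ᴮ Q? ≤ #ᴬ P?
  #-surjective P? Q? f s = subst (#ᴮ Q? ≤_) (trans (length-map f (A.members P?)) (A.length-members P?))
    (B.cover⇒#≤ Q? λ qy → let x , px , e = s qy in subst (_∈ List.map f (A.members P?)) e (∈-map⁺ f (A.∈-members⁺ P? px)))

  ∑-swap : ∀ (f : Carrier A → Carrier B → ℕ) → ∑ A (λ x → ∑ B (f x)) ≡ ∑ B (λ y → ∑ A (λ x → f x y))
  ∑-swap f = ∑-comm (λ i j → f (Inverse.from (FiniteSet.enum A) i) (Inverse.from (FiniteSet.enum B) j))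

  weighted-# : {Q : Pred (Carrier B) 0ℓ} {R : Pred (Carrier B) 0ℓ} (Q? : Decidable₁ Q) (R? : Decidable₁ R) →
               ∀ c → c * #ᴮ (λ y → Q? y ×-dec R? y) ≡ ∑ B (λ y → c * (⟦ Q? y ⟧ * ⟦ R? y ⟧))
  weighted-# Q? R? c = trans (cong (c *_) (trans (B.#≡∑ (λ y → Q? y ×-dec R? y)) (B.∑-cong pt)))
                             (sym (B.∑-*ˡ c (λ y → ⟦ Q? y ⟧ * ⟦ R? y ⟧)))
    where
    pt : ∀ y → ⟦ Q? y ×-dec R? y ⟧ ≡ ⟦ Q? y ⟧ * ⟦ R? y ⟧
    pt y with does (Q? y) | does (R? y)
    ... | true  | true = refl
    ... | true  | false = refl
    ... | false | _ = refl

module DoubleCounting (A B : FiniteSet) {P : Pred (Carrier A) 0ℓ} {Q : Pred (Carrier B) 0ℓ} {R : REL (Carrier A) (Carrier B) 0ℓ}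
         (P? : Decidable₁ P) (Q? : Decidable₁ Q) (R? : ∀ x y → Dec (R x y)) where

  private
    module A = Counting A
    module B = Counting B
  open FiniteSet A using () renaming (# to #ᴬ)
  open FiniteSet B using () renaming (# to #ᴮ)

  -- Both sides count the pairs in `R` between `P` and `Q`, written as a double sum of products of
  -- indicators.
  ∑-flags : ∑ A (λ x → ⟦ P? x ⟧ * #ᴮ (λ y → Q? y ×-dec R? x y)) ≡ ∑ B (λ y → ⟦ Q? y ⟧ * #ᴬ (λ x → P? x ×-dec R? x y))
  ∑-flags = begin
    ∑ A (λ x → ⟦ P? x ⟧ * #ᴮ (λ y → Q? y ×-dec R? x y))  ≡⟨ A.∑-cong (λ x → Counting₂.weighted-# A B Q? (R? x) ⟦ P? x ⟧) ⟩
    ∑ A (λ x → ∑ B (λ y → ⟦ P? x ⟧ * (⟦ Q? y ⟧ * ⟦ R? x y ⟧)))  ≡⟨ Counting₂.∑-swap A B (λ x y → ⟦ P? x ⟧ * (⟦ Q? y ⟧ * ⟦ R? x y ⟧)) ⟩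
    ∑ B (λ y → ∑ A (λ x → ⟦ P? x ⟧ * (⟦ Q? y ⟧ * ⟦ R? x y ⟧)))  ≡⟨ B.∑-cong (λ y → A.∑-cong (λ x → swap* ⟦ P? x ⟧ ⟦ Q? y ⟧ ⟦ R? x y ⟧)) ⟩
    ∑ B (λ y → ∑ A (λ x → ⟦ Q? y ⟧ * (⟦ P? x ⟧ * ⟦ R? x y ⟧)))  ≡⟨ B.∑-cong (λ y → Counting₂.weighted-# B A P? (λ x → R? x y) ⟦ Q? y ⟧) ⟨
    ∑ B (λ y → ⟦ Q? y ⟧ * #ᴬ (λ x → P? x ×-dec R? x y))  ∎
    where
    open ≡-Reasoning
    swap* : ∀ a b c → a * (b * c) ≡ b * (a * c)
    swap* a b c = trans (sym (*-assoc a b c)) (trans (cong (_* c) (*-comm a b)) (*-assoc b a c))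

  -- Bounds on the two sides suffice for an inequality; exact counts are obtained by applying it
  -- twice, with the two sets exchanged.
  double-count : ∀ p q → (∀ x → P x → p ≤ #ᴮ (λ y → Q? y ×-dec R? x y)) →
                 (∀ y → Q y → #ᴬ (λ x → P? x ×-dec R? x y) ≤ q) → #ᴬ P? * p ≤ #ᴮ Q? * q
  double-count p q lo hi = begin
    #ᴬ P? * p  ≡⟨ cong (_* p) (A.#≡∑ P?) ⟩
    ∑ A (λ x → ⟦ P? x ⟧) * p  ≡⟨ A.∑-*ʳ p (λ x → ⟦ P? x ⟧) ⟨
    ∑ A (λ x → ⟦ P? x ⟧ * p)  ≤⟨ A.∑-mono lo′ ⟩
    ∑ A (λ x → ⟦ P? x ⟧ * #ᴮ (λ y → Q? y ×-dec R? x y))  ≡⟨ ∑-flags ⟩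
    ∑ B (λ y → ⟦ Q? y ⟧ * #ᴬ (λ x → P? x ×-dec R? x y))  ≤⟨ B.∑-mono hi′ ⟩
    ∑ B (λ y → ⟦ Q? y ⟧ * q)  ≡⟨ B.∑-*ʳ q (λ y → ⟦ Q? y ⟧) ⟩
    ∑ B (λ y → ⟦ Q? y ⟧) * q  ≡⟨ cong (_* q) (B.#≡∑ Q?) ⟨
    #ᴮ Q? * q  ∎
    where
    open ≤-Reasoning
    lo′ : ∀ x → ⟦ P? x ⟧ * p ≤ ⟦ P? x ⟧ * #ᴮ (λ y → Q? y ×-dec R? x y)
    lo′ x with P? x
    ... | yes px = +-monoˡ-≤ 0 (lo x px)
    ... | no  _ = z≤n
    hi′ : ∀ y → ⟦ Q? y ⟧ * #ᴬ (λ x → P? x ×-dec R? x y) ≤ ⟦ Q? y ⟧ * q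
    hi′ y with Q? y
    ... | yes qy = +-monoˡ-≤ 0 (hi y qy)
    ... | no  _ = z≤n

-- Common neighbours and distant vertices

module Neighbours (Γ : Graph) where

  open Graph Γ
  open FiniteSet vertices using (#; _≟_)
  open Counting vertices

  -- In a triangle-free graph this is distance 0 or 2, since a vertex that has a neighbour is joined
  -- to itself.
  Joined : V → V → Set
  Joined x y = ∃[ z ] (Adj x z × Adj y z)

  joined? : ∀ x y → Dec (Joined x y)
  joined? x y = map′ (#>0⁻ (λ z → adj? x z ×-dec adj? y z)) (λ (z , h) → #>0 (λ z → adj? x z ×-dec adj? y z) h)
                     (1 ≤? #commonNeighbours x y)

  joined-sym : ∀ {x y} → Joined x y → Joined y x
  joined-sym (z , x~z , y~z) = z , y~z , x~z

  apart : ∀ {v w z} → Adj z v → ¬ Adj z w → v ≢ w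
  apart z~v z≁w refl = z≁w z~v

  at-most-two : ∀ {v w c d e} → #commonNeighbours v w ≡ 2 → c ≢ d → c ≢ e → d ≢ e →
                Adj v c → Adj w c → Adj v d → Adj w d → Adj v e → Adj w e → ⊥
  at-most-two {v} {w} {c} {d} {e} #≡2 c≢d c≢e d≢e vc wc vd wd ve we = contradiction
    (≤-trans (unique⇒≤# (λ z → adj? v z ×-dec adj? w z) {c ∷ d ∷ e ∷ []} ((c≢d ∷ c≢e ∷ []) ∷ (d≢e ∷ []) ∷ [] ∷ [])
       λ { (here refl) → vc , wc ; (2nd refl) → vd , wd ; (3rd refl) → ve , we })
     (≤-reflexive #≡2)) λ { (s≤s (s≤s ())) }

  -- d(x, u) ≥ 4
  record Far (x u : V) : Set where
    field
      no0 : x ≢ u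
      no1 : ¬ Adj x u
      no2 : ∀ {p} → Adj x p → Adj u p → ⊥
      no3 : ∀ {p q} → Adj x p → Adj p q → Adj u q → ⊥

  far-sym : ∀ {x u} → Far x u → Far u x
  far-sym F = record
    { no0 = ≢-sym no0 ; no1 = no1 ∘ symm ; no2 = λ a b → no2 b a ; no3 = λ a b c → no3 c (symm b) a }
    where open Far F

  far : ∀ {x u} → Distance x u 4 → Far x u
  far {x} {u} (_ , lower) = record
    { no0 = λ { refl → contradiction (lower 0 []) λ () }
    ; no1 = λ a → contradiction (lower 1 (a ∷ [])) λ { (s≤s ()) }
    ; no2 = λ a b → contradiction (lower 2 (a ∷ symm b ∷ [])) λ { (s≤s (s≤s ())) }
    ; no3 = λ a b c → contradiction (lower 3 (a ∷ b ∷ symm c ∷ [])) λ { (s≤s (s≤s (s≤s ()))) }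
    }

  -- No vertex is adjacent to both `x` and `u`, so the two sets of μ neighbours of `y` are disjoint,
  -- and `w ≢ w′` would make 2μ + 2 neighbours.
  remaining-unique : ∀ {μ x u y w w′} → Far x u → #commonNeighbours x y ≡ μ → #commonNeighbours u y ≡ μ → degree y ≡ suc (μ + μ) →
                     Adj y w → Adj y w′ → ¬ Adj x w → ¬ Adj u w → ¬ Adj x w′ → ¬ Adj u w′ → w ≡ w′
  remaining-unique {μ} {x} {u} {y} {w} {w′} F #A #B deg y~w y~w′ x≁w u≁w x≁w′ u≁w′ =
    decidable-stable (FiniteSet._≟_ vertices w w′) λ w≢w′ →
      <-irrefl refl (≤-trans (s≤s (s≤s (≤-reflexive (trans (sym (cong₂ _+_ #A #B))
        (trans (#-∪∩ A? B?) (trans (cong (# (λ z → A? z ⊎-dec B? z) +_)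
          (#≡0 (λ z → A? z ×-dec B? z) λ ((x~z , _) , (u~z , _)) → Far.no2 F x~z u~z)) (+-identityʳ _)))))))
      (≤-trans (#-mono-+ (λ z → A? z ⊎-dec B? z) (adj? y) ((w≢w′ ∷ []) ∷ [] ∷ []) new λ { (inj₁ (_ , a)) → a ; (inj₂ (_ , a)) → a })
        (≤-reflexive deg)))
    where
    A? = λ z → adj? x z ×-dec adj? y z
    B? = λ z → adj? u z ×-dec adj? y z
    new : ∀ {z} → z ∈ w ∷ w′ ∷ [] → Adj y z × ¬ ((Adj x z × Adj y z) ⊎ (Adj u z × Adj y z))
    new (here refl) = y~w  , λ { (inj₁ (a , _)) → x≁w a ; (inj₂ (a , _)) → u≁w a }
    new (2nd refl) = y~w′ , λ { (inj₁ (a , _)) → x≁w′ a ; (inj₂ (a , _)) → u≁w′ a }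

  -- Counts the pairs (z, w) with v ~ z ~ w and w ≠ v: each of the d + 1 vertices z has d further
  -- neighbours w, and each w occurs with μ vertices z.
  #joined*μ : ∀ {d μ} → Regular (suc d) → (∀ {x y} → x ≢ y → Joined x y → #commonNeighbours x y ≡ μ) →
              ∀ v → # (λ w → ¬? (w ≟ v) ×-dec joined? v w) * μ ≡ suc d * d
  #joined*μ {d} {μ} regular common v = trans (≤-antisym
      (DoubleCounting.double-count vertices vertices S? (adj? v) adj? μ d (λ w s → ≤-reflexive (sym (joinedμ w s))) (λ z v~z → ≤-reflexive (rest z v~z)))
      (DoubleCounting.double-count vertices vertices (adj? v) S? adj? d μ (λ z v~z → ≤-reflexive (sym (trans (flip-# z) (rest z v~z)))) (λ w s → ≤-reflexive (trans (flip-#′ w) (joinedμ w s)))))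
    (cong (_* d) (regular v))
    where
    S? = λ w → ¬? (w ≟ v) ×-dec joined? v w
    joinedμ : ∀ w → w ≢ v × Joined v w → # (λ z → adj? v z ×-dec adj? w z) ≡ μ
    joinedμ w (w≢v , J) = common (≢-sym w≢v) J
    rest : ∀ z → Adj v z → # (λ w → S? w ×-dec adj? w z) ≡ d
    rest z v~z = suc-injective (trans (≤-antisym
      (#-mono-+ (λ w → S? w ×-dec adj? w z) (adj? z) ([] ∷ []) (λ { (here refl) → symm v~z , λ ((ne , _) , _) → ne refl }) λ (_ , w~z) → symm w~z)
      (#-≤-suc (adj? z) (λ w → S? w ×-dec adj? w z) {v} sub)) (regular z))
      where
      sub : ∀ {w} → Adj z w → w ≡ v ⊎ ((w ≢ v × Joined v w) × Adj w z)
      sub {w} z~w with w ≟ v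
      ... | yes e = inj₁ e
      ... | no ne = inj₂ ((ne , z , v~z , symm z~w) , symm z~w)
    flip-# : ∀ z → # (λ w → S? w ×-dec adj? z w) ≡ # (λ w → S? w ×-dec adj? w z)
    flip-# z = #-cong (λ w → S? w ×-dec adj? z w) (λ w → S? w ×-dec adj? w z) (λ (s , a) → s , symm a) (λ (s , a) → s , symm a)
    flip-#′ : ∀ w → # (λ z → adj? v z ×-dec adj? z w) ≡ # (λ z → adj? v z ×-dec adj? w z)
    flip-#′ w = #-cong (λ z → adj? v z ×-dec adj? z w) (λ z → adj? v z ×-dec adj? w z) (λ (s , a) → s , symm a) (λ (s , a) → s , symm a)

  -- Every edge has one end in each class; counting the edges from either class gives its size times
  -- the common degree.
  equal-sides : ∀ {d} → Regular (suc d) → {P : V → Set} (P? : ∀ v → Dec (P v)) →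
                (∀ {v w} → Adj v w → P v → ¬ P w) → (∀ {v w} → Adj v w → ¬ P v → P w) → # (λ v → ¬? (P? v)) ≡ # P?
  equal-sides {d} regular P? PQ QP = *-cancelʳ-≡ (# Q?) (# P?) (suc d) (≤-antisym
      (DoubleCounting.double-count vertices vertices Q? P? adj? (suc d) (suc d)
        (λ v B → ≤-trans (≤-reflexive (sym (regular v))) (#-mono (adj? v) (λ w → P? w ×-dec adj? v w) λ a → QP a B , a))
        (λ w _ → ≤-trans (#-mono (λ v → Q? v ×-dec adj? v w) (adj? w) (symm ∘ proj₂)) (≤-reflexive (regular w))))
      (DoubleCounting.double-count vertices vertices P? Q? adj? (suc d) (suc d)
        (λ v P → ≤-trans (≤-reflexive (sym (regular v))) (#-mono (adj? v) (λ w → Q? w ×-dec adj? v w) λ a → PQ a P , a))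
        (λ w _ → ≤-trans (#-mono (λ v → P? v ×-dec adj? v w) (adj? w) (symm ∘ proj₂)) (≤-reflexive (regular w)))))
    where
    Q? = λ v → ¬? (P? v)

  walk-closed : ∀ {S : V → Set} → (∀ {v w} → S v → Adj v w → S w) → ∀ {v w n} → Walk v w n → S v → S w
  walk-closed step []      s = s
  walk-closed step (a ∷ p) s = walk-closed step p (step s a)

-- Absence of triangles

module TriangleFree {Γ : Graph} {v k lam μ : ℕ} (AR : AmplyRegular Γ v k lam μ) (k≡2μ+1 : k ≡ suc (μ + μ)) (2≤μ : 2 ≤ μ) where

  open Graph Γ
  open FiniteSet vertices using (#)
  open Counting vertices
  open Neighbours Γ
  open AmplyRegular AR

  common≡μ : ∀ {x y} → x ≢ y → ¬ Adj x y → Joined x y → #commonNeighbours x y ≡ μ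
  common≡μ {x} {y} x≢y x≁y (z , x~z , y~z) = dist-two x y (x~z ∷ symm y~z ∷ [] , lower)
    where
    lower : ∀ m → Walk x y m → 2 ≤ m
    lower 0 []              = contradiction refl x≢y
    lower 1 (x~y ∷ [])      = contradiction x~y x≁y
    lower (suc (suc m)) _   = s≤s (s≤s z≤n)

  module Mid {x u y} (F : Far x u) (Jx : Joined x y) (Ju : Joined u y) where
    open Far F

    x≢y : x ≢ y
    x≢y refl = let z , u~z , x~z = Ju in no2 x~z u~z

    x≁y : ¬ Adj x y
    x≁y x~y = let z , u~z , y~z = Ju in no3 x~y y~z u~z

    common-x : # (λ z → adj? x z ×-dec adj? y z) ≡ μ
    common-x = common≡μ x≢y x≁y Jx

  rest-unique : ∀ {x u y w w′} → Far x u → Joined x y → Joined u y → Adj y w → Adj y w′ →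
                ¬ Adj x w → ¬ Adj u w → ¬ Adj x w′ → ¬ Adj u w′ → w ≡ w′
  rest-unique {y = y} F Jx Ju = remaining-unique F (Mid.common-x F Jx Ju) (Mid.common-x (far-sym F) Ju Jx) (trans (regular y) k≡2μ+1)

  module _ {x u a y b : V} (F : Far x u) (x~a : Adj x a) (a~y : Adj a y) (y~b : Adj y b) (u~b : Adj u b) where
    private
      Jx : Joined x y
      Jx = a , x~a , symm a~y
      Ju : Joined u y
      Ju = b , u~b , y~b
    open Far F

    local? : ∀ z → Dec ((Adj a z × Adj y z) × Adj x z)
    local? z = (adj? a z ×-dec adj? y z) ×-dec adj? x z

    outer? : ∀ z → Dec ((Adj a z × Adj y z) × ¬ Adj x z)
    outer? z = (adj? a z ×-dec adj? y z) ×-dec ¬? (adj? x z)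

    -- An outer vertex is adjacent to `a`, hence not to `u`, as d(a, u) ≥ 3. So it is the one
    -- neighbour of `y` that is adjacent to neither `x` nor `u`.
    outer-unique : ∀ {z z′} → (Adj a z × Adj y z) × ¬ Adj x z → (Adj a z′ × Adj y z′) × ¬ Adj x z′ → z ≡ z′
    outer-unique ((a~z , y~z) , x≁z) ((a~z′ , y~z′) , x≁z′) =
      rest-unique F Jx Ju y~z y~z′ x≁z (no3 x~a a~z) x≁z′ (no3 x~a a~z′)

    lam-split : lam ≡ # local? + # outer?
    lam-split = trans (sym (adjacent a y a~y)) (#-split (λ z → adj? a z ×-dec adj? y z) (adj? x))

    lam≤ : lam ≤ suc (# local?)
    lam≤ = ≤-trans (≤-reflexive lam-split) (≤-trans (+-monoʳ-≤ (# local?) outer≤1) (≤-reflexive (+-comm _ 1)))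
      where
      outer≤1 : # outer? ≤ 1
      outer≤1 with # outer? in eq
      ... | zero = z≤n
      ... | suc zero = s≤s z≤n
      ... | suc (suc n) = let z , pz = #>0⁻ outer? (subst (1 ≤_) (sym eq) (s≤s z≤n))
                              z′ , pz′ , z′≢z = another outer? (subst (2 ≤_) (sym eq) (s≤s (s≤s z≤n))) z
                          in contradiction (outer-unique pz′ pz) z′≢z

    -- The strictness is due to `a`, which is a common neighbour of `x` and `y` but not adjacent to
    -- itself.
    local<μ : suc (# local?) ≤ μ
    local<μ = ≤-trans (#-mono-+ local? (λ z → adj? x z ×-dec adj? y z) ([] ∷ [])
      (λ { (here refl) → (x~a , symm a~y) , λ ((a~a , _) , _) → irrefl refl a~a }) (λ ((_ , y~z) , x~z) → x~z , y~z))
      (≤-reflexive (Mid.common-x F Jx Ju))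

    lam≤μ : lam ≤ μ
    lam≤μ = ≤-trans lam≤ local<μ

    -- When λ reaches μ, the at most μ - 1 local vertices cannot account for all λ common neighbours
    -- of `a` and `y`.
    outer-exists : μ ≤ lam → ∃[ w ] ((Adj a w × Adj y w) × ¬ Adj x w)
    outer-exists μ≤lam = #>0⁻ outer? (+-cancelˡ-≤ (# local?) 1 (# outer?)
      (≤-trans (≤-reflexive (+-comm _ 1)) (≤-trans local<μ (≤-trans μ≤lam (≤-reflexive lam-split)))))

  module _ {x u a y b : V} (F : Far x u) (x~a : Adj x a) (a~y : Adj a y) (y~b : Adj y b) (u~b : Adj u b) where
    private
      Jx : Joined x y
      Jx = a , x~a , symm a~y
      Ju : Joined u y
      Ju = b , u~b , y~b
    open Far F

    -- If λ ≥ μ, every vertex of Γ(x) ∩ Γ(y) is adjacent to the further neighbour `w` of `y`, and by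
    -- the same argument from `u` so is `b`. Then the adjacent vertices `w` and `y` have at least μ
    -- + 1 common neighbours, although λ ≤ μ.
    lam<μ : lam < μ
    lam<μ = ≰⇒> λ μ≤lam →
      let w , (a~w , y~w) , x≁w   = outer-exists F x~a a~y y~b u~b μ≤lam
          w′ , (b~w′ , y~w′) , u≁w′ = outer-exists (far-sym F) u~b (symm y~b) (symm a~y) x~a μ≤lam
          u≁w : ¬ Adj u w
          u≁w = no3 x~a a~w
          x≁w′ : ¬ Adj x w′
          x≁w′ x~w′ = no3 x~w′ (symm b~w′) u~b
          w≡w′ = rest-unique F Jx Ju y~w y~w′ x≁w u≁w x≁w′ u≁w′
          b~w = subst (Adj b) (sym w≡w′) b~w′
          sub : ∀ {z} → Adj x z × Adj y z → Adj w z × Adj y z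
          sub (x~z , y~z) =
            let w″ , (z~w″ , y~w″) , x≁w″ = outer-exists F x~z (symm y~z) y~b u~b μ≤lam
                e = rest-unique F Jx Ju y~w″ y~w x≁w″ (no3 x~z z~w″) x≁w u≁w
            in subst (λ w → Adj w _) e (symm z~w″) , y~z
      in <-irrefl refl (≤-trans (s≤s (≤-reflexive (sym (Mid.common-x F Jx Ju))))
           (≤-trans (#-mono-+ (λ z → adj? x z ×-dec adj? y z) (λ z → adj? w z ×-dec adj? y z) ([] ∷ [])
             (λ { (here refl) → (symm b~w , y~b) , λ (x~b , _) → no2 x~b u~b }) sub)
           (≤-trans (≤-reflexive (adjacent w y (symm y~w))) (lam≤μ F x~a a~y y~b u~b))))

    C? : ∀ z → Dec (Adj a z × Joined u z)
    C? z = adj? a z ×-dec joined? u z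

    μ≤#C : μ ≤ # C?
    μ≤#C = ≤-trans (≤-reflexive (sym (common≡μ {a} {b} (λ { refl → no2 x~a u~b }) (λ a~b → no3 x~a a~b u~b) (y , a~y , symm y~b))))
      (#-mono (λ z → adj? a z ×-dec adj? b z) C? λ (a~z , b~z) → a~z , b , u~b , symm b~z)

    -- For lam ≥ 2, double counting the edges between C and Γ(a) ∩ Γ(x) gives μ ≤ |C| ≤ lam.
    lam≤1 : lam ≤ 1
    lam≤1 = ≮⇒≥ λ 1<lam → <⇒≱ lam<μ (≤-trans μ≤#C (bound lam refl 1<lam))
      where
      E? = λ z → adj? a z ×-dec adj? x z
      bound : ∀ l → lam ≡ l → 2 ≤ l → # C? ≤ lam
      bound (suc zero) _ (s≤s ())
      bound (suc (suc l)) e _ = *-cancelʳ-≤ (# C?) lam (suc l)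
        (≤-trans (DoubleCounting.double-count vertices vertices C? E? adj? (suc l) (suc l) lo hi)
          (≤-reflexive (cong (_* suc l) (adjacent a x (symm x~a)))))
        where
        lo : ∀ z → Adj a z × Joined u z → suc l ≤ # (λ e → E? e ×-dec adj? z e)
        lo z (a~z , (c , u~c , z~c)) = ≤-pred (≤-trans (≤-reflexive (sym e)) (≤-trans (lam≤ F x~a a~z z~c u~c)
          (s≤s (#-mono (local? F x~a a~z z~c u~c) (λ e → E? e ×-dec adj? z e) λ ((p , q) , r) → (p , r) , q))))
        hi : ∀ e → Adj a e × Adj x e → # (λ z → C? z ×-dec adj? z e) ≤ suc l
        hi f (a~f , x~f) = ≤-pred (≤-trans (#-mono-+ (λ z → C? z ×-dec adj? z f) (λ z → adj? a z ×-dec adj? f z) ([] ∷ [])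
          (λ { (here refl) → (symm x~a , symm x~f) , λ ((_ , (c , u~c , x~c)) , _) → no2 x~c u~c })
          (λ ((a~z , _) , z~f) → a~z , symm z~f)) (≤-reflexive (trans (adjacent a f a~f) e)))

    -- If every edge lies in exactly one triangle, the third vertex of the triangle on `a` and `y`
    -- is not adjacent to `x`, so it is the further neighbour `w` of `y`. As μ ≥ 2, the same happens
    -- with a second vertex `a′`, and the edge between `y` and `w` lies in two triangles.
    lam≢1 : lam ≢ 1
    lam≢1 e =
      let a′ , (x~a′ , y~a′) , a′≢a = another (λ z → adj? x z ×-dec adj? y z) (≤-trans 2≤μ (≤-reflexive (sym (Mid.common-x F Jx Ju)))) a
          w , (a~w , y~w) , x≁w = outer-of x~a (symm a~y)
          w′ , (a′~w′ , y~w′) , x≁w′ = outer-of x~a′ y~a′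
          w≡w′ = rest-unique F Jx Ju y~w y~w′ x≁w (no3 x~a a~w) x≁w′ (no3 x~a′ a′~w′)
      in a′≢a (only-one y~w (symm (subst (Adj a′) (sym w≡w′) a′~w′) , y~a′) (symm a~w , symm a~y))
      where
      only-one : ∀ {p q r s} → Adj p q → Adj q r × Adj p r → Adj q s × Adj p s → r ≡ s
      only-one {p} {q} p~q (q~r , p~r) (q~s , p~s) =
        let t , _ , all≡t = #≡1⁻ (λ z → adj? p z ×-dec adj? q z) (trans (adjacent p q p~q) e)
        in trans (all≡t _ (p~r , q~r)) (sym (all≡t _ (p~s , q~s)))
      outer-of : ∀ {a} → Adj x a → Adj y a → ∃[ w ] ((Adj a w × Adj y w) × ¬ Adj x w)
      outer-of {a} x~a y~a =
        let w , (a~w , y~w) = #>0⁻ (λ z → adj? a z ×-dec adj? y z) (≤-reflexive (sym (trans (adjacent a y (symm y~a)) e)))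
        in w , (a~w , y~w) , λ x~w → Mid.x≢y F Jx Ju (only-one a~w (symm x~w , symm x~a) (symm y~w , symm y~a))

    lam≡0 : lam ≡ 0
    lam≡0 = n<1⇒n≡0 (≤∧≢⇒< lam≤1 lam≢1)

-- Fixed-point-free involutions and group divisible designs

module Pairing (A : FiniteSet) (σ : Carrier A → Carrier A) (σσ : ∀ p → σ (σ p) ≡ p) (σ≢ : ∀ p → σ p ≢ p) where

  open FiniteSet A using (#; enum)
  open Counting A

  private
    pos : Carrier A → ℕ
    pos p = toℕ (Inverse.to enum p)

    pos-injective : ∀ {p q} → pos p ≡ pos q → p ≡ q
    pos-injective {p} {q} e = trans (sym (Inverse.strictlyInverseʳ enum p))
      (trans (cong (Inverse.from enum) (toℕ-injective e)) (Inverse.strictlyInverseʳ enum q))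

    -- Of the two members of a pair {p, σ p}, the representative is the one that comes first in the
    -- enumeration.
    Rep : Carrier A → Set
    Rep p = pos p < pos (σ p)

    rep? : ∀ p → Dec (Rep p)
    rep? p = pos p <? pos (σ p)

    σ-rep : ∀ {p} → ¬ Rep p → Rep (σ p)
    σ-rep {p} ¬r = subst (λ q → pos (σ p) < pos q) (sym (σσ p)) (≤∧≢⇒< (≮⇒≥ ¬r) (λ e → σ≢ p (pos-injective e)))

    σ-¬rep : ∀ {p} → Rep p → ¬ Rep (σ p)
    σ-¬rep {p} r r′ = <-asym r (subst (λ q → pos (σ p) < pos q) (σσ p) r′)

    σ-injective : ∀ {p q} → σ p ≡ σ q → p ≡ q
    σ-injective {p} {q} e = trans (sym (σσ p)) (trans (cong σ e) (σσ q))

    reps : List (Carrier A)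
    reps = members rep?

  -- `σ` exchanges the representatives with the other elements.
  #reps : length reps + length reps ≡ size A
  #reps = trans (cong₂ _+_ (length-members rep?) (trans (length-members rep?)
    (≤-antisym (Counting₂.#-injective A A rep? (λ p → ¬? (rep? p)) σ σ-¬rep (λ _ _ → σ-injective))
               (Counting₂.#-injective A A (λ p → ¬? (rep? p)) rep? σ σ-rep (λ _ _ → σ-injective)))))
    (#-complement rep?)

  private
    orbit : (p : Carrier A) → Σ[ q ∈ Carrier A ] (Rep q × (q ≡ p ⊎ q ≡ σ p))
    orbit p with rep? p
    ... | yes r = p , r , inj₁ refl
    ... | no ¬r = σ p , σ-rep ¬r , inj₂ refl

    index : Carrier A → Fin (length reps)
    index p = Any.index (∈-members⁺ rep? (proj₁ (proj₂ (orbit p))))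

    lookup-orbit : ∀ p → List.lookup reps (index p) ≡ proj₁ (orbit p)
    lookup-orbit p = sym (lookup-index (∈-members⁺ rep? (proj₁ (proj₂ (orbit p)))))

    orbit-σ : ∀ p → proj₁ (orbit (σ p)) ≡ proj₁ (orbit p)
    orbit-σ p with rep? p | rep? (σ p)
    ... | yes r | yes r′ = contradiction r′ (σ-¬rep r)
    ... | yes _ | no  _ = σσ p
    ... | no  _ | yes _ = refl
    ... | no ¬r | no ¬r′ = contradiction (σ-rep ¬r) ¬r′

    orbit-rep : ∀ p → Rep p → proj₁ (orbit p) ≡ p
    orbit-rep p r with rep? p
    ... | yes _ = refl
    ... | no ¬r = contradiction r ¬r

    orbit-≡ : ∀ {p q} → proj₁ (orbit p) ≡ proj₁ (orbit q) → q ≡ p ⊎ q ≡ σ p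
    orbit-≡ {p} {q} e with proj₂ (proj₂ (orbit p)) | proj₂ (proj₂ (orbit q))
    ... | inj₁ a | inj₁ b = inj₁ (trans (sym b) (trans (sym e) a))
    ... | inj₁ a | inj₂ b = inj₂ (σ-injective (trans (sym b) (trans (sym e) (trans a (sym (σσ p))))))
    ... | inj₂ a | inj₁ b = inj₂ (trans (sym b) (trans (sym e) a))
    ... | inj₂ a | inj₂ b = inj₁ (σ-injective (trans (sym b) (trans (sym e) a)))

  -- The pairs {p, σ p} as the fibres of a map onto `Fin m`, which is the form in which `GDD` takes
  -- its partition into groups.
  Labelling : ℕ → Set
  Labelling m = Σ[ group ∈ (Carrier A → Fin m) ]
    ((∀ p q → group p ≡ group q → q ≡ p ⊎ q ≡ σ p) × (∀ p → group (σ p) ≡ group p) × (∀ j → ∃[ p ] (group p ≡ j)))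

  labelling : ∀ {m} → size A ≡ m + m → Labelling m
  labelling {m} e = subst Labelling (halve _ m (trans #reps e))
    (index , (λ p q i≡j → orbit-≡ (trans (sym (lookup-orbit p)) (trans (cong (List.lookup reps) i≡j) (lookup-orbit q))))
           , (λ p → injective (trans (lookup-orbit (σ p)) (trans (orbit-σ p) (sym (lookup-orbit p)))))
           , (λ j → List.lookup reps j , injective (trans (lookup-orbit (List.lookup reps j))
               (orbit-rep (List.lookup reps j) (∈-members⁻ rep? (∈-lookup j))))))
    where
    injective : ∀ {i j} → List.lookup reps i ≡ List.lookup reps j → i ≡ j
    injective {i} {j} = lookup-injective (members-unique rep?) i j
    halve : ∀ a b → a + a ≡ b + b → a ≡ b
    halve a b e with <-cmp a b
    ... | tri≈ _ e′ _ = e′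
    ... | tri< l _ _ = contradiction e (<⇒≢ (+-mono-< l l))
    ... | tri> _ _ g = contradiction (sym e) (<⇒≢ (+-mono-< g g))

pairs⇒GDD : ∀ {m k λ₂} (S : IncidenceStructure) → let open IncidenceStructure S in
  (σ : Carrier points → Carrier points) → (∀ p → σ (σ p) ≡ p) → (∀ p → σ p ≢ p) → size points ≡ m + m →
  (∀ b → blockSize b ≡ k) → (∀ p → #commonBlocks p (σ p) ≡ 0) → (∀ p q → q ≢ p → q ≢ σ p → #commonBlocks p q ≡ λ₂) →
  GDD 2 m k 0 λ₂ S
pairs⇒GDD {m} S σ σσ σ≢ e bs paired unpaired = record
  { group = group ; group-size = size2 ; block-size = bs
  ; same-group = λ p q p≢q g≡ → same p q p≢q (sep p q g≡)
  ; diff-group = λ p q g≢ → unpaired p q (λ { refl → g≢ refl }) (λ { refl → g≢ (sym (gσ p)) }) }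
  where
  open IncidenceStructure S
  open Pairing points σ σσ σ≢
  open Counting points
  group : Carrier points → Fin m
  group = proj₁ (labelling e)
  sep : ∀ p q → group p ≡ group q → q ≡ p ⊎ q ≡ σ p
  sep = proj₁ (proj₂ (labelling e))
  gσ : ∀ p → group (σ p) ≡ group p
  gσ = proj₁ (proj₂ (proj₂ (labelling e)))
  same : ∀ p q → p ≢ q → q ≡ p ⊎ q ≡ σ p → #commonBlocks p q ≡ 0
  same p q p≢q (inj₁ q≡p) = contradiction (sym q≡p) p≢q
  same p q p≢q (inj₂ refl) = paired p
  size2 : ∀ j → FiniteSet.# points (λ p → group p ≟ᶠ j) ≡ 2
  size2 j = go (proj₂ (proj₂ (proj₂ (labelling e))) j)
    where
    go : ∃[ p ] (group p ≡ j) → FiniteSet.# points (λ p → group p ≟ᶠ j) ≡ 2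
    go (p , gp≡j) = ≤-antisym (cover⇒#≤ (λ q → group q ≟ᶠ j) {p ∷ σ p ∷ []} (λ {q} gq → cov (sep p q (trans gp≡j (sym gq)))))
                              (unique⇒≤# (λ q → group q ≟ᶠ j) ((≢-sym (σ≢ p) ∷ []) ∷ [] ∷ []) mem)
      where
      cov : ∀ {q} → q ≡ p ⊎ q ≡ σ p → q ∈ p ∷ σ p ∷ []
      cov (inj₁ e) = here e
      cov (inj₂ e) = 2nd e
      mem : ∀ {q} → q ∈ p ∷ σ p ∷ [] → group q ≡ j
      mem (here refl) = gp≡j
      mem (2nd refl) = trans (gσ p) gp≡j

-- Isomorphisms, and bipartite graphs as incidence graphs

bijective⇒≅ : ∀ {Γ Δ : Graph} (f : Graph.V Δ → Graph.V Γ) → (∀ {i j} → f i ≡ f j → i ≡ j) → (∀ v → ∃[ i ] (f i ≡ v)) →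
              (∀ {i j} → Graph.Adj Δ i j → Graph.Adj Γ (f i) (f j)) → (∀ {i j} → Graph.Adj Γ (f i) (f j) → Graph.Adj Δ i j) → Γ ≅ Δ
bijective⇒≅ {Γ} {Δ} f inj surj hom refl-hom = record
  { bijection = mk↔ₛ′ g f (λ i → inj (proj₂ (surj (f i)))) (λ v → proj₂ (surj v))
  ; adjacency = λ x y → mk⇔ (λ a → refl-hom (subst₂ (Graph.Adj Γ) (sym (proj₂ (surj x))) (sym (proj₂ (surj y))) a))
                            (λ a → subst₂ (Graph.Adj Γ) (proj₂ (surj x)) (proj₂ (surj y)) (hom a)) }
  where
  g : Graph.V Γ → Graph.V Δ
  g v = proj₁ (surj v)

module Members (A : FiniteSet) {P : Carrier A → Set} (P? : ∀ v → Dec (P v)) where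

  open FiniteSet A using (#)
  open Counting A

  Pᵢ : List (Carrier A)
  Pᵢ = members P?

  lookup-P : ∀ i → P (List.lookup Pᵢ i)
  lookup-P i = ∈-members⁻ P? (∈-lookup i)

  lookup-inj : ∀ {i j} → List.lookup Pᵢ i ≡ List.lookup Pᵢ j → i ≡ j
  lookup-inj {i} {j} = lookup-injective (members-unique P?) i j

  at : ∀ {v} → P v → ∃[ i ] (List.lookup Pᵢ i ≡ v)
  at pv = Any.index (∈-members⁺ P? pv) , sym (lookup-index (∈-members⁺ P? pv))

  #-lookup : {R : Carrier A → Set} (R? : ∀ v → Dec (R v)) → (∀ {v} → R v → P v) →
             FiniteSet.# (finFS (length Pᵢ)) (λ i → R? (List.lookup Pᵢ i)) ≡ # R?
  #-lookup {R} R? R⊆P = ≤-antisym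
    (Counting₂.#-injective (finFS (length Pᵢ)) A _ R? (List.lookup Pᵢ) id (λ _ _ → lookup-inj))
    (Counting₂.#-surjective (finFS (length Pᵢ)) A (λ i → R? (List.lookup Pᵢ i)) R? (List.lookup Pᵢ)
      λ rv → let i , e = at (R⊆P rv) in i , subst R (sym e) rv , e)

module Sides (Γ : Graph) {P Q : Graph.V Γ → Set} (P? : ∀ v → Dec (P v)) (Q? : ∀ v → Dec (Q v))
             (side : ∀ v → P v ⊎ Q v) (P∩Q : ∀ {v} → P v → Q v → ⊥)
             (PQ : ∀ {v w} → Graph.Adj Γ v w → P v → Q w) (QP : ∀ {v w} → Graph.Adj Γ v w → Q v → P w) where

  open Graph Γ
  module Pₘ = Members vertices P?
  module Qₘ = Members vertices Q?
  open Pₘ public using (Pᵢ)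
  open Qₘ public using () renaming (Pᵢ to Qᵢ)

  structure : IncidenceStructure
  structure = record
    { points = finFS (length Pᵢ) ; blocks = finFS (length Qᵢ)
    ; Inc = λ i j → Adj (List.lookup Pᵢ i) (List.lookup Qᵢ j) ; inc? = λ i j → adj? (List.lookup Pᵢ i) (List.lookup Qᵢ j) }

  isomorphic : Γ ≅ incidenceGraph structure
  isomorphic = bijective⇒≅ {Γ} {incidenceGraph structure} f (λ {i} {j} → inj i j) surj (λ {i} {j} → hom i j) (λ {i} {j} → hom⁻ i j)
    where
    f : Fin (length Pᵢ) ⊎ Fin (length Qᵢ) → V
    f (inj₁ i) = List.lookup Pᵢ i
    f (inj₂ i) = List.lookup Qᵢ i
    inj : ∀ i j → f i ≡ f j → i ≡ j
    inj (inj₁ i) (inj₁ j) e = cong inj₁ (Pₘ.lookup-inj e)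
    inj (inj₂ i) (inj₂ j) e = cong inj₂ (Qₘ.lookup-inj e)
    inj (inj₁ i) (inj₂ j) e = ⊥-elim (P∩Q (subst P e (Pₘ.lookup-P i)) (Qₘ.lookup-P j))
    inj (inj₂ i) (inj₁ j) e = ⊥-elim (P∩Q (Pₘ.lookup-P j) (subst Q e (Qₘ.lookup-P i)))
    surj : ∀ v → ∃[ i ] (f i ≡ v)
    surj v with side v
    ... | inj₁ pv = let i , e = Pₘ.at pv in inj₁ i , e
    ... | inj₂ qv = let i , e = Qₘ.at qv in inj₂ i , e
    hom : ∀ i j → Graph.Adj (incidenceGraph structure) i j → Adj (f i) (f j)
    hom (inj₁ i) (inj₂ j) a = a
    hom (inj₂ i) (inj₁ j) a = symm a
    hom⁻ : ∀ i j → Adj (f i) (f j) → Graph.Adj (incidenceGraph structure) i j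
    hom⁻ (inj₁ i) (inj₂ j) a = a
    hom⁻ (inj₂ i) (inj₁ j) a = symm a
    hom⁻ (inj₁ i) (inj₁ j) a = P∩Q (Pₘ.lookup-P j) (PQ a (Pₘ.lookup-P i))
    hom⁻ (inj₂ i) (inj₂ j) a = P∩Q (QP a (Qₘ.lookup-P i)) (Qₘ.lookup-P j)

-- Graphs in which joined vertices have μ common neighbours

module MuGraph (Γ : Graph) {μ : ℕ} (2≤μ : 2 ≤ μ) (regular : Graph.Regular Γ (suc (μ + μ)))
  (common : ∀ {x y} → x ≢ y → Neighbours.Joined Γ x y → Graph.#commonNeighbours Γ x y ≡ μ) where

  open Graph Γ
  open FiniteSet vertices using (#; _≟_)
  open Counting vertices
  open Neighbours Γ

  other-common : ∀ {x y z} → x ≢ y → Adj x z → Adj y z → ∃[ w ] ((Adj x w × Adj y w) × w ≢ z)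
  other-common {x} {y} {z} x≢y x~z y~z =
    another (λ w → adj? x w ×-dec adj? y w) (≤-trans 2≤μ (≤-reflexive (sym (common x≢y (z , x~z , y~z))))) z

  -- Let C = Γ(a) ∩ Γ₂(u) and Q = Γ(x) ∩ Γ(x′) \ {a}.  Every z ∈ C has at least μ − 2 neighbours in Q and every o ∈ Q has
  -- at most μ − 2 in C, although |Q| < μ ≤ |C|.
  branching⇒μ≡2 : ∀ {a u x x′ y b} → ¬ Adj u a → ¬ Joined u a → Adj a x → Adj a x′ → x ≢ x′ → ¬ Joined u x → ¬ Joined u x′ →
                  Adj a y → Adj y b → Adj u b → μ ≤ 2
  branching⇒μ≡2 {a} {u} {x} {x′} {y} {b} u≁a ¬Jua a~x a~x′ x≢x′ ¬Jx ¬Jx′ a~y y~b u~b = ≮⇒≥ λ 2<μ → go μ refl 2<μ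
    where
    C? = λ z → adj? a z ×-dec joined? u z
    Q? = λ z → (adj? x z ×-dec adj? x′ z) ×-dec ¬? (z ≟ a)

    μ≤#C : μ ≤ # C?
    μ≤#C = ≤-trans (≤-reflexive (sym (common {a} {b} (λ { refl → u≁a u~b }) (y , a~y , symm y~b))))
      (#-mono (λ z → adj? a z ×-dec adj? b z) C? λ (a~z , b~z) → a~z , b , u~b , symm b~z)

    #Q<μ : suc (# Q?) ≤ μ
    #Q<μ = ≤-trans (#-mono-+ Q? (λ z → adj? x z ×-dec adj? x′ z) ([] ∷ [])
      (λ { (here refl) → (symm a~x , symm a~x′) , λ (_ , ne) → ne refl }) proj₁) (≤-reflexive (common x≢x′ (a , symm a~x , symm a~x′)))

    go : ∀ l → μ ≡ l → 3 ≤ l → ⊥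
    go 2 _ (s≤s (s≤s ()))
    go (suc (suc (suc m))) μ≡ _ = <-irrefl refl (≤-trans (s≤s μ≤#C) (≤-trans (s≤s #C≤#Q) #Q<μ))
      where
      lo : ∀ z → Adj a z × Joined u z → suc m ≤ # (λ o → Q? o ×-dec adj? z o)
      lo z (a~z , c , u~c , z~c) = ≤-pred (≤-pred (subst (_≤ 2 + # QZ?) μ≡ (≤-trans μ≤ (s≤s ∩≤))))
        where
        G? = λ o → adj? x o ×-dec adj? z o
        G′? = λ o → adj? x′ o ×-dec adj? z o
        B? = λ o → adj? u o ×-dec adj? z o
        QZ? = λ o → Q? o ×-dec adj? z o
        #G≡μ : # G? ≡ μ
        #G≡μ = common (λ { refl → ¬Jx (c , u~c , z~c) }) (a , symm a~x , symm a~z)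
        #G′≡μ : # G′? ≡ μ
        #G′≡μ = common (λ { refl → ¬Jx′ (c , u~c , z~c) }) (a , symm a~x′ , symm a~z)
        #B≡μ : # B? ≡ μ
        #B≡μ = common (λ { refl → u≁a (symm a~z) }) (c , u~c , z~c)
        -- The μ neighbours of `z` adjacent to `u` are adjacent to neither `x` nor `x′`, so both
        -- sets of size μ lie among the other μ + 1 neighbours. Hence they share at least μ - 1
        -- vertices, one of them `a`.
        ∪≤ : # (λ o → G? o ⊎-dec G′? o) ≤ suc μ
        ∪≤ = +-cancelˡ-≤ μ _ _ (≤-trans (≤-reflexive (cong (_+ # (λ o → G? o ⊎-dec G′? o)) (sym (trans (length-members B?) #B≡μ))))
          (≤-trans (#-mono-+ (λ o → G? o ⊎-dec G′? o) (adj? z) (members-unique B?)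
             (λ i → let u~o , z~o = ∈-members⁻ B? i in z~o , λ { (inj₁ (x~o , _)) → ¬Jx (_ , u~o , x~o) ; (inj₂ (x′~o , _)) → ¬Jx′ (_ , u~o , x′~o) })
             (λ { (inj₁ (_ , z~o)) → z~o ; (inj₂ (_ , z~o)) → z~o }))
          (≤-reflexive (trans (regular z) (sym (+-suc μ μ))))))
        ∩≤ : # (λ o → G? o ×-dec G′? o) ≤ suc (# QZ?)
        ∩≤ = #-≤-suc (λ o → G? o ×-dec G′? o) QZ? {a} sub
          where
          sub : ∀ {o} → (Adj x o × Adj z o) × (Adj x′ o × Adj z o) → o ≡ a ⊎ (((Adj x o × Adj x′ o) × o ≢ a) × Adj z o)
          sub {o} ((x~o , z~o) , (x′~o , _)) with o ≟ a
          ... | yes e = inj₁ e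
          ... | no ne = inj₂ (((x~o , x′~o) , ne) , z~o)
        μ≤ : μ ≤ suc (# (λ o → G? o ×-dec G′? o))
        μ≤ = +-cancelˡ-≤ μ _ _ (≤-trans (≤-reflexive (trans (sym (cong₂ _+_ #G≡μ #G′≡μ)) (#-∪∩ G? G′?)))
          (≤-trans (+-monoˡ-≤ _ ∪≤) (≤-reflexive (sym (+-suc μ _)))))
      -- Two of the μ common neighbours of `a` and `o` are `x` and `x′`, which are not in C.
      hi : ∀ o → (Adj x o × Adj x′ o) × o ≢ a → # (λ z → C? z ×-dec adj? z o) ≤ suc m
      hi o ((x~o , x′~o) , o≢a) = ≤-pred (≤-pred (≤-trans
        (#-mono-+ (λ z → C? z ×-dec adj? z o) (λ z → adj? a z ×-dec adj? o z) ((x≢x′ ∷ []) ∷ [] ∷ [])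
          (λ { (here refl)         → (a~x , symm x~o) , λ ((_ , J) , _) → ¬Jx J
             ; (2nd refl) → (a~x′ , symm x′~o) , λ ((_ , J) , _) → ¬Jx′ J })
          (λ ((a~z , _) , z~o) → a~z , symm z~o))
        (≤-reflexive (trans (common (≢-sym o≢a) (x , a~x , symm x~o)) μ≡))))
      #C≤#Q : # C? ≤ # Q?
      #C≤#Q = *-cancelʳ-≤ (# C?) (# Q?) (suc m) (DoubleCounting.double-count vertices vertices C? Q? adj? (suc m) (suc m) lo hi)

  -- From `#joined*μ` with d = 2μ, since (2μ + 1) · 2μ = 2(2μ + 1) · μ.
  #joined : ∀ v → # (λ w → ¬? (w ≟ v) ×-dec joined? v w) ≡ suc (μ + μ) + suc (μ + μ)
  #joined v = *-cancelʳ-≡ _ (suc (μ + μ) + suc (μ + μ)) μ {{>-nonZero (≤-trans (s≤s z≤n) 2≤μ)}}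
    (trans (#joined*μ regular common v) (trans (*-distribˡ-+ (suc (μ + μ)) μ μ) (sym (*-distribʳ-+ μ (suc (μ + μ)) (suc (μ + μ))))))

-- The bipartite case: halves with a unique partner for each vertex

module Antipodal (Γ : Graph) {μ : ℕ} (2≤μ : 2 ≤ μ) (regular : Graph.Regular Γ (suc (μ + μ)))
  (common : ∀ {x y} → x ≢ y → Neighbours.Joined Γ x y → Graph.#commonNeighbours Γ x y ≡ μ) where

  open Graph Γ
  open FiniteSet vertices using (#; _≟_)
  open Counting vertices
  open Neighbours Γ
  open MuGraph Γ 2≤μ regular common

  private
    k = suc (μ + μ)

  Near : V → V → Set
  Near u a = ∃[ y ] (Adj a y × Joined u y)

  -- `Joined u` stands for Γ₂(u) and `Near u` for the neighbours of its vertices; `x` has to be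
  -- excepted because it is applied with d(x, u) ≥ 4.
  Tight : V → V → Set
  Tight x u = ∀ {a z} → Adj x a → Near u a → Adj a z → z ≢ x → Joined u z

  -- `r` and `a` share `x`, hence also some `m ≢ x`, and tightness at `a` puts `m` into Γ₂(u). So
  -- tightness applies to every neighbour of `x` as soon as it applies to one.
  neighbours-near : ∀ {x u r} → Tight x u → ∃[ a ] (Adj x a × Near u a) → Adj x r → Near u r
  neighbours-near {r = r} t (a , x~a , near) x~r with r ≟ a
  ... | yes refl = near
  ... | no r≢a = let m , (r~m , a~m) , m≢x = other-common r≢a (symm x~r) (symm x~a)
                 in m , r~m , t x~a near a~m m≢x

  module _ {x u} (F : Far x u) (tₓ : Tight x u) (tᵤ : Tight u x) (start : ∃[ a ] (Adj x a × Near u a)) (connected : Connected) where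

    open Far F

    private
      start′ : ∃[ b ] (Adj u b × Near x b)
      start′ = let a , x~a , y , a~y , b , u~b , y~b = start in b , u~b , y , symm y~b , a , x~a , symm a~y

    -- The half that contains `x`: besides `x`, it will consist of `u` and the vertices joined to
    -- both.
    Mid Pt : V → Set
    Mid z = Joined x z × Joined u z
    Pt z = z ≡ x ⊎ z ≡ u ⊎ Mid z

    Pt? : ∀ z → Dec (Pt z)
    Pt? z = (z ≟ x) ⊎-dec ((z ≟ u) ⊎-dec (joined? x z ×-dec joined? u z))

    private
      nbrₓ : ∀ {a z} → Adj x a → Adj a z → Pt z
      nbrₓ {a} {z} x~a a~z with z ≟ x
      ... | yes e = inj₁ e
      ... | no ne = inj₂ (inj₂ ((a , x~a , symm a~z) , tₓ x~a (neighbours-near tₓ start x~a) a~z ne))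

      nbrᵤ : ∀ {b z} → Adj u b → Adj b z → Pt z
      nbrᵤ {b} {z} u~b b~z with z ≟ u
      ... | yes e = inj₂ (inj₁ e)
      ... | no ne = inj₂ (inj₂ (tᵤ u~b (neighbours-near tᵤ start′ u~b) b~z ne , (b , u~b , symm b~z)))

      x≁mid : ∀ {y} → Mid y → ¬ Adj x y
      x≁mid (_ , b , u~b , y~b) x~y = no3 x~y y~b u~b

      u≁mid : ∀ {y} → Mid y → ¬ Adj u y
      u≁mid ((a , x~a , y~a) , _) u~y = no3 x~a (symm y~a) u~y

      remaining : ∀ {y w w′} → Mid y → Adj y w → Adj y w′ → ¬ Adj x w → ¬ Adj u w → ¬ Adj x w′ → ¬ Adj u w′ → w ≡ w′
      remaining {y} (Jx , Ju) = remaining-unique F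
        (common (λ { refl → let _ , p , q = Ju in no2 q p }) Jx) (common (λ { refl → let _ , p , q = Jx in no2 p q }) Ju) (regular y)

      -- With `a` between `x` and `y`, an edge from `y` to `y′` gives `a` and `y′` a second common
      -- neighbour `m ≢ y`, which is again a `Mid` vertex. Then `y` and `m` are two neighbours of
      -- `y′` adjacent to neither `x` nor `u`, against `remaining`.
      mid≁mid : ∀ {y y′} → Mid y → Mid y′ → ¬ Adj y y′
      mid≁mid {y} {y′} M@((a , x~a , y~a) , _) M′ y~y′
        with other-common {a} {y′} {y} (λ { refl → x≁mid M′ x~a }) (symm y~a) (symm y~y′)
      ... | m , (a~m , y′~m) , m≢y with nbrₓ x~a a~m
      ...   | inj₁ refl = x≁mid M′ (symm y′~m)
      ...   | inj₂ (inj₁ refl) = no2 x~a (symm a~m)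
      ...   | inj₂ (inj₂ N) = m≢y (remaining M′ y′~m (symm y~y′) (x≁mid N) (u≁mid N) (x≁mid M) (u≁mid M))

    Pt-independent : ∀ {v w} → Adj v w → Pt v → ¬ Pt w
    Pt-independent v~w (inj₁ refl)        (inj₁ refl)        = irrefl refl v~w
    Pt-independent v~w (inj₁ refl)        (inj₂ (inj₁ refl)) = no1 v~w
    Pt-independent v~w (inj₁ refl)        (inj₂ (inj₂ M))    = x≁mid M v~w
    Pt-independent v~w (inj₂ (inj₁ refl)) (inj₁ refl)        = no1 (symm v~w)
    Pt-independent v~w (inj₂ (inj₁ refl)) (inj₂ (inj₁ refl)) = irrefl refl v~w
    Pt-independent v~w (inj₂ (inj₁ refl)) (inj₂ (inj₂ M))    = u≁mid M v~w
    Pt-independent v~w (inj₂ (inj₂ M))    (inj₁ refl)        = x≁mid M (symm v~w)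
    Pt-independent v~w (inj₂ (inj₂ M))    (inj₂ (inj₁ refl)) = u≁mid M (symm v~w)
    Pt-independent v~w (inj₂ (inj₂ M))    (inj₂ (inj₂ N))    = mid≁mid M N v~w

    -- The hard case is that `p` is a `Mid` vertex and `v` its one further neighbour. If `w ≢ p`,
    -- these two have a second common neighbour `m ≢ v`; since the further neighbour is unique, `m`
    -- is adjacent to `x` or `u`, and `w` is two steps away from that vertex.
    two-steps : ∀ {p v w} → Pt p → Adj p v → Adj v w → Pt w
    two-steps (inj₁ refl)        p~v v~w = nbrₓ p~v v~w
    two-steps (inj₂ (inj₁ refl)) p~v v~w = nbrᵤ p~v v~w
    two-steps {p} {v} {w} (inj₂ (inj₂ M)) p~v v~w with adj? x v | adj? u v | w ≟ p
    ... | yes x~v | _       | _ = nbrₓ x~v v~w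
    ... | no _    | yes u~v | _ = nbrᵤ u~v v~w
    ... | no _    | no _    | yes refl = inj₂ (inj₂ M)
    ... | no x≁v  | no u≁v  | no w≢p   with other-common w≢p (symm v~w) p~v
    ...   | m , (w~m , p~m) , m≢v with adj? x m | adj? u m
    ...     | yes x~m | _ = nbrₓ x~m (symm w~m)
    ...     | no _    | yes u~m = nbrᵤ u~m (symm w~m)
    ...     | no x≁m  | no u≁m = contradiction (remaining M p~m p~v x≁m u≁m x≁v u≁v) m≢v

    covered : ∀ v → Pt v ⊎ ∃[ p ] (Pt p × Adj p v)
    covered v = walk-closed step (proj₂ (connected x v)) (inj₁ (inj₁ refl))
      where
      step : ∀ {v w} → Pt v ⊎ ∃[ p ] (Pt p × Adj p v) → Adj v w → Pt w ⊎ ∃[ p ] (Pt p × Adj p w)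
      step (inj₁ P)            v~w = inj₂ (_ , P , v~w)
      step (inj₂ (_ , P , pv)) v~w = inj₁ (two-steps P pv v~w)

    Bl : V → Set
    Bl v = ¬ Pt v

    Bl? : ∀ v → Dec (Bl v)
    Bl? v = ¬? (Pt? v)

    Bl⇒Pt : ∀ {v w} → Adj v w → Bl v → Pt w
    Bl⇒Pt {v} v~w ¬P with covered v
    ... | inj₁ P = contradiction P ¬P
    ... | inj₂ (_ , P , pv) = two-steps P pv v~w

    module Partner {R : V → Set} (R? : ∀ v → Dec (R v)) (closed : ∀ {p v w} → R p → Adj p v → Adj v w → R w) where

      partner? : ∀ v w → Dec (R w × w ≢ v × ¬ Joined v w)
      partner? v w = R? w ×-dec (¬? (w ≟ v) ×-dec ¬? (joined? v w))

      -- In the class of `v`, 2k vertices are joined to `v`, one is `v`, and the rest are partners.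
      -- So a class of 2k + 2 vertices has exactly one partner for each vertex, which supplies the
      -- involution of `pairs⇒GDD`.
      #side : ∀ {v} → R v → # R? ≡ (k + k) + suc (# (partner? v))
      #side {v} Rv = trans (#-split R? S?) (cong₂ _+_
        (trans (#-cong RS? S? proj₂ λ (ne , z , vz , wz) → closed Rv vz (symm wz) , ne , z , vz , wz) (#joined v))
        (≤-antisym (#-≤-suc R¬S? (partner? v) {v} sub)
                   (#-mono-+ (partner? v) R¬S? ([] ∷ []) (λ { (here refl) → (Rv , λ (ne , _) → ne refl) , λ (_ , ne , _) → ne refl })
                     λ (Rw , ne , ¬J) → Rw , λ (_ , J) → ¬J J)))
        where
        S? = λ w → ¬? (w ≟ v) ×-dec joined? v w
        RS? = λ w → R? w ×-dec S? w
        R¬S? = λ w → R? w ×-dec ¬? (S? w)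
        sub : ∀ {w} → R w × ¬ (w ≢ v × Joined v w) → w ≡ v ⊎ (R w × w ≢ v × ¬ Joined v w)
        sub {w} (Rw , ¬S) with w ≟ v
        ... | yes e = inj₁ e
        ... | no ne = inj₂ (Rw , ne , λ J → ¬S (ne , J))

      module _ (#R : # R? ≡ suc k + suc k) where

        partner : ∀ v → R v → ∃[ w ] ((R w × w ≢ v × ¬ Joined v w) × ∀ z → R z × z ≢ v × ¬ Joined v z → z ≡ w)
        partner v Rv = #≡1⁻ (partner? v) (suc-injective (+-cancelˡ-≡ (k + k) _ _ (trans (sym (#side Rv))
          (trans #R (trans (cong suc (+-suc k k)) (+-comm 2 (k + k)))))))

        half : (S : IncidenceStructure) → let open IncidenceStructure S in
               (e : Carrier points → V) → (∀ p → R (e p)) → (∀ {p q} → e p ≡ e q → p ≡ q) → (∀ {v} → R v → ∃[ p ] (e p ≡ v)) →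
               size points ≡ # R? → (∀ b → blockSize b ≡ k) → (∀ p q → #commonBlocks p q ≡ #commonNeighbours (e p) (e q)) →
               GDD 2 (suc k) k 0 μ S
        half S e Re e-inj e-surj sz bs cb = pairs⇒GDD S σ σσ
          (λ p σp≡p → proj₁ (proj₂ (σ-spec p)) (cong e σp≡p)) (trans sz #R) bs
          (λ p → trans (cb p (σ p)) (#≡0 (λ z → adj? (e p) z ×-dec adj? (e (σ p)) z) λ h → proj₂ (proj₂ (σ-spec p)) (_ , h)))
          (λ p q q≢p q≢σp → trans (cb p q) (common (λ e≡ → q≢p (sym (e-inj e≡)))
            (decidable-stable (joined? (e p) (e q)) λ ¬J → q≢σp (σ-unique p q (Re q , (λ e≡ → q≢p (e-inj e≡)) , ¬J)))))
          where
          open IncidenceStructure S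
          σ : Carrier points → Carrier points
          σ p = proj₁ (e-surj (proj₁ (proj₁ (proj₂ (partner (e p) (Re p))))))
          e-σ : ∀ p → e (σ p) ≡ proj₁ (partner (e p) (Re p))
          e-σ p = proj₂ (e-surj (proj₁ (proj₁ (proj₂ (partner (e p) (Re p))))))
          σ-spec : ∀ p → R (e (σ p)) × e (σ p) ≢ e p × ¬ Joined (e p) (e (σ p))
          σ-spec p = subst (λ w → R w × w ≢ e p × ¬ Joined (e p) w) (sym (e-σ p)) (proj₁ (proj₂ (partner (e p) (Re p))))
          σ-unique : ∀ p q → R (e q) × e q ≢ e p × ¬ Joined (e p) (e q) → q ≡ σ p
          σ-unique p q h = e-inj (trans (proj₂ (proj₂ (partner (e p) (Re p))) (e q) h) (sym (e-σ p)))
          σσ : ∀ p → σ (σ p) ≡ p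
          σσ p = sym (σ-unique (σ p) p (Re p , ≢-sym (proj₁ (proj₂ (σ-spec p))) , λ J → proj₂ (proj₂ (σ-spec p)) (joined-sym J)))

    private
      module Points = Partner Pt? two-steps
      module Blocks = Partner Bl? (λ B p~v v~w → Pt-independent v~w (Bl⇒Pt p~v B))

    -- Evaluated at `x`, whose only partner is `u` by the definition of `Pt`.
    #Pt : # Pt? ≡ suc k + suc k
    #Pt = trans (Points.#side (inj₁ refl)) (trans (cong (λ n → (k + k) + suc n) one) (trans (+-comm (k + k) 2) (cong suc (sym (+-suc k k)))))
      where
      only-u : ∀ {w} → Pt w × w ≢ x × ¬ Joined x w → w ∈ u ∷ []
      only-u (inj₁ e , ne , _) = contradiction e ne
      only-u (inj₂ (inj₁ e) , _) = here e
      only-u (inj₂ (inj₂ (J , _)) , _ , ¬J) = contradiction J ¬J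
      one : # (Points.partner? x) ≡ 1
      one = ≤-antisym (cover⇒#≤ (Points.partner? x) only-u)
                      (#>0 (Points.partner? x) {u} (inj₂ (inj₁ refl) , ≢-sym no0 , λ (_ , p , q) → no2 p q))

    #Bl : # Bl? ≡ suc k + suc k
    #Bl = trans (equal-sides regular Pt? Pt-independent Bl⇒Pt) #Pt

    private
      module Γₛ = Sides Γ Pt? Bl? (λ v → toSum (Pt? v)) (λ P B → B P) Pt-independent Bl⇒Pt

    GDDDP-structure : Σ[ S ∈ IncidenceStructure ] (GDDDP 2 (suc k) k 0 μ S × Γ ≅ incidenceGraph S)
    GDDDP-structure = Γₛ.structure , (pts , bls) , Γₛ.isomorphic
      where
      pts : GDD 2 (suc k) k 0 μ Γₛ.structure
      pts = Points.half #Pt Γₛ.structure (List.lookup Γₛ.Pᵢ) Γₛ.Pₘ.lookup-P Γₛ.Pₘ.lookup-inj Γₛ.Pₘ.at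
        (length-members Pt?)
        (λ b → trans (Γₛ.Pₘ.#-lookup (λ v → adj? v (List.lookup Γₛ.Qᵢ b)) (λ a → Bl⇒Pt (symm a) (Γₛ.Qₘ.lookup-P b)))
          (trans (#-cong (λ v → adj? v (List.lookup Γₛ.Qᵢ b)) (adj? (List.lookup Γₛ.Qᵢ b)) symm symm) (regular _)))
        (λ p q → Γₛ.Qₘ.#-lookup (λ v → adj? (List.lookup Γₛ.Pᵢ p) v ×-dec adj? (List.lookup Γₛ.Pᵢ q) v) (λ (a , _) → Pt-independent a (Γₛ.Pₘ.lookup-P p)))
      bls : GDD 2 (suc k) k 0 μ (dual Γₛ.structure)
      bls = Blocks.half #Bl (dual Γₛ.structure) (List.lookup Γₛ.Qᵢ) Γₛ.Qₘ.lookup-P Γₛ.Qₘ.lookup-inj Γₛ.Qₘ.at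
        (length-members Bl?)
        (λ p → trans (Γₛ.Qₘ.#-lookup (adj? (List.lookup Γₛ.Pᵢ p)) (λ a → Pt-independent a (Γₛ.Pₘ.lookup-P p))) (regular _))
        (λ b c → let B = List.lookup Γₛ.Qᵢ b ; C = List.lookup Γₛ.Qᵢ c in
          trans (Γₛ.Pₘ.#-lookup (λ v → adj? v B ×-dec adj? v C) (λ (a , _) → Bl⇒Pt (symm a) (Γₛ.Qₘ.lookup-P b)))
          (#-cong (λ v → adj? v B ×-dec adj? v C) (λ v → adj? B v ×-dec adj? C v) (λ (a , a′) → symm a , symm a′) (λ (a , a′) → symm a , symm a′)))

-- Neighbour lists and coverings

module Neighbourhoods (Γ : Graph) where

  open Graph Γ
  open FiniteSet vertices using (#; _≟_)
  open Counting vertices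

  -- A complete list allows an unnamed second common neighbour to be identified by cases.
  record Nbrs (v : V) (xs : List V) : Set where
    field
      adjacent   : All (Adj v) xs
      unique     : Unique xs
      exhaustive : ∀ {w} → Adj v w → w ∈ xs

  nbrs : ∀ {v xs} → degree v ≡ length xs → All (Adj v) xs → Unique xs → Nbrs v xs
  nbrs {v} {xs} deg adj uniq = record { adjacent = adj ; unique = uniq ; exhaustive = exhaustive }
    where
    exhaustive : ∀ {w} → Adj v w → w ∈ xs
    exhaustive {w} v~w = decidable-stable (Any.any? (w ≟_) xs) λ w∉ →
      <-irrefl (sym deg) (unique⇒≤# (adj? v) {w ∷ xs} (All.tabulate (λ {y} y∈ e → w∉ (subst (_∈ xs) (sym e) y∈)) ∷ uniq)
        λ { (here refl) → v~w ; (there i) → All.lookup adj i })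

-- A local bijection between connected graphs has equally large fibres, so the single fibre in
-- `base` decides injectivity. This replaces the comparison of all pairs of named vertices of `Γ`.
module Covering (Γ K : Graph) (f : Graph.V K → Graph.V Γ) (nb : Graph.V K → List (Graph.V K))
  (nb⁺ : ∀ {i j} → Graph.Adj K i j → j ∈ nb i) (nb⁻ : ∀ {i j} → j ∈ nb i → Graph.Adj K i j)
  (local : ∀ i → Neighbourhoods.Nbrs Γ (f i) (List.map f (nb i)))
  (Γ-connected : Graph.Connected Γ) (K-connected : Graph.Connected K)
  (i₀ : Graph.V K) (base : ∀ j → f j ≡ f i₀ → j ≡ i₀) where

  open Graph Γ
  open Neighbourhoods Γ
  open Neighbours Γ using (walk-closed)
  private module K = Graph K

  preserves : ∀ {i j} → K.Adj i j → Adj (f i) (f j)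
  preserves {i} a = All.lookup (Nbrs.adjacent (local i)) (∈-map⁺ f (nb⁺ a))

  lift : ∀ {i v} → Adj (f i) v → ∃[ j ] (K.Adj i j × v ≡ f j)
  lift {i} a = let j , j∈ , e = ∈-map⁻ f (Nbrs.exhaustive (local i) a) in j , nb⁻ j∈ , e

  locally-injective : ∀ {i j j′} → K.Adj i j → K.Adj i j′ → f j ≡ f j′ → j ≡ j′
  locally-injective {i} a a′ = go (nb i) (Nbrs.unique (local i)) (nb⁺ a) (nb⁺ a′)
    where
    go : ∀ {j j′} xs → Unique (List.map f xs) → j ∈ xs → j′ ∈ xs → f j ≡ f j′ → j ≡ j′
    go (x ∷ xs) _          (here refl) (here refl) _ = refl
    go (x ∷ xs) (x∉ ∷ _)   (here refl) (there j′∈) e = contradiction e (All.lookup x∉ (∈-map⁺ f j′∈))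
    go (x ∷ xs) (x∉ ∷ _)   (there j∈)  (here refl) e = contradiction (sym e) (All.lookup x∉ (∈-map⁺ f j∈))
    go (x ∷ xs) (_ ∷ uniq) (there j∈)  (there j′∈) e = go xs uniq j∈ j′∈ e

  injective : ∀ {i j} → f i ≡ f j → i ≡ j
  injective {i} {j} e = decidable-stable (FiniteSet._≟_ K.vertices i j) (λ i≢j → go (proj₂ (K-connected i i₀)) j e i≢j)
    where
    -- Two points of one fibre are moved along a walk to the fibre of i₀ without ever meeting.
    go : ∀ {i n} → K.Walk i i₀ n → ∀ j → f i ≡ f j → i ≢ j → ⊥
    go K.[]      j e i≢j = i≢j (sym (base j (sym e)))
    go (K._∷_ {y = i′} a w) j e i≢j =
      let j′ , j~j′ , e′ = lift {j} {f i′} (subst (λ v → Adj v (f i′)) e (preserves a))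
      in go w j′ e′ λ i′≡j′ → i≢j (locally-injective (K.symm a) (K.symm (subst (K.Adj j) (sym i′≡j′) j~j′)) e)

  surjective : ∀ v → ∃[ i ] (f i ≡ v)
  surjective v = walk-closed {λ v → ∃[ i ] (f i ≡ v)} (λ { (i , refl) a → let j , _ , e = lift a in j , sym e })
                             (proj₂ (Γ-connected (f i₀) v)) (i₀ , refl)

  isomorphism : Γ ≅ K
  isomorphism = bijective⇒≅ {Γ} {K} f injective surjective preserves
    λ {i} a → let j , i~j , e = lift a in subst (K.Adj i) (sym (injective e)) i~j

-- The orderings of three indices

data Tri : Fin 3 → Fin 3 → Fin 3 → Set where
  t012 : Tri 0F 1F 2F
  t021 : Tri 0F 2F 1F
  t102 : Tri 1F 0F 2F
  t120 : Tri 1F 2F 0F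
  t201 : Tri 2F 0F 1F
  t210 : Tri 2F 1F 0F

tri-12 : ∀ {i j k} → Tri i j k → i ≢ j
tri-12 t012 ()
tri-12 t021 ()
tri-12 t102 ()
tri-12 t120 ()
tri-12 t201 ()
tri-12 t210 ()

tri-rot : ∀ {i j k} → Tri i j k → Tri j k i
tri-rot t012 = t120
tri-rot t021 = t210
tri-rot t102 = t021
tri-rot t120 = t201
tri-rot t201 = t012
tri-rot t210 = t102

tri-swap : ∀ {i j k} → Tri i j k → Tri i k j
tri-swap t012 = t021
tri-swap t021 = t012
tri-swap t102 = t120
tri-swap t120 = t102
tri-swap t201 = t210
tri-swap t210 = t201

tri-13 : ∀ {i j k} → Tri i j k → i ≢ k
tri-13 t = tri-12 (tri-swap t)

tri-23 : ∀ {i j k} → Tri i j k → j ≢ k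
tri-23 t = tri-12 (tri-rot t)

tri-cases : ∀ {i j k} → Tri i j k → ∀ m → m ≡ i ⊎ m ≡ j ⊎ m ≡ k
tri-cases t012 0F = inj₁ refl
tri-cases t012 1F = inj₂ (inj₁ refl)
tri-cases t012 2F = inj₂ (inj₂ refl)
tri-cases t021 0F = inj₁ refl
tri-cases t021 1F = inj₂ (inj₂ refl)
tri-cases t021 2F = inj₂ (inj₁ refl)
tri-cases t102 0F = inj₂ (inj₁ refl)
tri-cases t102 1F = inj₁ refl
tri-cases t102 2F = inj₂ (inj₂ refl)
tri-cases t120 0F = inj₂ (inj₂ refl)
tri-cases t120 1F = inj₁ refl
tri-cases t120 2F = inj₂ (inj₁ refl)
tri-cases t201 0F = inj₂ (inj₁ refl)
tri-cases t201 1F = inj₂ (inj₂ refl)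
tri-cases t201 2F = inj₁ refl
tri-cases t210 0F = inj₂ (inj₂ refl)
tri-cases t210 1F = inj₂ (inj₁ refl)
tri-cases t210 2F = inj₁ refl

third : ∀ {i j} → i ≢ j → ∃[ k ] Tri i j k
third {0F} {0F} ne = contradiction refl ne
third {0F} {1F} _ = 2F , t012
third {0F} {2F} _ = 1F , t021
third {1F} {0F} _ = 2F , t102
third {1F} {1F} ne = contradiction refl ne
third {1F} {2F} _ = 0F , t120
third {2F} {0F} _ = 1F , t201
third {2F} {1F} _ = 0F , t210
third {2F} {2F} ne = contradiction refl ne

-- The cyclic choice of the other two indices; the tables of neighbours of labels are written with
-- it.
triple : ∀ i → ∃[ j ] ∃[ k ] Tri i j k
triple 0F = 1F , 2F , t012
triple 1F = 2F , 0F , t120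
triple 2F = 0F , 1F , t201

triple-tri : ∀ i → Tri i (proj₁ (triple i)) (proj₁ (proj₂ (triple i)))
triple-tri i = proj₂ (proj₂ (triple i))

all₃ : ∀ {P : Fin 3 → Set} → P 0F → P 1F → P 2F → ∀ i → P i
all₃ c d e 0F = c
all₃ c d e 1F = d
all₃ c d e 2F = e

all₂ : ∀ {P : Bool → Set} → P true → P false → ∀ s → P s
all₂ c d true  = c
all₂ c d false = d

-- Graphs of valency 5 in which joined vertices have two common neighbours

module Rectagraph (Γ : Graph) (regular : Graph.Regular Γ 5)
  (common : ∀ {x y} → x ≢ y → Neighbours.Joined Γ x y → Graph.#commonNeighbours Γ x y ≡ 2) where

  open Graph Γ
  open FiniteSet vertices using (#; _≟_)
  open Counting vertices
  open Neighbours Γ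
  open Neighbourhoods Γ
  open MuGraph Γ {2} ≤-refl regular common using (other-common)

  no-three : ∀ {v w c d e} → v ≢ w → c ≢ d → c ≢ e → d ≢ e →
             Adj v c → Adj w c → Adj v d → Adj w d → Adj v e → Adj w e → ⊥
  no-three v≢w c≢d c≢e d≢e vc wc = at-most-two (common v≢w (_ , vc , wc)) c≢d c≢e d≢e vc wc

  nbrs₅ : ∀ {v c d e f g} → Adj v c → Adj v d → Adj v e → Adj v f → Adj v g →
          c ≢ d → c ≢ e → c ≢ f → c ≢ g → d ≢ e → d ≢ f → d ≢ g → e ≢ f → e ≢ g → f ≢ g → Nbrs v (c ∷ d ∷ e ∷ f ∷ g ∷ [])
  nbrs₅ {v} c d e f g cd ce cf cg de df dg ef eg fg = nbrs (regular v) (c ∷ d ∷ e ∷ f ∷ g ∷ [])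
    ((cd ∷ ce ∷ cf ∷ cg ∷ []) ∷ (de ∷ df ∷ dg ∷ []) ∷ (ef ∷ eg ∷ []) ∷ (fg ∷ []) ∷ [] ∷ [])

  -- The interval between a and u, at distance 3, is a 3-cube with the layers a, y, b, u; x and z are the
  -- remaining neighbours of a and u; o, p, q, r close the quadrangles (y, a, x), (b, u, z), (x, a, x), (z, u, z).
  record Frame : Set where
    field
      a u q r : V
      y b     : Fin 3 → V
      x z     : Bool → V
      o p     : Fin 3 → Bool → V
      a~y     : ∀ i → Adj a (y i)
      u~b     : ∀ i → Adj u (b i)
      a~x     : ∀ s → Adj a (x s)
      u~z     : ∀ s → Adj u (z s)
      y~b     : ∀ {i j} → i ≢ j → Adj (y i) (b j)
      y-inj   : ∀ {i j} → i ≢ j → y i ≢ y j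
      b-inj   : ∀ {i j} → i ≢ j → b i ≢ b j
      x-inj   : ∀ {s t} → s ≢ t → x s ≢ x t
      z-inj   : ∀ {s t} → s ≢ t → z s ≢ z t
      a≢u     : a ≢ u
      a≁u     : ¬ Adj a u
      a≁z     : ∀ {s} → ¬ Adj a (z s)
      u≁x     : ∀ {s} → ¬ Adj u (x s)
      x≁b     : ∀ {s i} → ¬ Adj (x s) (b i)
      z≁y     : ∀ {s i} → ¬ Adj (z s) (y i)
      x≁z     : ∀ {s t} → ¬ Adj (x s) (z t)
      y~o     : ∀ i s → Adj (y i) (o i s)
      b~p     : ∀ i s → Adj (b i) (p i s)
      x~o     : ∀ i s → Adj (x s) (o i s)
      z~p     : ∀ i s → Adj (z s) (p i s)
      o≢a     : ∀ {i s} → o i s ≢ a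
      p≢u     : ∀ {i s} → p i s ≢ u
      x~q     : ∀ s → Adj (x s) q
      z~r     : ∀ s → Adj (z s) r
      q≢a     : q ≢ a
      r≢u     : r ≢ u

  dual-frame : Frame → Frame
  dual-frame F = record
    { a = u ; u = a ; q = r ; r = q ; y = b ; b = y ; x = z ; z = x ; o = p ; p = o
    ; a~y = u~b ; u~b = a~y ; a~x = u~z ; u~z = a~x ; y~b = λ ne → symm (y~b (≢-sym ne))
    ; y-inj = b-inj ; b-inj = y-inj ; x-inj = z-inj ; z-inj = x-inj
    ; a≢u = ≢-sym a≢u ; a≁u = a≁u ∘ symm ; a≁z = u≁x ; u≁x = a≁z ; x≁b = z≁y ; z≁y = x≁b ; x≁z = x≁z ∘ symm
    ; y~o = b~p ; b~p = y~o ; x~o = z~p ; z~p = x~o ; o≢a = p≢u ; p≢u = o≢a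
    ; x~q = z~r ; z~r = x~q ; q≢a = r≢u ; r≢u = q≢a }
    where open Frame F

  -- Most nonadjacencies come from `no-three`: one more edge would give two vertices a third common
  -- neighbour. Most inequalities come from `apart`, through a vertex adjacent to only one of the
  -- two. Facts on the side of `u` are those on the side of `a`, read in `dual-frame`.
  module FrameLemmas (F : Frame) where

    open Frame F

    y≢x : ∀ {i s} → y i ≢ x s
    y≢x {i} = let _ , _ , t = triple i in apart (symm (y~b (tri-12 t))) (x≁b ∘ symm)

    y≢u : ∀ {i} → y i ≢ u
    y≢u {i} = apart (a~y i) a≁u

    o≁y : ∀ {i j s} → i ≢ j → ¬ Adj (y j) (o i s)
    o≁y {i} {j} {s} ne a = no-three (≢-sym o≢a) (y-inj ne) y≢x y≢x
      (a~y i) (symm (y~o i s)) (a~y j) (symm a) (a~x s) (symm (x~o i s))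

    o≁x : ∀ {i s t} → s ≢ t → ¬ Adj (x t) (o i s)
    o≁x {i} {s} {t} ne a = no-three (≢-sym o≢a) y≢x y≢x (x-inj ne)
      (a~y i) (symm (y~o i s)) (a~x s) (symm (x~o i s)) (a~x t) (symm a)

    o≁u : ∀ {i s} → ¬ Adj u (o i s)
    o≁u {i} {s} e = let j , k , t = triple i in
      no-three {y i} {u} y≢u (b-inj (tri-23 t)) (≢-sym (apart (x~o i s) x≁b)) (≢-sym (apart (x~o i s) x≁b))
        (y~b (tri-12 t)) (u~b j) (y~b (tri-13 t)) (u~b k) (y~o i s) e

    q≁y : ∀ {i} → ¬ Adj (y i) q
    q≁y {i} e = no-three (≢-sym q≢a) (x-inj {true} {false} (λ ())) (≢-sym y≢x) (≢-sym y≢x)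
      (a~x true) (symm (x~q true)) (a~x false) (symm (x~q false)) (a~y i) (symm e)

    o≢q : ∀ {i s} → o i s ≢ q
    o≢q {i} {s} = apart (y~o i s) q≁y

    o≢b : ∀ {i j s} → o i s ≢ b j
    o≢b {i} {j} {s} = apart (x~o i s) x≁b

    a≢b : ∀ {i} → a ≢ b i
    a≢b {i} = ≢-sym (apart (u~b i) (a≁u ∘ symm))

    o-inj₁ : ∀ {i j s t} → i ≢ j → o i s ≢ o j t
    o-inj₁ {i} {s = s} ne = apart (y~o i s) (o≁y (≢-sym ne))

    o-inj₂ : ∀ {i s t} → s ≢ t → o i s ≢ o i t
    o-inj₂ {i} {s} ne = apart (x~o i s) (o≁x (≢-sym ne))

    a-nbrs : ∀ {i j k} → Tri i j k → Nbrs a (y i ∷ y j ∷ y k ∷ x true ∷ x false ∷ [])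
    a-nbrs {i} {j} {k} t = nbrs₅ (a~y i) (a~y j) (a~y k) (a~x true) (a~x false)
      (y-inj (tri-12 t)) (y-inj (tri-13 t)) y≢x y≢x (y-inj (tri-23 t)) y≢x y≢x y≢x y≢x (x-inj λ ())

    y-nbrs : ∀ {i j k} → Tri i j k → Nbrs (y i) (a ∷ b j ∷ b k ∷ o i true ∷ o i false ∷ [])
    y-nbrs {i} t = nbrs₅ (symm (a~y i)) (y~b (tri-12 t)) (y~b (tri-13 t)) (y~o i true) (y~o i false)
      a≢b a≢b (≢-sym o≢a) (≢-sym o≢a) (b-inj (tri-23 t)) (≢-sym o≢b) (≢-sym o≢b) (≢-sym o≢b) (≢-sym o≢b) (o-inj₂ λ ())

    x-nbrs : ∀ {i j k} → Tri i j k → ∀ s → Nbrs (x s) (a ∷ q ∷ o i s ∷ o j s ∷ o k s ∷ [])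
    x-nbrs {i} {j} {k} t s = nbrs₅ (symm (a~x s)) (x~q s) (x~o i s) (x~o j s) (x~o k s)
      (≢-sym q≢a) (≢-sym o≢a) (≢-sym o≢a) (≢-sym o≢a) (≢-sym o≢q) (≢-sym o≢q) (≢-sym o≢q)
      (o-inj₁ (tri-12 t)) (o-inj₁ (tri-13 t)) (o-inj₁ (tri-23 t))

    a-cases : ∀ {w} → Adj a w → (∃[ i ] w ≡ y i) ⊎ (∃[ s ] w ≡ x s)
    a-cases e with Nbrs.exhaustive (a-nbrs t012) e
    ... | here e = inj₁ (0F , e)
    ... | 2nd e = inj₁ (1F , e)
    ... | 3rd e = inj₁ (2F , e)
    ... | 4th e = inj₂ (true , e)
    ... | 5th e = inj₂ (false , e)

    y-cases : ∀ {i w} → Adj (y i) w → w ≡ a ⊎ (∃[ j ] (i ≢ j × w ≡ b j)) ⊎ (∃[ s ] w ≡ o i s)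
    y-cases {i} e with triple i
    ... | j , k , t with Nbrs.exhaustive (y-nbrs t) e
    ...     | here e = inj₁ e
    ...     | 2nd e = inj₂ (inj₁ (j , tri-12 t , e))
    ...     | 3rd e = inj₂ (inj₁ (k , tri-13 t , e))
    ...     | 4th e = inj₂ (inj₂ (true , e))
    ...     | 5th e = inj₂ (inj₂ (false , e))

    x-cases : ∀ {s w} → Adj (x s) w → w ≡ a ⊎ w ≡ q ⊎ (∃[ i ] w ≡ o i s)
    x-cases {s} e with Nbrs.exhaustive (x-nbrs t012 s) e
    ... | here e = inj₁ e
    ... | 2nd e = inj₂ (inj₁ e)
    ... | 3rd e = inj₂ (inj₂ (0F , e))
    ... | 4th e = inj₂ (inj₂ (1F , e))
    ... | 5th e = inj₂ (inj₂ (2F , e))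

  module Links (F : Frame) where

    open Frame F
    open FrameLemmas F public
    private module D = FrameLemmas (dual-frame F)

    y≢p : ∀ {i j s} → y i ≢ p j s
    y≢p {i} = apart (a~y i) D.o≁u

    x≢p : ∀ {s j t} → x s ≢ p j t
    x≢p {s} = apart (a~x s) D.o≁u

    -- `o i s` and `b j` share `y i`; among the neighbours of `b j`, the second common one can only
    -- be some `p j t`. With `link-unique` on both sides, the edges between the pairs `o i` and
    -- `p j` form a perfect matching.
    link : ∀ {i j} → i ≢ j → ∀ s → ∃[ t ] Adj (o i s) (p j t)
    link {i} {j} ne s with other-common {o i s} {b j} {y i} o≢b (symm (y~o i s)) (symm (y~b ne))
    ... | m , (o~m , b~m) , m≢y with D.y-cases b~m
    ...   | inj₁ refl = contradiction (symm o~m) o≁u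
    ...   | inj₂ (inj₂ (t , refl)) = t , o~m
    ...   | inj₂ (inj₁ (i′ , _ , refl)) with i ≟ᶠ i′
    ...     | yes refl = contradiction refl m≢y
    ...     | no i≢i′ = contradiction (symm o~m) (o≁y i≢i′)

    link-unique : ∀ {i j s t t′} → i ≢ j → Adj (o i s) (p j t) → Adj (o i s) (p j t′) → t ≡ t′
    link-unique {i} {j} {s} {t} {t′} ne e e′ = decidable-stable (t ≟ᵇ t′) λ t≢t′ →
      no-three {o i s} {b j} o≢b y≢p y≢p (D.o-inj₂ t≢t′) (symm (y~o i s)) (symm (y~b ne)) e (b~p j t) e′ (b~p j t′)

    -- Otherwise `o i s` and `b i` share `p i t` and a second vertex, which can only be the other
    -- `p i t′`. Together with `y i`, `x s` and the links into `p j` and `p k`, this makes six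
    -- neighbours of `o i s`.
    p≁o-same : ∀ {i s t} → (∀ {j} → i ≢ j → ∃[ t ] Adj (o i s) (p j t)) → ¬ Adj (o i s) (p i t)
    p≁o-same {i} {s} {t} links e with other-common {o i s} {b i} {p i t} o≢b e (b~p i t)
    ... | m , (o~m , b~m) , m≢p with D.y-cases b~m
    ...   | inj₁ refl = o≁u (symm o~m)
    ...   | inj₂ (inj₁ (j , i≢j , refl)) = o≁y i≢j (symm o~m)
    ...   | inj₂ (inj₂ (t′ , refl)) = six (triple i)
      where
      six : ∃[ j ] ∃[ k ] Tri i j k → ⊥
      six (j , k , tr) with links (tri-12 tr) | links (tri-13 tr)
      ... | sⱼ , eⱼ | sₖ , eₖ with Nbrs.exhaustive (nbrs₅ (symm (y~o i s)) (symm (x~o i s)) eⱼ eₖ e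
                y≢x y≢p y≢p y≢p x≢p x≢p x≢p (D.o-inj₁ (tri-23 tr)) (D.o-inj₁ (≢-sym (tri-12 tr))) (D.o-inj₁ (≢-sym (tri-13 tr)))) o~m
      ...   | here e = y≢p (sym e)
      ...   | 2nd e = x≢p (sym e)
      ...   | 3rd e = D.o-inj₁ (tri-12 tr) e
      ...   | 4th e = D.o-inj₁ (tri-13 tr) e
      ...   | 5th e = m≢p e

  -- A perfect matching between two pairs is either straight or crossed; `ε i j` is `true` when the
  -- one between `o i` and `p j` is crossed.
  record Config : Set where
    field
      frame : Frame
    open Frame frame public
    field
      ε   : Fin 3 → Fin 3 → Bool
      o~p : ∀ {i j} → i ≢ j → ∀ s → Adj (o i s) (p j (s xor ε i j))

  xor-twice : ∀ s e → (s xor e) xor e ≡ s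
  xor-twice false false = refl
  xor-twice false true  = refl
  xor-twice true  false = refl
  xor-twice true  true  = refl

  xor-injʳ : ∀ s {e e′} → s xor e ≡ s xor e′ → e ≡ e′
  xor-injʳ false              eq = eq
  xor-injʳ true {false} {false} _  = refl
  xor-injʳ true {true}  {true}  _  = refl

  xor-injˡ : ∀ {s t} e → s ≢ t → s xor e ≢ t xor e
  xor-injˡ {s} {t} e ne eq = ne (trans (sym (xor-twice s e)) (trans (cong (_xor e) eq) (xor-twice t e)))

  dual-config : Config → Config
  dual-config C = record { frame = dual-frame frame ; ε = λ i j → ε j i
    ; o~p = λ {i} {j} ne s → symm (subst (λ t → Adj (o j (s xor ε j i)) (p i t)) (xor-twice s (ε j i)) (o~p (≢-sym ne) (s xor ε j i))) }
    where open Config C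

  config : Frame → Config
  config F = record { frame = F ; ε = λ i j → proj₁ (bit i j) ; o~p = λ {i} {j} ne s → proj₂ (bit i j) ne s }
    where
    open Frame F
    open Links F
    module D = Links (dual-frame F)
    bit : ∀ i j → ∃[ e ] (i ≢ j → ∀ s → Adj (o i s) (p j (s xor e)))
    bit i j with i ≟ᶠ j
    ... | yes e = false , λ ne → contradiction e ne
    ... | no ne with link ne false | link ne true
    ...   | t , e | t′ , e′ = t , λ _ → λ { false → e ; true → subst (λ t → Adj (o i true) (p j t)) t′≡ e′ }
      where
      t′≡ : t′ ≡ not t
      t′≡ = ¬-not λ { refl → contradiction (D.link-unique (≢-sym ne) (symm e) (symm e′)) λ () }

  module ConfigLemmas (C : Config) where

    open Config C
    open Links frame public
    private module D = FrameLemmas (dual-frame frame)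

    o≁p : ∀ {i s t} → ¬ Adj (o i s) (p i t)
    o≁p {i} {s} = p≁o-same (λ {j} ne → s xor ε i j , o~p ne s)

    p~o : ∀ {i j} → i ≢ j → ∀ s → Adj (p j s) (o i (s xor ε i j))
    p~o {i} {j} ne = Config.o~p (dual-config C) (≢-sym ne)

    colink-unique : ∀ {i j s s′ t} → i ≢ j → Adj (o i s) (p j t) → Adj (o i s′) (p j t) → s ≡ s′
    colink-unique ne e e′ = Links.link-unique (dual-frame frame) (≢-sym ne) (symm e) (symm e′)

    -- Let `o i s` be the neighbour of `p j t` in that pair. The second common neighbour of `x s`
    -- and `p j t` is `o k s` or `q`, and as the signs differ it is not `o k s`.
    twisted-q : ∀ {i j k} → Tri i j k → ε i j ≢ ε k j → ∀ t → Adj q (p j t)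
    twisted-q {i} {j} {k} tr tw t with other-common {x s} {p j t} {o i s} x≢p (x~o i s) (p~o (tri-12 tr) t)
      where s = t xor ε i j
    ... | m , (x~m , p~m) , m≢o with x-cases x~m
    ...   | inj₁ refl = contradiction (symm p~m) D.o≁u
    ...   | inj₂ (inj₁ refl) = symm p~m
    ...   | inj₂ (inj₂ (i′ , refl)) with tri-cases tr i′
    ...     | inj₁ refl = contradiction refl m≢o
    ...     | inj₂ (inj₁ refl) = contradiction (symm p~m) o≁p
    ...     | inj₂ (inj₂ refl) = contradiction (xor-injʳ t (colink-unique (≢-sym (tri-23 tr)) (symm p~m) (symm (p~o (≢-sym (tri-23 tr)) t)))) tw

    -- Here `o i s` and `o k s` are already the two common neighbours of `x s` and `p j t`.
    untwisted-q : ∀ {i j k} → Tri i j k → ε i j ≡ ε k j → ∀ {t} → ¬ Adj q (p j t)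
    untwisted-q {i} {j} {k} tr un {t} q~p = no-three {x s} {p j t} x≢p (o-inj₁ (tri-13 tr)) o≢q o≢q
      (x~o i s) (p~o (tri-12 tr) t) (x~o k s) (subst (λ e → Adj (p j t) (o k (t xor e))) (sym un) (p~o (≢-sym (tri-23 tr)) t)) (x~q s) (symm q~p)
      where s = t xor ε i j

    Twisted Untwisted : Fin 3 → Set
    Twisted j = ∀ {i k} → Tri i j k → ε i j ≢ ε k j
    Untwisted j = ∀ {i k} → Tri i j k → ε i j ≡ ε k j

    twisted? : ∀ j → Twisted j ⊎ Untwisted j
    twisted? 0F with ε 1F 0F ≟ᵇ ε 2F 0F
    ... | yes e = inj₂ λ { t102 → e ; t201 → sym e }
    ... | no ne = inj₁ λ { t102 → ne ; t201 → ≢-sym ne }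
    twisted? 1F with ε 0F 1F ≟ᵇ ε 2F 1F
    ... | yes e = inj₂ λ { t012 → e ; t210 → sym e }
    ... | no ne = inj₁ λ { t012 → ne ; t210 → ≢-sym ne }
    twisted? 2F with ε 0F 2F ≟ᵇ ε 1F 2F
    ... | yes e = inj₂ λ { t021 → e ; t120 → sym e }
    ... | no ne = inj₁ λ { t021 → ne ; t120 → ≢-sym ne }

    -- A twisted index gives `q` two neighbours `p j true` and `p j false`. Besides the two `x`,
    -- only three places are left, too few for two such pairs.
    twisted-unique : ∀ {j j′} → Twisted j → Twisted j′ → j ≡ j′
    twisted-unique {j} {j′} tw tw′ = decidable-stable (j ≟ᶠ j′) λ ne → six ne (third ne)
      where
      six : j ≢ j′ → ∃[ k ] Tri j j′ k → ⊥
      six ne (k , tr) = absurd (Nbrs.exhaustive (nbrs₅ (symm (x~q true)) (symm (x~q false)) (q~p true) (q~p false) (q~p′ true)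
          (x-inj λ ()) x≢p x≢p x≢p x≢p x≢p x≢p (D.o-inj₂ λ ()) (D.o-inj₁ ne) (D.o-inj₁ ne)) (q~p′ false))
        where
        q~p = twisted-q (tri-rot (tri-rot tr)) (tw (tri-rot (tri-rot tr)))
        q~p′ = twisted-q tr (tw′ tr)
        absurd : p j′ false ∉ x true ∷ x false ∷ p j true ∷ p j false ∷ p j′ true ∷ []
        absurd (here e) = x≢p (sym e)
        absurd (2nd e) = x≢p (sym e)
        absurd (3rd e) = D.o-inj₁ (≢-sym ne) e
        absurd (4th e) = D.o-inj₁ (≢-sym ne) e
        absurd (5th e) = D.o-inj₂ (λ ()) e

  -- `R` is the common neighbour of `o j true` and `o j false` other than `y j`, and it will be the
  -- fifth neighbour of both. It has to be separated from the vertices `x`, `y`, `p` and `u` of the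
  -- frame.
  module Fifth (F : Frame) {j : Fin 3} {R : V} (o~R : ∀ s → Adj (Frame.o F j s) R) (R≢yⱼ : R ≢ Frame.y F j)
               (o≁p : ∀ {s t} → ¬ Adj (Frame.o F j s) (Frame.p F j t)) where

    open Frame F
    open Links F
    private module D = Links (dual-frame F)

    R≢x : ∀ {s} → R ≢ x s
    R≢x {true}  refl = o≁x {j} {false} {true} (λ ()) (symm (o~R false))
    R≢x {false} refl = o≁x {j} {true} {false} (λ ()) (symm (o~R true))

    R≢y : ∀ {m} → R ≢ y m
    R≢y {m} with j ≟ᶠ m
    ... | yes refl = R≢yⱼ
    ... | no j≢m = λ { refl → o≁y j≢m (symm (o~R true)) }

    R≢p : ∀ {m s} → R ≢ p m s
    R≢p {m} {s} refl with j ≟ᶠ m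
    ... | yes refl = o≁p (o~R true)
    ... | no j≢m = contradiction (D.link-unique (≢-sym j≢m) (symm (o~R true)) (symm (o~R false))) λ ()

    R≢u : R ≢ u
    R≢u refl = o≁u (symm (o~R true))

    a≁R : ¬ Adj a R
    a≁R e with a-cases e
    ... | inj₁ (_ , e) = R≢y e
    ... | inj₂ (_ , e) = R≢x e

    b≁R : ∀ {m} → ¬ Adj (b m) R
    b≁R e with D.y-cases e
    ... | inj₁ e = R≢u e
    ... | inj₂ (inj₁ (_ , _ , e)) = R≢y e
    ... | inj₂ (inj₂ (_ , e)) = R≢p e

    z≁R : R ≢ r → ∀ {s} → ¬ Adj (z s) R
    z≁R R≢r e with D.x-cases e
    ... | inj₁ e = R≢u e
    ... | inj₂ (inj₁ e) = R≢r e
    ... | inj₂ (inj₂ (_ , e)) = R≢p e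

  -- The configuration without twists, in which `gauge` has made all signs `false`.
  record Cube : Set where
    field
      frame : Frame
    open Frame frame public
    field
      o~p : ∀ {i j} → i ≢ j → ∀ s → Adj (o i s) (p j s)
      q≁p : ∀ {i s} → ¬ Adj q (p i s)
      r≁o : ∀ {i s} → ¬ Adj r (o i s)
      R T : Fin 3 → V
      o~R : ∀ i s → Adj (o i s) (R i)
      p~T : ∀ i s → Adj (p i s) (T i)
      R≢yᵢ : ∀ {i} → R i ≢ y i
      T≢bᵢ : ∀ {i} → T i ≢ b i

  dual-cube : Cube → Cube
  dual-cube C = record { frame = dual-frame frame ; o~p = λ ne s → symm (o~p (≢-sym ne) s) ; q≁p = r≁o ; r≁o = q≁p
                       ; R = T ; T = R ; o~R = p~T ; p~T = o~R ; R≢yᵢ = T≢bᵢ ; T≢bᵢ = R≢yᵢ }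
    where open Cube C

  module CubeNbrs (C : Cube) where

    open Cube C
    open Links frame public
    private module D = Links (dual-frame frame)

    o≁p : ∀ {i s t} → ¬ Adj (o i s) (p i t)
    o≁p {i} {s} = p≁o-same λ ne → s , o~p ne s

    module _ {i : Fin 3} where
      open Fifth frame (o~R i) R≢yᵢ o≁p public

    R≢r : ∀ {i} → R i ≢ r
    R≢r {i} refl = r≁o (symm (o~R i true))

    o-nbrs : ∀ {i j k} → Tri i j k → ∀ s → Nbrs (o i s) (y i ∷ x s ∷ p j s ∷ p k s ∷ R i ∷ [])
    o-nbrs {i} t s = nbrs₅ (symm (y~o i s)) (symm (x~o i s)) (o~p (tri-12 t) s) (o~p (tri-13 t) s) (o~R i s)
      y≢x y≢p y≢p (≢-sym R≢y) x≢p x≢p (≢-sym R≢x) (D.o-inj₁ (tri-23 t)) (≢-sym R≢p) (≢-sym R≢p)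

    -- `q` and `o i true` share `x true`; as `q` is adjacent to no `y` and no `p`, their second
    -- common neighbour must be `R i`.
    q~R : ∀ i → Adj q (R i)
    q~R i = let j , k , t = triple i
                m , (q~m , o~m) , m≢x = other-common {q} {o i true} {x true} (≢-sym o≢q) (symm (x~q true)) (symm (x~o i true))
            in go q~m m≢x (Nbrs.exhaustive (o-nbrs t true) o~m)
      where
      go : ∀ {j k m} → Adj q m → m ≢ x true → m ∈ y i ∷ x true ∷ p j true ∷ p k true ∷ R i ∷ [] → Adj q (R i)
      go q~m _   (here refl) = contradiction (symm q~m) q≁y
      go _   m≢x (2nd refl)  = contradiction refl m≢x
      go q~m _   (3rd refl)  = contradiction q~m q≁p
      go q~m _   (4th refl)  = contradiction q~m q≁p
      go q~m _   (5th refl)  = q~m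

    -- Otherwise `o i true` and `o j true` would share `x true`, `p k true` and `R i`.
    R-inj : ∀ {i j} → i ≢ j → R i ≢ R j
    R-inj {i} {j} ne R≡ = let k , t = third ne in
      no-three (o-inj₁ ne) x≢p (≢-sym R≢x) (≢-sym R≢p) (symm (x~o i true)) (symm (x~o j true))
        (o~p (tri-13 t) true) (o~p (tri-23 t) true) (o~R i true) (subst (Adj (o j true)) (sym R≡) (o~R j true))

    q-nbrs : Nbrs q (x true ∷ x false ∷ R 0F ∷ R 1F ∷ R 2F ∷ [])
    q-nbrs = nbrs₅ (symm (x~q true)) (symm (x~q false)) (q~R 0F) (q~R 1F) (q~R 2F)
      (x-inj λ ()) (≢-sym R≢x) (≢-sym R≢x) (≢-sym R≢x) (≢-sym R≢x) (≢-sym R≢x) (≢-sym R≢x) (R-inj λ ()) (R-inj λ ()) (R-inj λ ())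

  module CubeLemmas (C : Cube) where

    open Cube C
    open CubeNbrs C public
    private module D = CubeNbrs (dual-cube C)

    o≁R : ∀ {i k s} → i ≢ k → ¬ Adj (o k s) (R i)
    o≁R {i} {k} {s} ne a = absurd (Nbrs.exhaustive (o-nbrs (triple-tri k) s) a)
      where
      absurd : ∀ {l m} → R i ∉ y k ∷ x s ∷ p l s ∷ p m s ∷ R k ∷ []
      absurd (here e) = R≢y e
      absurd (2nd e) = R≢x e
      absurd (3rd e) = R≢p e
      absurd (4th e) = R≢p e
      absurd (5th e) = R-inj ne e

    -- `R i` and `p j true` share `o i true`; all other neighbours of `p j true` except `T j` are
    -- excluded as the second one.
    R~T : ∀ {i j} → i ≢ j → Adj (R i) (T j)
    R~T {i} {j} ne =
      let k , tr = third ne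
          m , (R~m , p~m) , m≢o = other-common {R i} {p j true} {o i true} R≢p (symm (o~R i true)) (symm (o~p ne true))
      in go (tri-13 tr) R~m m≢o (Nbrs.exhaustive (D.o-nbrs (tri-swap (tri-rot tr)) true) p~m)
      where
      go : ∀ {k m} → i ≢ k → Adj (R i) m → m ≢ o i true → m ∈ b j ∷ z true ∷ o i true ∷ o k true ∷ T j ∷ [] → Adj (R i) (T j)
      go _   R~m _   (here refl) = contradiction (symm R~m) b≁R
      go _   R~m _   (2nd refl) = contradiction (symm R~m) (z≁R R≢r)
      go _   _   m≢o (3rd refl) = contradiction refl m≢o
      go i≢k R~m _   (4th refl) = contradiction (symm R~m) (o≁R i≢k)
      go _   R~m _   (5th refl) = R~m

    R-nbrs : ∀ {i j k} → Tri i j k → Nbrs (R i) (q ∷ o i true ∷ o i false ∷ T j ∷ T k ∷ [])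
    R-nbrs {i} t = nbrs₅ (symm (q~R i)) (symm (o~R i true)) (symm (o~R i false)) (R~T (tri-12 t)) (R~T (tri-13 t))
      (≢-sym o≢q) (≢-sym o≢q) (≢-sym D.R≢r) (≢-sym D.R≢r) (o-inj₂ λ ()) (≢-sym D.R≢p) (≢-sym D.R≢p) (≢-sym D.R≢p) (≢-sym D.R≢p) (D.R-inj (tri-23 t))

  cross : ∀ {f g : Bool → V} → (∀ s → Adj (f s) (g (not s))) → ∀ s → Adj (g s) (f (not s))
  cross h true  = symm (h false)
  cross h false = symm (h true)

  -- The configuration twisted at `i` on both sides: the matching of `o m` with `p n` is straight
  -- exactly when `m` comes before `n` in the order `j`, `i`, `k`.
  record Twist (i j k : Fin 3) : Set where
    field
      frame : Frame
      tr    : Tri i j k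
    open Frame frame public
    field
      oⱼ~pᵢ : ∀ s → Adj (o j s) (p i s)
      oⱼ~pₖ : ∀ s → Adj (o j s) (p k s)
      oᵢ~pₖ : ∀ s → Adj (o i s) (p k s)
      oₖ~pᵢ : ∀ s → Adj (o k s) (p i (not s))
      oₖ~pⱼ : ∀ s → Adj (o k s) (p j (not s))
      oᵢ~pⱼ : ∀ s → Adj (o i s) (p j (not s))
      q~pᵢ  : ∀ s → Adj q (p i s)
      r~oᵢ  : ∀ s → Adj r (o i s)
      q~r   : Adj q r
      r≁oⱼ  : ∀ {s} → ¬ Adj r (o j s)
      q≁pₖ  : ∀ {s} → ¬ Adj q (p k s)
      R T   : V
      oⱼ~R  : ∀ s → Adj (o j s) R
      pₖ~T  : ∀ s → Adj (p k s) T
      R≢yⱼ  : R ≢ y j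
      T≢bₖ  : T ≢ b k

  -- Duality transposes the signs and so reverses the order `j`, `i`, `k`; the pattern returns after
  -- exchanging `j` and `k`. The bits of `s` keep their names.
  dual-twist : ∀ {i j k} → Twist i j k → Twist i k j
  dual-twist C = record
    { frame = dual-frame frame ; tr = tri-swap tr
    ; oⱼ~pᵢ = symm ∘ oᵢ~pₖ ; oⱼ~pₖ = symm ∘ oⱼ~pₖ ; oᵢ~pₖ = symm ∘ oⱼ~pᵢ
    ; oₖ~pᵢ = cross oᵢ~pⱼ ; oₖ~pⱼ = cross oₖ~pⱼ ; oᵢ~pⱼ = cross oₖ~pᵢ
    ; q~pᵢ = r~oᵢ ; r~oᵢ = q~pᵢ ; q~r = symm q~r ; r≁oⱼ = q≁pₖ ; q≁pₖ = r≁oⱼ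
    ; R = T ; T = R ; oⱼ~R = pₖ~T ; pₖ~T = oⱼ~R ; R≢yⱼ = T≢bₖ ; T≢bₖ = R≢yⱼ }
    where open Twist C

  module TwistNbrs {i j k : Fin 3} (C : Twist i j k) where

    open Twist C
    open Links frame public
    private module D = Links (dual-frame frame)

    private
      oⱼ≁pⱼ : ∀ {s t} → ¬ Adj (o j s) (p j t)
      oⱼ≁pⱼ {s} = p≁o-same links
        where
        links : ∀ {m} → j ≢ m → ∃[ t ] Adj (o j s) (p m t)
        links {m} j≢m with tri-cases tr m
        ... | inj₁ refl = s , oⱼ~pᵢ s
        ... | inj₂ (inj₁ refl) = contradiction refl j≢m
        ... | inj₂ (inj₂ refl) = s , oⱼ~pₖ s

    open Fifth frame oⱼ~R R≢yⱼ oⱼ≁pⱼ public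

    R≢r : R ≢ r
    R≢r refl = r≁oⱼ (symm (oⱼ~R true))

    r≢x : ∀ {s} → r ≢ x s
    r≢x = apart (z~r true) (x≁z ∘ symm)

    r≢p : ∀ {m s} → r ≢ p m s
    r≢p = ≢-sym D.o≢q

    oᵢ-nbrs : ∀ s → Nbrs (o i s) (y i ∷ x s ∷ p j (not s) ∷ p k s ∷ r ∷ [])
    oᵢ-nbrs s = nbrs₅ (symm (y~o i s)) (symm (x~o i s)) (oᵢ~pⱼ s) (oᵢ~pₖ s) (symm (r~oᵢ s))
      y≢x y≢p y≢p (≢-sym (apart (z~r true) z≁y)) x≢p x≢p (≢-sym r≢x) (D.o-inj₁ (tri-23 tr)) (≢-sym r≢p) (≢-sym r≢p)

    q-nbrs : Nbrs q (x true ∷ x false ∷ p i true ∷ p i false ∷ r ∷ [])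
    q-nbrs = nbrs₅ (symm (x~q true)) (symm (x~q false)) (q~pᵢ true) (q~pᵢ false) q~r
      (x-inj λ ()) x≢p x≢p (≢-sym r≢x) x≢p x≢p (≢-sym r≢x) (D.o-inj₂ λ ()) (≢-sym r≢p) (≢-sym r≢p)

    oᵢ≁R : ∀ {s} → ¬ Adj (o i s) R
    oᵢ≁R {s} e with Nbrs.exhaustive (oᵢ-nbrs s) e
    ... | here e = R≢y e
    ... | 2nd e = R≢x e
    ... | 3rd e = R≢p e
    ... | 4th e = R≢p e
    ... | 5th e = R≢r e

    q≁R : ¬ Adj q R
    q≁R e with Nbrs.exhaustive q-nbrs e
    ... | here e = R≢x e
    ... | 2nd e = R≢x e
    ... | 3rd e = R≢p e
    ... | 4th e = R≢p e
    ... | 5th e = R≢r e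

    -- `x s` and `R` share `o j s`, and among the neighbours of `x s` only `o k s` is left as the
    -- second one. So a single `R` serves `j` and `k`, where the cube has two vertices.
    oₖ~R : ∀ s → Adj (o k s) R
    oₖ~R s with other-common {x s} {R} {o j s} (≢-sym R≢x) (x~o j s) (symm (oⱼ~R s))
    ... | m , (x~m , R~m) , m≢o with x-cases x~m
    ...   | inj₁ refl = contradiction (symm R~m) a≁R
    ...   | inj₂ (inj₁ refl) = contradiction (symm R~m) q≁R
    ...   | inj₂ (inj₂ (n , refl)) with tri-cases tr n
    ...     | inj₁ refl = contradiction (symm R~m) oᵢ≁R
    ...     | inj₂ (inj₁ refl) = contradiction refl m≢o
    ...     | inj₂ (inj₂ refl) = symm R~m

    oⱼ-nbrs : ∀ s → Nbrs (o j s) (y j ∷ x s ∷ p i s ∷ p k s ∷ R ∷ [])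
    oⱼ-nbrs s = nbrs₅ (symm (y~o j s)) (symm (x~o j s)) (oⱼ~pᵢ s) (oⱼ~pₖ s) (oⱼ~R s)
      y≢x y≢p y≢p (≢-sym R≢y) x≢p x≢p (≢-sym R≢x) (D.o-inj₁ (tri-13 tr)) (≢-sym R≢p) (≢-sym R≢p)

    oₖ-nbrs : ∀ s → Nbrs (o k s) (y k ∷ x s ∷ p i (not s) ∷ p j (not s) ∷ R ∷ [])
    oₖ-nbrs s = nbrs₅ (symm (y~o k s)) (symm (x~o k s)) (oₖ~pᵢ s) (oₖ~pⱼ s) (oₖ~R s)
      y≢x y≢p y≢p (≢-sym R≢y) x≢p x≢p (≢-sym R≢x) (D.o-inj₁ (tri-12 tr)) (≢-sym R≢p) (≢-sym R≢p)

  module TwistLemmas {i j k : Fin 3} (C : Twist i j k) where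

    open Twist C
    open TwistNbrs C public
    private module D = TwistNbrs (dual-twist C)

    R~T : Adj R T
    R~T = let m , (R~m , p~m) , m≢o = other-common {R} {p k true} {o j true} R≢p (symm (oⱼ~R true)) (symm (oⱼ~pₖ true))
          in go R~m m≢o (Nbrs.exhaustive (D.oⱼ-nbrs true) p~m)
      where
      go : ∀ {m} → Adj R m → m ≢ o j true → m ∈ b k ∷ z true ∷ o i true ∷ o j true ∷ T ∷ [] → Adj R T
      go R~m _   (here refl) = contradiction (symm R~m) b≁R
      go R~m _   (2nd refl) = contradiction (symm R~m) (z≁R R≢r)
      go R~m _   (3rd refl) = contradiction (symm R~m) oᵢ≁R
      go _   m≢o (4th refl) = contradiction refl m≢o
      go R~m _   (5th refl) = R~m

    R-nbrs : Nbrs R (o j true ∷ o j false ∷ o k true ∷ o k false ∷ T ∷ [])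
    R-nbrs = nbrs₅ (symm (oⱼ~R true)) (symm (oⱼ~R false)) (symm (oₖ~R true)) (symm (oₖ~R false)) R~T
      (o-inj₂ λ ()) (o-inj₁ (tri-23 tr)) (o-inj₁ (tri-23 tr)) (≢-sym D.R≢p) (o-inj₁ (tri-23 tr)) (o-inj₁ (tri-23 tr)) (≢-sym D.R≢p)
      (o-inj₂ λ ()) (≢-sym D.R≢p) (≢-sym D.R≢p)

  -- Exchanging the names of the two vertices z (if e = true) adds e to all the signs ε.
  gauge : Bool → Frame → Frame
  gauge e F = record
    { a = a ; u = u ; q = q ; r = r ; y = y ; b = b ; x = x ; z = λ s → z (s xor e) ; o = o ; p = λ i s → p i (s xor e)
    ; a~y = a~y ; u~b = u~b ; a~x = a~x ; u~z = λ s → u~z (s xor e) ; y~b = y~b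
    ; y-inj = y-inj ; b-inj = b-inj ; x-inj = x-inj ; z-inj = λ ne → z-inj (xor-injˡ e ne)
    ; a≢u = a≢u ; a≁u = a≁u ; a≁z = a≁z ; u≁x = u≁x ; x≁b = x≁b ; z≁y = z≁y ; x≁z = x≁z
    ; y~o = y~o ; b~p = λ i s → b~p i (s xor e) ; x~o = x~o ; z~p = λ i s → z~p i (s xor e) ; o≢a = o≢a ; p≢u = p≢u
    ; x~q = x~q ; z~r = λ s → z~r (s xor e) ; q≢a = q≢a ; r≢u = r≢u }
    where open Frame F

  unique-or-none : ∀ {P N : Fin 3 → Set} → (∀ i → P i ⊎ N i) → (∀ {i j} → P i → P j → i ≡ j) →
                   (∀ i → N i) ⊎ (∃[ i ] (P i × ∀ {j} → i ≢ j → N j))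
  unique-or-none {P} {N} dec uniq = go (dec 0F) (dec 1F) (dec 2F)
    where
    rest : ∀ {i} → P i → ∀ {j} → i ≢ j → N j
    rest p {j} ne with dec j
    ... | inj₁ p′ = contradiction (uniq p p′) ne
    ... | inj₂ n = n
    go : P 0F ⊎ N 0F → P 1F ⊎ N 1F → P 2F ⊎ N 2F → (∀ i → N i) ⊎ (∃[ i ] (P i × ∀ {j} → i ≢ j → N j))
    go (inj₂ n₀) (inj₂ n₁) (inj₂ n₂) = inj₁ λ { 0F → n₀ ; 1F → n₁ ; 2F → n₂ }
    go (inj₁ p)  _         _ = inj₂ (0F , p , rest p)
    go (inj₂ _)  (inj₁ p)  _ = inj₂ (1F , p , rest p)
    go (inj₂ _)  (inj₂ _)  (inj₁ p) = inj₂ (2F , p , rest p)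

  module Classify (C : Config) where

    open Config C
    open ConfigLemmas C
    private module D = ConfigLemmas (dual-config C)

    module _ (i : Fin 3) where
      fifth : ∃[ w ] ((Adj (o i true) w × Adj (o i false) w) × w ≢ y i)
      fifth = other-common (o-inj₂ λ ()) (symm (y~o i true)) (symm (y~o i false))

      fifth′ : ∃[ w ] ((Adj (p i true) w × Adj (p i false) w) × w ≢ b i)
      fifth′ = other-common (D.o-inj₂ λ ()) (symm (b~p i true)) (symm (b~p i false))

      o~fifth : ∀ s → Adj (o i s) (proj₁ fifth)
      o~fifth true  = proj₁ (proj₁ (proj₂ fifth))
      o~fifth false = proj₂ (proj₁ (proj₂ fifth))

      p~fifth′ : ∀ s → Adj (p i s) (proj₁ fifth′)
      p~fifth′ true  = proj₁ (proj₁ (proj₂ fifth′))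
      p~fifth′ false = proj₂ (proj₁ (proj₂ fifth′))

    -- The six signs form the hexagon 01, 02, 12, 10, 20, 21 whose neighbours agree in the first or
    -- in the second index. The hypotheses are the six equalities along its edges.
    constant : (∀ j → Untwisted j) → (∀ i → D.Untwisted i) → ∀ {i j} → i ≢ j → ε i j ≡ ε 0F 1F
    constant ub uy = go
      where
      ε02 : ε 0F 2F ≡ ε 0F 1F
      ε02 = uy 0F t201
      ε21 : ε 2F 1F ≡ ε 0F 1F
      ε21 = ub 1F t210
      ε20 : ε 2F 0F ≡ ε 0F 1F
      ε20 = trans (uy 2F t021) ε21
      ε10 : ε 1F 0F ≡ ε 0F 1F
      ε10 = trans (ub 0F t102) ε20
      ε12 : ε 1F 2F ≡ ε 0F 1F
      ε12 = trans (uy 1F t210) ε10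
      go : ∀ {i j} → i ≢ j → ε i j ≡ ε 0F 1F
      go {0F} {0F} ne = contradiction refl ne
      go {0F} {1F} _ = refl
      go {0F} {2F} _ = ε02
      go {1F} {0F} _ = ε10
      go {1F} {1F} ne = contradiction refl ne
      go {1F} {2F} _ = ε12
      go {2F} {0F} _ = ε20
      go {2F} {1F} _ = ε21
      go {2F} {2F} ne = contradiction refl ne

    cube-case : (∀ j → Untwisted j) → (∀ i → D.Untwisted i) → Cube
    cube-case ub uy = record
      { frame = gauge e frame
      ; o~p = λ {i} {j} ne s → subst (λ e → Adj (o i s) (p j (s xor e))) (constant ub uy ne) (o~p ne s)
      ; q≁p = λ {i} → let _ , _ , t = triple i in untwisted-q (tri-rot (tri-rot t)) (ub i (tri-rot (tri-rot t)))
      ; r≁o = λ {i} → let _ , _ , t = triple i in D.untwisted-q (tri-rot (tri-rot t)) (uy i (tri-rot (tri-rot t)))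
      ; R = λ i → proj₁ (fifth i) ; T = λ i → proj₁ (fifth′ i) ; o~R = o~fifth ; p~T = λ i s → p~fifth′ i (s xor e)
      ; R≢yᵢ = λ {i} → proj₂ (proj₂ (fifth i)) ; T≢bᵢ = λ {i} → proj₂ (proj₂ (fifth′ i)) }
      where e = ε 0F 1F

    -- By the twist `r` is adjacent to `o i true`, so `x true` and `r` share that vertex. The second
    -- common neighbour is not `a`, nor another `o j` as those indices are untwisted; so it is `q`.
    q~r : ∀ {i} → D.Twisted i → (∀ {j} → i ≢ j → D.Untwisted j) → Adj q r
    q~r {i} tw un with other-common {x true} {r} {o i true} (≢-sym (apart (z~r true) (x≁z ∘ symm))) (x~o i true) (r~o true)
      where
      t = triple-tri i
      r~o = D.twisted-q (tri-rot (tri-rot t)) (tw (tri-rot (tri-rot t)))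
    ... | m , (x~m , r~m) , m≢o with x-cases x~m
    ...   | inj₂ (inj₁ refl) = symm r~m
    ...   | inj₁ refl with a-cases (symm r~m)
    ...     | inj₁ (_ , e) = contradiction e (apart (z~r true) z≁y)
    ...     | inj₂ (_ , e) = contradiction e (apart (z~r true) (x≁z ∘ symm))
    q~r {i} tw un | m , (x~m , r~m) , m≢o | inj₂ (inj₂ (j , refl)) with i ≟ᶠ j
    ...     | yes refl = contradiction refl m≢o
    ...     | no i≢j = let k , t = third i≢j in contradiction r~m (D.untwisted-q t (un i≢j t))

    twist-case : ∀ {i j k} → Tri i j k → Twisted i → (∀ {j} → i ≢ j → Untwisted j) → D.Twisted i → (∀ {j} → i ≢ j → D.Untwisted j) →
                 Twist i j k
    twist-case {i} {j} {k} t tb ub ty uy = record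
      { frame = gauge e frame ; tr = t
      ; oⱼ~pᵢ = λ s → o~p (≢-sym (tri-12 t)) s
      ; oⱼ~pₖ = straight (tri-23 t) εⱼₖ ; oᵢ~pₖ = straight (tri-13 t) εᵢₖ
      ; oₖ~pᵢ = crossed (≢-sym (tri-13 t)) εₖᵢ ; oₖ~pⱼ = crossed (≢-sym (tri-23 t)) εₖⱼ ; oᵢ~pⱼ = crossed (tri-12 t) εᵢⱼ
      ; q~pᵢ = λ s → twisted-q jik (tb jik) (s xor e) ; r~oᵢ = D.twisted-q jik (ty jik) ; q~r = q~r ty uy
      ; r≁oⱼ = D.untwisted-q t (uy (tri-12 t) t) ; q≁pₖ = untwisted-q (tri-swap t) (ub (tri-13 t) (tri-swap t))
      ; R = proj₁ (fifth j) ; T = proj₁ (fifth′ k) ; oⱼ~R = o~fifth j ; pₖ~T = λ s → p~fifth′ k (s xor e)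
      ; R≢yⱼ = proj₂ (proj₂ (fifth j)) ; T≢bₖ = proj₂ (proj₂ (fifth′ k)) }
      where
      -- The reference sign `e` spreads unchanged to (j, k) and (i, k). Across the twist at `i` it
      -- flips at (k, i), and from there it spreads to (k, j) and (i, j).
      e = ε j i
      jik = tri-swap (tri-rot t)
      εⱼₖ : ε j k ≡ e
      εⱼₖ = sym (uy (tri-12 t) t)
      εᵢₖ : ε i k ≡ e
      εᵢₖ = trans (ub (tri-13 t) (tri-swap t)) εⱼₖ
      εₖᵢ : ε k i ≡ not e
      εₖᵢ = ¬-not (≢-sym (tb jik))
      εₖⱼ : ε k j ≡ not e
      εₖⱼ = trans (sym (uy (tri-13 t) (tri-swap t))) εₖᵢ
      εᵢⱼ : ε i j ≡ not e
      εᵢⱼ = trans (ub (tri-12 t) t) εₖⱼ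
      straight : ∀ {m n} → m ≢ n → ε m n ≡ e → ∀ s → Adj (o m s) (p n (s xor e))
      straight {m} {n} ne eq s = subst (λ e → Adj (o m s) (p n (s xor e))) eq (o~p ne s)
      crossed : ∀ {m n} → m ≢ n → ε m n ≡ not e → ∀ s → Adj (o m s) (p n (not s xor e))
      crossed {m} {n} ne eq s = subst (λ t → Adj (o m s) (p n t)) (trans (cong (s xor_) eq) (xor-not s e)) (o~p ne s)
        where
        xor-not : ∀ s e → s xor not e ≡ not s xor e
        xor-not false e     = refl
        xor-not true  false = refl
        xor-not true  true  = refl

    -- p j t and p k t′ share o i s; no neighbour of p j t can be their second common neighbour.
    mixed-absurd : ∀ {i j k} → Tri i j k → Twisted j → Untwisted k → D.Twisted i → ⊥
    mixed-absurd {i} {j} {k} tr tb ub ty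
      with other-common {p j t} {p k t′} {o i true} (D.o-inj₁ (tri-23 tr)) (symm (o~p (tri-12 tr) true)) (symm (o~p (tri-13 tr) true))
      where t = true xor ε i j ; t′ = true xor ε i k
    ... | m , (pⱼ~m , pₖ~m) , m≢o with Nbrs.exhaustive (nbrs₅ (symm (b~p j _)) (symm (z~p j _)) (symm (o~p (tri-12 tr) true))
            (p~o (≢-sym (tri-23 tr)) _) (symm (twisted-q tr (tb tr) _))
            D.y≢x (≢-sym o≢b) (≢-sym o≢b) (≢-sym (apart (x~q true) x≁b)) z≢o z≢o (≢-sym (apart (x~q true) x≁z))
            (o-inj₁ (tri-13 tr)) o≢q o≢q) pⱼ~m
      where
      z≢o : ∀ {s m t} → z s ≢ o m t
      z≢o {s} = apart (u~z s) o≁u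
    ...   | here refl = D.o≁y (≢-sym (tri-23 tr)) (symm pₖ~m)
    ...   | 2nd refl = D.o≁x (λ e → ty (tri-swap (tri-rot tr)) (sym (xor-injʳ true e))) (symm pₖ~m)
    ...   | 3rd refl = m≢o refl
    ...   | 4th refl = o≁p (symm pₖ~m)
    ...   | 5th refl = untwisted-q (tri-swap tr) (ub (tri-swap tr)) (symm pₖ~m)

    classify : Cube ⊎ (∃[ i ] ∃[ j ] ∃[ k ] Twist i j k)
    classify = go (unique-or-none twisted? twisted-unique) (unique-or-none D.twisted? D.twisted-unique)
      where
      go : (∀ j → Untwisted j) ⊎ (∃[ j ] (Twisted j × ∀ {m} → j ≢ m → Untwisted m)) →
           (∀ i → D.Untwisted i) ⊎ (∃[ i ] (D.Twisted i × ∀ {m} → i ≢ m → D.Untwisted m)) → Cube ⊎ (∃[ i ] ∃[ j ] ∃[ k ] Twist i j k)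
      go (inj₁ ub) (inj₁ uy) = inj₁ (cube-case ub uy)
      -- Five equalities around the hexagon force the sixth, so there cannot be a single twist.
      go (inj₁ ub) (inj₂ (i , ty , uy)) = let j , k , t = triple i in contradiction
        (trans (ub j t) (trans (uy (tri-13 t) (tri-rot t)) (trans (ub i (tri-rot (tri-rot t)))
          (trans (uy (tri-12 t) t) (ub k (tri-rot t)))))) (ty (tri-swap (tri-rot t)))
      go (inj₂ (i , tb , ub)) (inj₁ uy) = let j , k , t = triple i in contradiction
        (trans (uy j t) (trans (ub (tri-13 t) (tri-rot t)) (trans (uy i (tri-rot (tri-rot t)))
          (trans (ub (tri-12 t) t) (uy k (tri-rot t)))))) (tb (tri-swap (tri-rot t)))
      go (inj₂ (j , tb , ub)) (inj₂ (i , ty , uy)) with i ≟ᶠ j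
      ... | yes refl = let j , k , t = triple i in inj₂ (i , j , k , twist-case t tb ub ty uy)
      ... | no i≢j = let k , t = third i≢j in ⊥-elim (mixed-absurd t tb (ub (tri-23 t)) ty)

  fresh-neighbour : ∀ v xs → length xs < 5 → ∃[ w ] (Adj v w × w ∉ xs)
  fresh-neighbour v xs short = #>0⁻ new? (n≢0⇒n>0 λ #≡ → <⇒≱ short (≤-trans (≤-reflexive (sym (regular v)))
    (cover⇒#≤ (adj? v) {xs} λ {w} v~w → decidable-stable (w ∈? xs) λ w∉ → <-irrefl (sym #≡) (#>0 new? (v~w , w∉)))))
    where
    _∈?_ : ∀ w xs → Dec (w ∈ xs)
    w ∈? xs = Any.any? (w ≟_) xs
    new? = λ w → adj? v w ×-dec ¬? (w ∈? xs)

  pick₃ : V → V → V → Fin 3 → V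
  pick₃ c d e 0F = c
  pick₃ c d e 1F = d
  pick₃ c d e 2F = e

  pick₂ : V → V → Bool → V
  pick₂ c d true  = c
  pick₂ c d false = d

  pick₃-injective : ∀ {c d e} → c ≢ d → c ≢ e → d ≢ e → ∀ {i j} → i ≢ j → pick₃ c d e i ≢ pick₃ c d e j
  pick₃-injective cd ce de {0F} {0F} ne = contradiction refl ne
  pick₃-injective cd ce de {0F} {1F} ne = cd
  pick₃-injective cd ce de {0F} {2F} ne = ce
  pick₃-injective cd ce de {1F} {0F} ne = ≢-sym cd
  pick₃-injective cd ce de {1F} {1F} ne = contradiction refl ne
  pick₃-injective cd ce de {1F} {2F} ne = de
  pick₃-injective cd ce de {2F} {0F} ne = ≢-sym ce
  pick₃-injective cd ce de {2F} {1F} ne = ≢-sym de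
  pick₃-injective cd ce de {2F} {2F} ne = contradiction refl ne

  pick₂-injective : ∀ {c d} → c ≢ d → ∀ {s t} → s ≢ t → pick₂ c d s ≢ pick₂ c d t
  pick₂-injective cd {true}  {true}  ne = contradiction refl ne
  pick₂-injective cd {true}  {false} ne = cd
  pick₂-injective cd {false} {true}  ne = ≢-sym cd
  pick₂-injective cd {false} {false} ne = contradiction refl ne

  -- The 3-cube grows from the path `a`, `y₀`, `b₂`, `u` by taking second common neighbours. This
  -- yields five of the six edges between the middle layers; the sixth is `y₂~b₀`.
  frame-exists : ∀ {a u x x′ y b} → a ≢ u → ¬ Adj u a → ¬ Joined u a → Adj a x → Adj a x′ → x ≢ x′ → ¬ Joined u x → ¬ Joined u x′ →
                 Adj a y → Adj y b → Adj u b → Frame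
  frame-exists {a} {u} {x₁} {x₂} {y₀} {b₂} a≢u u≁a ¬Ja a~x₁ a~x₂ x₁≢x₂ ¬Jx₁ ¬Jx₂ a~y₀ y₀~b₂ u~b₂
    with other-common {u} {y₀} {b₂} (≢-sym (apart a~y₀ (u≁a ∘ symm))) u~b₂ y₀~b₂
       | other-common {a} {b₂} {y₀} (≢-sym (apart u~b₂ u≁a)) a~y₀ (symm y₀~b₂)
  ... | b₁ , (u~b₁ , y₀~b₁) , b₁≢b₂ | y₁ , (a~y₁ , b₂~y₁) , y₁≢y₀
    with other-common {a} {b₁} {y₀} (≢-sym (apart u~b₁ u≁a)) a~y₀ (symm y₀~b₁)
       | other-common {u} {y₁} {b₂} (≢-sym (apart a~y₁ (u≁a ∘ symm))) u~b₂ (symm b₂~y₁)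
  ... | y₂ , (a~y₂ , b₁~y₂) , y₂≢y₀ | b₀ , (u~b₀ , y₁~b₀) , b₀≢b₂
    with other-common {a} {b₀} {y₁} (≢-sym (apart u~b₀ u≁a)) a~y₁ (symm y₁~b₀)
  ... | m , (a~m , b₀~m) , m≢y₁ with fresh-neighbour u (b₀ ∷ b₁ ∷ b₂ ∷ []) (s≤s (s≤s (s≤s (s≤s z≤n))))
  ... | z₁ , u~z₁ , z₁∉ with fresh-neighbour u (z₁ ∷ b₀ ∷ b₁ ∷ b₂ ∷ []) ≤-refl
  ... | z₂ , u~z₂ , z₂∉ = record
    { a = a ; u = u ; y = y ; b = b ; x = x ; z = z
    ; o = λ i s → proj₁ (o-spec i s) ; p = λ i s → proj₁ (p-spec i s) ; q = proj₁ q-spec ; r = proj₁ r-spec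
    ; a~y = a~y ; u~b = u~b ; a~x = a~x ; u~z = u~z ; y~b = λ {i} {j} → y~b {i} {j}
    ; y-inj = pick₃-injective (≢-sym y₁≢y₀) (≢-sym y₂≢y₀) y₁≢y₂ ; b-inj = pick₃-injective b₀≢b₁ b₀≢b₂ b₁≢b₂
    ; x-inj = pick₂-injective x₁≢x₂ ; z-inj = pick₂-injective (λ { refl → z₂∉ (here refl) })
    ; a≢u = a≢u ; a≁u = u≁a ∘ symm ; a≁z = λ {s} a~z → ¬Ja (z s , u~z s , a~z) ; u≁x = λ {s} u~x → ¬Ja (x s , u~x , a~x s)
    ; x≁b = λ {s} {i} → x≁b s i ; z≁y = λ {s} {i} → z≁y i s ; x≁z = λ {s} {t} x~z → ¬Jx s (z t , u~z t , x~z)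
    ; y~o = λ i s → proj₁ (proj₁ (proj₂ (o-spec i s))) ; b~p = λ i s → proj₁ (proj₁ (proj₂ (p-spec i s)))
    ; x~o = λ i s → proj₂ (proj₁ (proj₂ (o-spec i s))) ; z~p = λ i s → proj₂ (proj₁ (proj₂ (p-spec i s)))
    ; o≢a = λ {i} {s} → proj₂ (proj₂ (o-spec i s)) ; p≢u = λ {i} {s} → proj₂ (proj₂ (p-spec i s))
    ; x~q = all₂ (proj₁ (proj₁ (proj₂ q-spec))) (proj₂ (proj₁ (proj₂ q-spec))) ; z~r = all₂ (proj₁ (proj₁ (proj₂ r-spec))) (proj₂ (proj₁ (proj₂ r-spec)))
    ; q≢a = proj₂ (proj₂ q-spec) ; r≢u = proj₂ (proj₂ r-spec) }
    where
    y b : Fin 3 → V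
    y = pick₃ y₀ y₁ y₂
    b = pick₃ b₀ b₁ b₂
    x z : Bool → V
    x = pick₂ x₁ x₂
    z = pick₂ z₁ z₂
    a~y : ∀ i → Adj a (y i)
    a~y = all₃ a~y₀ a~y₁ a~y₂
    u~b : ∀ i → Adj u (b i)
    u~b = all₃ u~b₀ u~b₁ u~b₂
    a~x : ∀ s → Adj a (x s)
    a~x = all₂ a~x₁ a~x₂
    u~z : ∀ s → Adj u (z s)
    u~z = all₂ u~z₁ u~z₂
    ¬Jx : ∀ s → ¬ Joined u (x s)
    ¬Jx = all₂ ¬Jx₁ ¬Jx₂
    x≁b : ∀ s i → ¬ Adj (x s) (b i)
    x≁b s i x~b = ¬Jx s (b i , u~b i , x~b)
    a≢b : ∀ i → a ≢ b i
    a≢b i = ≢-sym (apart (u~b i) u≁a)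
    y₁≢y₂ : y₁ ≢ y₂
    y₁≢y₂ refl = no-three (≢-sym y₁≢y₀) (a≢b 1F) (a≢b 2F) b₁≢b₂ (symm a~y₀) (symm a~y₁) y₀~b₁ (symm b₁~y₂) y₀~b₂ (symm b₂~y₁)
    b₀≢b₁ : b₀ ≢ b₁
    b₀≢b₁ refl = no-three (a≢b 1F) (≢-sym y₁≢y₀) (≢-sym y₂≢y₀) y₁≢y₂ a~y₀ (symm y₀~b₁) a~y₁ (symm y₁~b₀) a~y₂ b₁~y₂
    y₀≁b₀ : ¬ Adj y₀ b₀
    y₀≁b₀ y₀~b₀ = no-three (apart a~y₀ (u≁a ∘ symm)) b₀≢b₁ b₀≢b₂ b₁≢b₂ y₀~b₀ u~b₀ y₀~b₁ u~b₁ y₀~b₂ u~b₂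
    joined-y : ∀ i → Joined u (y i)
    joined-y = all₃ (b₂ , u~b₂ , y₀~b₂) (b₂ , u~b₂ , symm b₂~y₁) (b₁ , u~b₁ , symm b₁~y₂)
    y≢x : ∀ i s → y i ≢ x s
    y≢x i s e = ¬Jx s (subst (Joined u) e (joined-y i))
    -- `m` is the second common neighbour of `a` and `b₀`. By now all five neighbours of `a` are
    -- known, and every one but `y₂` is excluded.
    y₂~b₀ : Adj y₂ b₀
    y₂~b₀ with Nbrs.exhaustive (nbrs₅ a~y₀ a~y₁ a~y₂ a~x₁ a~x₂ (≢-sym y₁≢y₀) (≢-sym y₂≢y₀) (y≢x 0F true) (y≢x 0F false)
                 y₁≢y₂ (y≢x 1F true) (y≢x 1F false) (y≢x 2F true) (y≢x 2F false) x₁≢x₂) a~m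
    ... | here refl = contradiction (symm b₀~m) y₀≁b₀
    ... | 2nd refl = contradiction refl m≢y₁
    ... | 3rd refl = symm b₀~m
    ... | 4th refl = contradiction (symm b₀~m) (x≁b true 0F)
    ... | 5th refl = contradiction (symm b₀~m) (x≁b false 0F)
    y~b : ∀ {i j} → i ≢ j → Adj (y i) (b j)
    y~b {0F} {0F} ne = contradiction refl ne
    y~b {0F} {1F} ne = y₀~b₁
    y~b {0F} {2F} ne = y₀~b₂
    y~b {1F} {0F} ne = y₁~b₀
    y~b {1F} {1F} ne = contradiction refl ne
    y~b {1F} {2F} ne = symm b₂~y₁
    y~b {2F} {0F} ne = y₂~b₀
    y~b {2F} {1F} ne = symm b₁~y₂
    y~b {2F} {2F} ne = contradiction refl ne
    b≢z : ∀ i s → b i ≢ z s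
    b≢z 0F true  refl = z₁∉ (here refl)
    b≢z 1F true  refl = z₁∉ (2nd refl)
    b≢z 2F true  refl = z₁∉ (3rd refl)
    b≢z 0F false refl = z₂∉ (2nd refl)
    b≢z 1F false refl = z₂∉ (3rd refl)
    b≢z 2F false refl = z₂∉ (4th refl)
    z≁y : ∀ i s → ¬ Adj (z s) (y i)
    z≁y i s z~y = let j , k , t = triple i in
      no-three {y i} {u} (apart (a~y i) (u≁a ∘ symm)) (pick₃-injective b₀≢b₁ b₀≢b₂ b₁≢b₂ (tri-23 t)) (b≢z j s) (b≢z k s)
        (y~b (tri-12 t)) (u~b j) (y~b (tri-13 t)) (u~b k) (symm z~y) (u~z s)
    o-spec : ∀ i s → ∃[ w ] ((Adj (y i) w × Adj (x s) w) × w ≢ a)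
    o-spec i s = other-common (y≢x i s) (symm (a~y i)) (symm (a~x s))
    p-spec : ∀ i s → ∃[ w ] ((Adj (b i) w × Adj (z s) w) × w ≢ u)
    p-spec i s = other-common (b≢z i s) (symm (u~b i)) (symm (u~z s))
    q-spec : ∃[ w ] ((Adj x₁ w × Adj x₂ w) × w ≢ a)
    q-spec = other-common x₁≢x₂ (symm a~x₁) (symm a~x₂)
    r-spec : ∃[ w ] ((Adj z₁ w × Adj z₂ w) × w ≢ u)
    r-spec = other-common (λ { refl → z₂∉ (here refl) }) (symm u~z₁) (symm u~z₂)

-- The 2-(7,4,2) design, its graph Λ and the prism K₂ □ Λ

-- p₀; p₁, p₂; p₃, p₄; p₅, p₆ : the six points other than p₀ are the edges of a K₄ on the blocks 0–3,
-- grouped into its three perfect matchings; each of the blocks 4–6 misses p₀ and one matching.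
incident : Fin 7 → Fin 7 → Bool
incident 0F 0F = true
incident 0F 1F = true
incident 0F 2F = true
incident 0F 3F = true
incident 1F 0F = true
incident 1F 1F = true
incident 1F 5F = true
incident 1F 6F = true
incident 2F 2F = true
incident 2F 3F = true
incident 2F 5F = true
incident 2F 6F = true
incident 3F 0F = true
incident 3F 2F = true
incident 3F 4F = true
incident 3F 6F = true
incident 4F 1F = true
incident 4F 3F = true
incident 4F 4F = true
incident 4F 6F = true
incident 5F 0F = true
incident 5F 3F = true
incident 5F 4F = true
incident 5F 5F = true
incident 6F 1F = true
incident 6F 2F = true
incident 6F 4F = true
incident 6F 5F = true
incident _ _ = false

D₇ : IncidenceStructure
D₇ = record { points = finFS 7 ; blocks = finFS 7 ; Inc = λ p b → IsTrue (incident p b) ; inc? = λ p b → T? (incident p b) }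

Λ : Graph
Λ = incidenceGraph D₇

D₇-square : SquareTwoDesign 7 4 2 D₇
D₇-square = record
  { #points = refl ; #blocks = refl
  ; block-size = from-yes (all? λ b → blockSize b ≟ⁿ 4)
  ; balanced = from-yes (all? λ p → all? λ q → ¬? (p ≟ᶠ q) →-dec (#commonBlocks p q ≟ⁿ 2)) }
  where open IncidenceStructure D₇

all⊎? : ∀ {m n} {P : Fin m ⊎ Fin n → Set} → (∀ v → Dec (P v)) → Dec (∀ v → P v)
all⊎? P? = map′ (λ { (f , g) (inj₁ i) → f i ; (f , g) (inj₂ j) → g j }) (λ h → h ∘ inj₁ , h ∘ inj₂)
                (all? (P? ∘ inj₁) ×-dec all? (P? ∘ inj₂))

Λ-regular : Graph.Regular Λ 4
Λ-regular = from-yes (all⊎? λ v → Graph.degree Λ v ≟ⁿ 4)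

Λ-zero-two : ∀ v w → v ≢ w → Graph.#commonNeighbours Λ v w ≡ 0 ⊎ Graph.#commonNeighbours Λ v w ≡ 2
Λ-zero-two = from-yes (all⊎? λ v → all⊎? λ w → ¬? (FiniteSet._≟_ (Graph.vertices Λ) v w) →-dec
  ((Graph.#commonNeighbours Λ v w ≟ⁿ 0) ⊎-dec (Graph.#commonNeighbours Λ v w ≟ⁿ 2)))

Δ : Graph
Δ = K₂ □ Λ

allΔ? : {P : Graph.V Δ → Set} → (∀ v → Dec (P v)) → Dec (∀ v → P v)
allΔ? P? = map′ (λ h (i , v) → h i v) (λ h i v → h (i , v)) (all? λ i → all⊎? λ v → P? (i , v))

Δ-regular : Graph.Regular Δ 5
Δ-regular = from-yes (allΔ? λ v → Graph.degree Δ v ≟ⁿ 5)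

-- These conditions characterise the distance: `descend` produces a walk of length `d v w`, and
-- `step` shows that no walk is shorter.
module Metric (G : Graph) (d : Graph.V G → Graph.V G → ℕ)
  (zero : ∀ v → d v v ≡ 0) (step : ∀ v v′ w → Graph.Adj G v v′ → d v w ≤ suc (d v′ w))
  (descend : ∀ v w → v ≡ w ⊎ ∃[ v′ ] (Graph.Adj G v v′ × d v w ≡ suc (d v′ w))) where

  open Graph G

  path : ∀ n {v w} → d v w ≡ n → Walk v w n
  path n {v} {w} e with descend v w
  path n {v} {w} e | inj₁ refl = subst (Walk v v) (trans (sym (zero v)) e) []
  path (suc n) {v} {w} e | inj₂ (v′ , a , e′) = a ∷ path n (suc-injective (trans (sym e′) e))
  path 0       {v} {w} e | inj₂ (v′ , a , e′) = contradiction (trans (sym e′) e) λ ()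

  lower : ∀ {v w m} → Walk v w m → d v w ≤ m
  lower {v} []            = ≤-reflexive (zero v)
  lower {v} {w} (a ∷ p)   = ≤-trans (step v _ w a) (s≤s (lower p))

  distance : ∀ v w → Distance v w (d v w)
  distance v w = path _ refl , λ m → lower

  connected : Connected
  connected v w = d v w , path _ refl

any⊎? : ∀ {m n} {P : Fin m ⊎ Fin n → Set} → (∀ v → Dec (P v)) → Dec (∃[ v ] P v)
any⊎? P? = map′ (λ { (inj₁ (i , p)) → inj₁ i , p ; (inj₂ (j , p)) → inj₂ j , p })
                (λ { (inj₁ i , p) → inj₁ (i , p) ; (inj₂ j , p) → inj₂ (j , p) })
                (any? (P? ∘ inj₁) ⊎-dec any? (P? ∘ inj₂))

-- Any two points share a block and any two blocks share a point, so distinct vertices of one class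
-- are at distance 2, and a point is at distance 3 from a block that misses it.
dΛ : Graph.V Λ → Graph.V Λ → ℕ
dΛ (inj₁ p) (inj₁ q) = if does (p ≟ᶠ q) then 0 else 2
dΛ (inj₂ b) (inj₂ c) = if does (b ≟ᶠ c) then 0 else 2
dΛ (inj₁ p) (inj₂ b) = if incident p b then 1 else 3
dΛ (inj₂ b) (inj₁ p) = if incident p b then 1 else 3

dΛ-zero : ∀ v → dΛ v v ≡ 0
dΛ-zero = from-yes (all⊎? λ v → dΛ v v ≟ⁿ 0)

dΛ-step : ∀ v v′ w → Graph.Adj Λ v v′ → dΛ v w ≤ suc (dΛ v′ w)
dΛ-step = from-yes (all⊎? λ v → all⊎? λ v′ → all⊎? λ w → Graph.adj? Λ v v′ →-dec (dΛ v w ≤? suc (dΛ v′ w)))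

dΛ-descend : ∀ v w → v ≡ w ⊎ ∃[ v′ ] (Graph.Adj Λ v v′ × dΛ v w ≡ suc (dΛ v′ w))
dΛ-descend = from-yes (all⊎? λ v → all⊎? λ w → (FiniteSet._≟_ (Graph.vertices Λ) v w) ⊎-dec
  (any⊎? λ v′ → Graph.adj? Λ v v′ ×-dec (dΛ v w ≟ⁿ suc (dΛ v′ w))))

dΛ≤3 : ∀ v w → dΛ v w ≤ 3
dΛ≤3 = from-yes (all⊎? λ v → all⊎? λ w → dΛ v w ≤? 3)

Λ-connected : Graph.Connected Λ
Λ-connected = Metric.connected Λ dΛ dΛ-zero dΛ-step dΛ-descend

d₂ : Fin 2 → Fin 2 → ℕ
d₂ i j = if does (i ≟ᶠ j) then 0 else 1

d₂-zero : ∀ i → d₂ i i ≡ 0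
d₂-zero = from-yes (all? λ i → d₂ i i ≟ⁿ 0)

d₂≤1 : ∀ i j → d₂ i j ≤ 1
d₂≤1 = from-yes (all? λ i → all? λ j → d₂ i j ≤? 1)

d₂-≢ : ∀ i j → i ≢ j → d₂ i j ≡ 1
d₂-≢ = from-yes (all? λ i → all? λ j → ¬? (i ≟ᶠ j) →-dec (d₂ i j ≟ⁿ 1))

module Prism (G : Graph) (d : Graph.V G → Graph.V G → ℕ)
  (zero : ∀ v → d v v ≡ 0) (step : ∀ v v′ w → Graph.Adj G v v′ → d v w ≤ suc (d v′ w))
  (descend : ∀ v w → v ≡ w ⊎ ∃[ v′ ] (Graph.Adj G v v′ × d v w ≡ suc (d v′ w))) where

  -- Distances add in a Cartesian product.
  d□ : Graph.V (K₂ □ G) → Graph.V (K₂ □ G) → ℕ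
  d□ (i , v) (j , w) = d₂ i j + d v w

  d□-zero : ∀ v → d□ v v ≡ 0
  d□-zero (i , v) = cong₂ _+_ (d₂-zero i) (zero v)

  d□-step : ∀ v v′ w → Graph.Adj (K₂ □ G) v v′ → d□ v w ≤ suc (d□ v′ w)
  d□-step (i , v) (.i , v′) (j , w) (inj₁ (refl , a)) = ≤-trans (+-monoʳ-≤ (d₂ i j) (step v v′ w a)) (≤-reflexive (+-suc (d₂ i j) (d v′ w)))
  d□-step (i , v) (i′ , .v) (j , w) (inj₂ (_ , refl)) = +-mono-≤ (d₂≤1 i j) (m≤n+m (d v w) (d₂ i′ j))

  d□-descend : ∀ v w → v ≡ w ⊎ ∃[ v′ ] (Graph.Adj (K₂ □ G) v v′ × d□ v w ≡ suc (d□ v′ w))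
  d□-descend (i , v) (j , w) = go (i ≟ᶠ j)
    where
    go : Dec (i ≡ j) → (i , v) ≡ (j , w) ⊎ ∃[ v′ ] (Graph.Adj (K₂ □ G) (i , v) v′ × d□ (i , v) (j , w) ≡ suc (d□ v′ (j , w)))
    go (no i≢j) = inj₂ ((j , v) , inj₂ (i≢j , refl) , cong (_+ d v w) (trans (d₂-≢ i j i≢j) (cong suc (sym (d₂-zero j)))))
    go (yes refl) with descend v w
    ... | inj₁ refl = inj₁ refl
    ... | inj₂ (v′ , a , e) = inj₂ ((i , v′) , inj₁ (refl , a) , trans (cong (d₂ i i +_) e) (+-suc (d₂ i i) (d v′ w)))

  open Metric (K₂ □ G) d□ d□-zero d□-step d□-descend public

  diameter : ∀ {n} → (∀ v w → d v w ≤ n) → (∃[ v ] ∃[ w ] (d v w ≡ n)) → Graph.Diameter (K₂ □ G) (suc n)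
  diameter d≤n (v , w , refl) = (λ { (i , v) (j , w) → d□ (i , v) (j , w) , distance (i , v) (j , w) , +-mono-≤ (d₂≤1 i j) (d≤n v w) })
                              , (0F , v) , (1F , w) , distance (0F , v) (1F , w)

Δ-connected : Graph.Connected Δ
Δ-connected = Prism.connected Λ dΛ dΛ-zero dΛ-step dΛ-descend

Δ-diameter : Graph.Diameter Δ 4
Δ-diameter = Prism.diameter Λ dΛ dΛ-zero dΛ-step dΛ-descend dΛ≤3 (inj₁ 0F , inj₂ 4F , refl)

Λ-bipartite-zero-two : BipartiteZeroTwo 14 4 Λ
Λ-bipartite-zero-two = record
  { bipartite = (λ { (inj₁ _) → true ; (inj₂ _) → false })
              , λ { (inj₁ _) (inj₂ _) _ () ; (inj₂ _) (inj₁ _) _ () }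
  ; zeroTwo = record { connected = Λ-connected ; zero-two = Λ-zero-two }
  ; #vertices = refl ; valency = Λ-regular }

-- Phrased by common neighbours instead of walks, so that it can be decided over all pairs;
-- `zero-two⇒amply-regular` translates it into conditions on distances.
Δ-common : ∀ v w → v ≡ w ⊎ Graph.#commonNeighbours Δ v w ≡ 0 ⊎ (Graph.#commonNeighbours Δ v w ≡ 2 × ¬ Graph.Adj Δ v w)
Δ-common = from-yes (allΔ? λ v → allΔ? λ w → (FiniteSet._≟_ (Graph.vertices Δ) v w) ⊎-dec
  ((Graph.#commonNeighbours Δ v w ≟ⁿ 0) ⊎-dec ((Graph.#commonNeighbours Δ v w ≟ⁿ 2) ×-dec ¬? (Graph.adj? Δ v w))))

zero-two⇒amply-regular : ∀ (G : Graph) {k} → let open Graph G in Regular k →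
  (∀ v w → v ≡ w ⊎ #commonNeighbours v w ≡ 0 ⊎ (#commonNeighbours v w ≡ 2 × ¬ Adj v w)) → AmplyRegular G order k 0 2
zero-two⇒amply-regular G regular cases = record { order≡v = refl ; regular = regular ; adjacent = adjacent ; dist-two = dist-two }
  where
  open Graph G
  adjacent : ∀ v w → Adj v w → #commonNeighbours v w ≡ 0
  adjacent v w a with cases v w
  ... | inj₁ refl = contradiction a (irrefl refl)
  ... | inj₂ (inj₁ e) = e
  ... | inj₂ (inj₂ (_ , ¬a)) = contradiction a ¬a
  dist-two : ∀ v w → Distance v w 2 → #commonNeighbours v w ≡ 2
  dist-two v w (_∷_ {y = t} a (b ∷ []) , low) with cases v w
  ... | inj₁ refl = contradiction (low 0 []) λ ()
  ... | inj₂ (inj₂ (e , _)) = e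
  ... | inj₂ (inj₁ e) = contradiction (≤-trans (Counting.#>0 vertices (λ z → adj? v z ×-dec adj? w z) {t} (a , symm b)) (≤-reflexive e)) λ ()

Δ-amply-regular : AmplyRegular Δ 28 5 0 2
Δ-amply-regular = zero-two⇒amply-regular Δ Δ-regular Δ-common

-- Coordinates for the 5-cube and for K₂ □ Λ

hamming-refl : ∀ {n} (x : Vec Bool n) → hamming x x ≡ 0
hamming-refl []          = refl
hamming-refl (true  ∷ x) = hamming-refl x
hamming-refl (false ∷ x) = hamming-refl x

hamming-∷ : ∀ {n} c (v w : Vec Bool n) → hamming (c ∷ v) (c ∷ w) ≡ hamming v w
hamming-∷ true  v w = refl
hamming-∷ false v w = refl

cube-connected : ∀ n → Graph.Connected (cube n)
cube-connected zero    [] [] = 0 , Graph.[]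
cube-connected (suc n) (b ∷ v) (c ∷ w) = join (b ≟ᵇ c) (cube-connected n v w)
  where
  lift : ∀ {v w m} → Graph.Walk (cube n) v w m → Graph.Walk (cube (suc n)) (c ∷ v) (c ∷ w) m
  lift Graph.[] = Graph.[]
  lift (Graph._∷_ {v} {v′} a p) = Graph._∷_ (trans (hamming-∷ c v v′) a) (lift p)
  flip-bit : ∀ b c → b ≢ c → hamming (b ∷ v) (c ∷ v) ≡ 1
  flip-bit true  true  ne = contradiction refl ne
  flip-bit false false ne = contradiction refl ne
  flip-bit true  false ne = cong suc (hamming-refl v)
  flip-bit false true  ne = cong suc (hamming-refl v)
  join : Dec (b ≡ c) → ∃[ m ] Graph.Walk (cube n) v w m → ∃[ m ] Graph.Walk (cube (suc n)) (b ∷ v) (c ∷ w) m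
  join (yes refl) (m , p) = m , lift p
  join (no b≢c)   (m , p) = suc m , Graph._∷_ (flip-bit b c b≢c) (lift p)

allBits? : ∀ n {P : Vec Bool n → Set} → (∀ v → Dec (P v)) → Dec (∀ v → P v)
allBits? zero    P? = map′ (λ { p [] → p }) (λ h → h []) (P? [])
allBits? (suc n) P? = map′ (λ { (f , g) (true ∷ v) → f v ; (f , g) (false ∷ v) → g v }) (λ h → h ∘ (true ∷_) , h ∘ (false ∷_))
                           (allBits? n (P? ∘ (true ∷_)) ×-dec allBits? n (P? ∘ (false ∷_)))

module Cube-labels where

  data Label : Set where
    a u q r : Label
    y b R T : Fin 3 → Label
    x z     : Bool → Label
    o p     : Fin 3 → Bool → Label

  one two : Fin 3 → Vec Bool 2 → Vec Bool 5
  one 0F v = true ∷ false ∷ false ∷ v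
  one 1F v = false ∷ true ∷ false ∷ v
  one 2F v = false ∷ false ∷ true ∷ v
  two 0F v = false ∷ true ∷ true ∷ v
  two 1F v = true ∷ false ∷ true ∷ v
  two 2F v = true ∷ true ∷ false ∷ v

  bot top : Vec Bool 2 → Vec Bool 5
  bot v = false ∷ false ∷ false ∷ v
  top v = true ∷ true ∷ true ∷ v

  core far : Vec Bool 2
  core = false ∷ false ∷ []
  far  = true ∷ true ∷ []

  side : Bool → Vec Bool 2
  side s = s ∷ not s ∷ []

  -- The first three coordinates locate a vertex in the interval between `a` and `u`, a 3-cube; the
  -- last two locate it in the 4-cycle `a`, `x true`, `q`, `x false`.
  code : Label → Vec Bool 5
  code a       = bot core
  code (y i)   = one i core
  code (b i)   = two i core
  code u       = top core
  code (x s)   = bot (side s)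
  code (o i s) = one i (side s)
  code (p i s) = two i (side s)
  code (z s)   = top (side s)
  code q       = bot far
  code (R i)   = one i far
  code (T i)   = two i far
  code r       = top far

  decode : Vec Bool 5 → Label
  decode (false ∷ false ∷ false ∷ false ∷ false ∷ []) = a
  decode (false ∷ false ∷ false ∷ false ∷ true ∷ []) = x false
  decode (false ∷ false ∷ false ∷ true ∷ false ∷ []) = x true
  decode (false ∷ false ∷ false ∷ true ∷ true ∷ []) = q
  decode (false ∷ false ∷ true ∷ false ∷ false ∷ []) = y 2F
  decode (false ∷ false ∷ true ∷ false ∷ true ∷ []) = o 2F false
  decode (false ∷ false ∷ true ∷ true ∷ false ∷ []) = o 2F true
  decode (false ∷ false ∷ true ∷ true ∷ true ∷ []) = R 2F
  decode (false ∷ true ∷ false ∷ false ∷ false ∷ []) = y 1F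
  decode (false ∷ true ∷ false ∷ false ∷ true ∷ []) = o 1F false
  decode (false ∷ true ∷ false ∷ true ∷ false ∷ []) = o 1F true
  decode (false ∷ true ∷ false ∷ true ∷ true ∷ []) = R 1F
  decode (false ∷ true ∷ true ∷ false ∷ false ∷ []) = b 0F
  decode (false ∷ true ∷ true ∷ false ∷ true ∷ []) = p 0F false
  decode (false ∷ true ∷ true ∷ true ∷ false ∷ []) = p 0F true
  decode (false ∷ true ∷ true ∷ true ∷ true ∷ []) = T 0F
  decode (true ∷ false ∷ false ∷ false ∷ false ∷ []) = y 0F
  decode (true ∷ false ∷ false ∷ false ∷ true ∷ []) = o 0F false
  decode (true ∷ false ∷ false ∷ true ∷ false ∷ []) = o 0F true
  decode (true ∷ false ∷ false ∷ true ∷ true ∷ []) = R 0F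
  decode (true ∷ false ∷ true ∷ false ∷ false ∷ []) = b 1F
  decode (true ∷ false ∷ true ∷ false ∷ true ∷ []) = p 1F false
  decode (true ∷ false ∷ true ∷ true ∷ false ∷ []) = p 1F true
  decode (true ∷ false ∷ true ∷ true ∷ true ∷ []) = T 1F
  decode (true ∷ true ∷ false ∷ false ∷ false ∷ []) = b 2F
  decode (true ∷ true ∷ false ∷ false ∷ true ∷ []) = p 2F false
  decode (true ∷ true ∷ false ∷ true ∷ false ∷ []) = p 2F true
  decode (true ∷ true ∷ false ∷ true ∷ true ∷ []) = T 2F
  decode (true ∷ true ∷ true ∷ false ∷ false ∷ []) = u
  decode (true ∷ true ∷ true ∷ false ∷ true ∷ []) = z false
  decode (true ∷ true ∷ true ∷ true ∷ false ∷ []) = z true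
  decode (true ∷ true ∷ true ∷ true ∷ true ∷ []) = r

  code-decode : ∀ v → code (decode v) ≡ v
  code-decode = from-yes (allBits? 5 λ v → FiniteSet._≟_ (bitsFS 5) (code (decode v)) v)

  decode-code : ∀ l → decode (code l) ≡ l
  decode-code a = refl
  decode-code u = refl
  decode-code q = refl
  decode-code r = refl
  decode-code (y i) = all₃ {λ i → decode (code (y i)) ≡ y i} refl refl refl i
  decode-code (b i) = all₃ {λ i → decode (code (b i)) ≡ b i} refl refl refl i
  decode-code (R i) = all₃ {λ i → decode (code (R i)) ≡ R i} refl refl refl i
  decode-code (T i) = all₃ {λ i → decode (code (T i)) ≡ T i} refl refl refl i
  decode-code (x s) = all₂ {λ s → decode (code (x s)) ≡ x s} refl refl s
  decode-code (z s) = all₂ {λ s → decode (code (z s)) ≡ z s} refl refl s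
  decode-code (o i s) = all₃ {λ i → ∀ s → decode (code (o i s)) ≡ o i s} (all₂ refl refl) (all₂ refl refl) (all₂ refl refl) i s
  decode-code (p i s) = all₃ {λ i → ∀ s → decode (code (p i s)) ≡ p i s} (all₂ refl refl) (all₂ refl refl) (all₂ refl refl) i s

  -- Each list keeps the order of the corresponding neighbour lemma, so that these lemmas prove
  -- `cube-local` as they stand.
  nb : Label → List Label
  nb a = y 0F ∷ y 1F ∷ y 2F ∷ x true ∷ x false ∷ []
  nb u = b 0F ∷ b 1F ∷ b 2F ∷ z true ∷ z false ∷ []
  nb q = x true ∷ x false ∷ R 0F ∷ R 1F ∷ R 2F ∷ []
  nb r = z true ∷ z false ∷ T 0F ∷ T 1F ∷ T 2F ∷ []
  nb (y i) = let j , k , _ = triple i in a ∷ b j ∷ b k ∷ o i true ∷ o i false ∷ []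
  nb (b i) = let j , k , _ = triple i in u ∷ y j ∷ y k ∷ p i true ∷ p i false ∷ []
  nb (x s) = a ∷ q ∷ o 0F s ∷ o 1F s ∷ o 2F s ∷ []
  nb (z s) = u ∷ r ∷ p 0F s ∷ p 1F s ∷ p 2F s ∷ []
  nb (o i s) = let j , k , _ = triple i in y i ∷ x s ∷ p j s ∷ p k s ∷ R i ∷ []
  nb (p i s) = let j , k , _ = triple i in b i ∷ z s ∷ o j s ∷ o k s ∷ T i ∷ []
  nb (R i) = let j , k , _ = triple i in q ∷ o i true ∷ o i false ∷ T j ∷ T k ∷ []
  nb (T i) = let j , k , _ = triple i in r ∷ p i true ∷ p i false ∷ R j ∷ R k ∷ []

  nbᶜ : Vec Bool 5 → List (Vec Bool 5)
  nbᶜ v = List.map code (nb (decode v))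

  nb⁺ : ∀ v w → hamming v w ≡ 1 → w ∈ nbᶜ v
  nb⁺ = from-yes (allBits? 5 λ v → allBits? 5 λ w → (hamming v w ≟ⁿ 1) →-dec Any.any? (FiniteSet._≟_ (bitsFS 5) w) (nbᶜ v))

  nb⁻ : ∀ v → All (λ w → hamming v w ≡ 1) (nbᶜ v)
  nb⁻ = from-yes (allBits? 5 λ v → All.all? (λ w → hamming v w ≟ⁿ 1) (nbᶜ v))

module Twist-labels where

  data Label : Set where
    a u q r R T : Label
    y b         : Fin 3 → Label
    x z         : Bool → Label
    o p         : Fin 3 → Bool → Label

  -- The indices 0, 1, 2 stand for i, j, k of the twist. The edges of the factor K₂ match `a` with
  -- `y i`, `u` with `b i`, `x s` with `o i s`, `z s` with `p i s`, `q` with `r`, `R` with `T`,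
  -- `y j` with `b k`, `y k` with `b j`, `o j s` with `p k s`, and `o k s` with the opposite `p j`.
  code : Label → Graph.V Δ
  code a = (0F , inj₁ 0F)
  code u = (1F , inj₁ 2F)
  code q = (0F , inj₁ 1F)
  code r = (1F , inj₁ 1F)
  code R = (0F , inj₂ 4F)
  code T = (1F , inj₂ 4F)
  code (y 0F) = (1F , inj₁ 0F)
  code (y 1F) = (0F , inj₂ 2F)
  code (y 2F) = (0F , inj₂ 3F)
  code (b 0F) = (0F , inj₁ 2F)
  code (b 1F) = (1F , inj₂ 3F)
  code (b 2F) = (1F , inj₂ 2F)
  code (x false) = (0F , inj₂ 0F)
  code (x true) = (0F , inj₂ 1F)
  code (z false) = (1F , inj₂ 6F)
  code (z true) = (1F , inj₂ 5F)
  code (o 0F false) = (1F , inj₂ 0F)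
  code (o 0F true) = (1F , inj₂ 1F)
  code (o 1F false) = (0F , inj₁ 3F)
  code (o 1F true) = (0F , inj₁ 6F)
  code (o 2F false) = (0F , inj₁ 5F)
  code (o 2F true) = (0F , inj₁ 4F)
  code (p 0F false) = (0F , inj₂ 6F)
  code (p 0F true) = (0F , inj₂ 5F)
  code (p 1F false) = (1F , inj₁ 4F)
  code (p 1F true) = (1F , inj₁ 5F)
  code (p 2F false) = (1F , inj₁ 3F)
  code (p 2F true) = (1F , inj₁ 6F)

  decode : Graph.V Δ → Label
  decode (0F , inj₁ 0F) = a
  decode (0F , inj₁ 1F) = q
  decode (0F , inj₁ 2F) = b 0F
  decode (0F , inj₁ 3F) = o 1F false
  decode (0F , inj₁ 4F) = o 2F true
  decode (0F , inj₁ 5F) = o 2F false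
  decode (0F , inj₁ 6F) = o 1F true
  decode (0F , inj₂ 0F) = x false
  decode (0F , inj₂ 1F) = x true
  decode (0F , inj₂ 2F) = y 1F
  decode (0F , inj₂ 3F) = y 2F
  decode (0F , inj₂ 4F) = R
  decode (0F , inj₂ 5F) = p 0F true
  decode (0F , inj₂ 6F) = p 0F false
  decode (1F , inj₁ 0F) = y 0F
  decode (1F , inj₁ 1F) = r
  decode (1F , inj₁ 2F) = u
  decode (1F , inj₁ 3F) = p 2F false
  decode (1F , inj₁ 4F) = p 1F false
  decode (1F , inj₁ 5F) = p 1F true
  decode (1F , inj₁ 6F) = p 2F true
  decode (1F , inj₂ 0F) = o 0F false
  decode (1F , inj₂ 1F) = o 0F true
  decode (1F , inj₂ 2F) = b 2F
  decode (1F , inj₂ 3F) = b 1F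
  decode (1F , inj₂ 4F) = T
  decode (1F , inj₂ 5F) = z true
  decode (1F , inj₂ 6F) = z false

  code-decode : ∀ v → code (decode v) ≡ v
  code-decode = from-yes (allΔ? λ v → FiniteSet._≟_ (Graph.vertices Δ) (code (decode v)) v)

  decode-code : ∀ l → decode (code l) ≡ l
  decode-code a = refl
  decode-code u = refl
  decode-code q = refl
  decode-code r = refl
  decode-code R = refl
  decode-code T = refl
  decode-code (y i) = all₃ {λ i → decode (code (y i)) ≡ y i} refl refl refl i
  decode-code (b i) = all₃ {λ i → decode (code (b i)) ≡ b i} refl refl refl i
  decode-code (x s) = all₂ {λ s → decode (code (x s)) ≡ x s} refl refl s
  decode-code (z s) = all₂ {λ s → decode (code (z s)) ≡ z s} refl refl s
  decode-code (o i s) = all₃ {λ i → ∀ s → decode (code (o i s)) ≡ o i s} (all₂ refl refl) (all₂ refl refl) (all₂ refl refl) i s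
  decode-code (p i s) = all₃ {λ i → ∀ s → decode (code (p i s)) ≡ p i s} (all₂ refl refl) (all₂ refl refl) (all₂ refl refl) i s

  -- Several lists on the side of `u` name index 2 before index 1, because `dual-twist` exchanges
  -- `j` and `k`.
  nb : Label → List Label
  nb a = y 0F ∷ y 1F ∷ y 2F ∷ x true ∷ x false ∷ []
  nb u = b 0F ∷ b 2F ∷ b 1F ∷ z true ∷ z false ∷ []
  nb q = x true ∷ x false ∷ p 0F true ∷ p 0F false ∷ r ∷ []
  nb r = z true ∷ z false ∷ o 0F true ∷ o 0F false ∷ q ∷ []
  nb R = o 1F true ∷ o 1F false ∷ o 2F true ∷ o 2F false ∷ T ∷ []
  nb T = p 2F true ∷ p 2F false ∷ p 1F true ∷ p 1F false ∷ R ∷ []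
  nb (y i) = let j , k , _ = triple i in a ∷ b j ∷ b k ∷ o i true ∷ o i false ∷ []
  nb (b i) = let j , k , _ = triple i in u ∷ y j ∷ y k ∷ p i true ∷ p i false ∷ []
  nb (x s) = a ∷ q ∷ o 0F s ∷ o 1F s ∷ o 2F s ∷ []
  nb (z s) = u ∷ r ∷ p 0F s ∷ p 2F s ∷ p 1F s ∷ []
  nb (o 0F s) = y 0F ∷ x s ∷ p 1F (not s) ∷ p 2F s ∷ r ∷ []
  nb (o 1F s) = y 1F ∷ x s ∷ p 0F s ∷ p 2F s ∷ R ∷ []
  nb (o 2F s) = y 2F ∷ x s ∷ p 0F (not s) ∷ p 1F (not s) ∷ R ∷ []
  nb (p 0F s) = b 0F ∷ z s ∷ o 2F (not s) ∷ o 1F s ∷ q ∷ []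
  nb (p 2F s) = b 2F ∷ z s ∷ o 0F s ∷ o 1F s ∷ T ∷ []
  nb (p 1F s) = b 1F ∷ z s ∷ o 0F (not s) ∷ o 2F (not s) ∷ T ∷ []

  nbᶜ : Graph.V Δ → List (Graph.V Δ)
  nbᶜ v = List.map code (nb (decode v))

  nb⁺ : ∀ v w → Graph.Adj Δ v w → w ∈ nbᶜ v
  nb⁺ = from-yes (allΔ? λ v → allΔ? λ w → Graph.adj? Δ v w →-dec Any.any? (FiniteSet._≟_ (Graph.vertices Δ) w) (nbᶜ v))

  nb⁻ : ∀ v → All (Graph.Adj Δ v) (nbᶜ v)
  nb⁻ = from-yes (allΔ? λ v → All.all? (Graph.adj? Δ v) (nbᶜ v))

-- Recognition of the two models

module Labelled (Γ K : Graph) {L : Set} (code : L → Graph.V K) (decode : Graph.V K → L)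
  (code-decode : ∀ v → code (decode v) ≡ v) (decode-code : ∀ l → decode (code l) ≡ l) (nb : L → List L)
  (nb⁺ : ∀ v w → Graph.Adj K v w → w ∈ List.map code (nb (decode v)))
  (nb⁻ : ∀ v → All (Graph.Adj K v) (List.map code (nb (decode v))))
  (value : L → Graph.V Γ) (local : ∀ l → Neighbourhoods.Nbrs Γ (value l) (List.map value (nb l)))
  (Γ-connected : Graph.Connected Γ) (K-connected : Graph.Connected K)
  (l₀ : L) (base : ∀ l → value l ≡ value l₀ → l ≡ l₀) where

  isomorphism : Γ ≅ K
  isomorphism = Covering.isomorphism Γ K (value ∘ decode) (λ v → List.map code (nb (decode v))) (λ {v} {w} → nb⁺ v w) (λ {v} → All.lookup (nb⁻ v))
    (λ v → subst (Neighbourhoods.Nbrs Γ (value (decode v))) (relabel (nb (decode v))) (local (decode v)))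
    Γ-connected K-connected (code l₀)
    (λ v e → trans (sym (code-decode v)) (cong code (base (decode v) (trans e (cong value (decode-code l₀))))))
    where
    relabel : ∀ ls → List.map value ls ≡ List.map (value ∘ decode) (List.map code ls)
    relabel ls = trans (map-cong (λ l → cong value (sym (decode-code l))) ls) (map-∘ ls)

module Models (Γ : Graph) (regular : Graph.Regular Γ 5)
  (triangle-free : ∀ {x y z} → Graph.Adj Γ x y → Graph.Adj Γ y z → Graph.Adj Γ x z → ⊥)
  (common : ∀ {x y} → x ≢ y → Neighbours.Joined Γ x y → Graph.#commonNeighbours Γ x y ≡ 2)
  (connected : Graph.Connected Γ) where

  open Graph Γ
  open Neighbourhoods Γ
  open Neighbours Γ using (apart)
  open Rectagraph Γ regular common

  a≁o : ∀ (F : Frame) {i s} → ¬ Adj (Frame.o F i s) (Frame.a F)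
  a≁o F {i} {s} o~a = triangle-free (Frame.a~y F i) (Frame.y~o F i s) (symm o~a)

  module _ (C : Cube) where
    private
      module C = Cube C
      module A = CubeLemmas C
      module U = CubeLemmas (dual-cube C)
    open Cube-labels

    cube-value : Label → V
    cube-value a = C.a
    cube-value u = C.u
    cube-value q = C.q
    cube-value r = C.r
    cube-value (y i) = C.y i
    cube-value (b i) = C.b i
    cube-value (R i) = C.R i
    cube-value (T i) = C.T i
    cube-value (x s) = C.x s
    cube-value (z s) = C.z s
    cube-value (o i s) = C.o i s
    cube-value (p i s) = C.p i s

    cube-local : ∀ l → Nbrs (cube-value l) (List.map cube-value (nb l))
    cube-local a = A.a-nbrs t012
    cube-local u = U.a-nbrs t012
    cube-local q = A.q-nbrs
    cube-local r = U.q-nbrs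
    cube-local (y i) = A.y-nbrs (triple-tri i)
    cube-local (b i) = U.y-nbrs (triple-tri i)
    cube-local (R i) = A.R-nbrs (triple-tri i)
    cube-local (T i) = U.R-nbrs (triple-tri i)
    cube-local (x s) = A.x-nbrs t012 s
    cube-local (z s) = U.x-nbrs t012 s
    cube-local (o i s) = A.o-nbrs (triple-tri i) s
    cube-local (p i s) = U.o-nbrs (triple-tri i) s

    -- The one-point fibre demanded by `Covering`, taken at `a`; for `R i` it uses that `a` and
    -- `o i s`, which share `y i`, are not adjacent.
    cube-base : ∀ l → cube-value l ≡ C.a → l ≡ a
    cube-base a e = refl
    cube-base u e = contradiction (sym e) C.a≢u
    cube-base q e = contradiction e C.q≢a
    cube-base r e = contradiction e (apart (C.z~r true) (C.a≁z ∘ symm))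
    cube-base (y i) e = contradiction (C.a~y i) (irrefl (sym e))
    cube-base (b i) e = contradiction (sym e) A.a≢b
    cube-base (R i) e = contradiction e (apart (C.o~R i true) (a≁o C.frame))
    cube-base (T i) e = contradiction e (apart (C.p~T i true) (U.o≁u ∘ symm))
    cube-base (x s) e = contradiction (C.a~x s) (irrefl (sym e))
    cube-base (z s) e = contradiction e (apart (C.u~z s) (C.a≁u ∘ symm))
    cube-base (o i s) e = contradiction e C.o≢a
    cube-base (p i s) e = contradiction e (apart (C.z~p i s) (C.a≁z ∘ symm))

    ≅cube : Γ ≅ cube 5
    ≅cube = Labelled.isomorphism Γ (cube 5) code decode code-decode decode-code nb nb⁺ nb⁻
              cube-value cube-local connected (cube-connected 5) a cube-base

  module _ {i j k : Fin 3} (C : Twist i j k) where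
    private
      module C = Twist C
      module A = TwistLemmas C
      module U = TwistLemmas (dual-twist C)
    open Twist-labels

    ix : Fin 3 → Fin 3
    ix 0F = i
    ix 1F = j
    ix 2F = k

    twist-value : Label → V
    twist-value a = C.a
    twist-value u = C.u
    twist-value q = C.q
    twist-value r = C.r
    twist-value R = C.R
    twist-value T = C.T
    twist-value (y m) = C.y (ix m)
    twist-value (b m) = C.b (ix m)
    twist-value (x s) = C.x s
    twist-value (z s) = C.z s
    twist-value (o m s) = C.o (ix m) s
    twist-value (p m s) = C.p (ix m) s

    ix-triple : ∀ m → Tri (ix m) (ix (proj₁ (triple m))) (ix (proj₁ (proj₂ (triple m))))
    ix-triple 0F = C.tr
    ix-triple 1F = tri-rot C.tr
    ix-triple 2F = tri-rot (tri-rot C.tr)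

    twist-local : ∀ l → Nbrs (twist-value l) (List.map twist-value (nb l))
    twist-local a = A.a-nbrs C.tr
    twist-local u = U.a-nbrs (tri-swap C.tr)
    twist-local q = A.q-nbrs
    twist-local r = U.q-nbrs
    twist-local R = A.R-nbrs
    twist-local T = U.R-nbrs
    twist-local (y m) = A.y-nbrs (ix-triple m)
    twist-local (b m) = U.y-nbrs (ix-triple m)
    twist-local (x s) = A.x-nbrs C.tr s
    twist-local (z s) = U.x-nbrs (tri-swap C.tr) s
    twist-local (o 0F s) = A.oᵢ-nbrs s
    twist-local (o 1F s) = A.oⱼ-nbrs s
    twist-local (o 2F s) = A.oₖ-nbrs s
    twist-local (p 0F s) = U.oᵢ-nbrs s
    twist-local (p 1F s) = U.oₖ-nbrs s
    twist-local (p 2F s) = U.oⱼ-nbrs s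

    twist-base : ∀ l → twist-value l ≡ C.a → l ≡ a
    twist-base a e = refl
    twist-base u e = contradiction (sym e) C.a≢u
    twist-base q e = contradiction e C.q≢a
    twist-base r e = contradiction e (apart (C.z~r true) (C.a≁z ∘ symm))
    twist-base R e = contradiction e (apart (C.oⱼ~R true) (a≁o C.frame))
    twist-base T e = contradiction e (apart (C.pₖ~T true) (U.o≁u ∘ symm))
    twist-base (y m) e = contradiction (C.a~y (ix m)) (irrefl (sym e))
    twist-base (b m) e = contradiction (sym e) A.a≢b
    twist-base (x s) e = contradiction (C.a~x s) (irrefl (sym e))
    twist-base (z s) e = contradiction e (apart (C.u~z s) (C.a≁u ∘ symm))
    twist-base (o m s) e = contradiction e C.o≢a
    twist-base (p m s) e = contradiction e (apart (C.z~p (ix m) s) (C.a≁z ∘ symm))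

    ≅prism : Γ ≅ Δ
    ≅prism = Labelled.isomorphism Γ Δ code decode code-decode decode-code nb nb⁺ nb⁻
               twist-value twist-local connected Δ-connected a twist-base

-- Uniqueness of Λ

module Λ-labels where

  data Label : Set where
    p g         : Label
    h eᵗ eᶠ C   : Fin 3 → Label

  code : Label → Graph.V Λ
  code p       = inj₁ 0F
  code (eᵗ 0F) = inj₁ 1F
  code (eᶠ 0F) = inj₁ 2F
  code (eᵗ 1F) = inj₁ 3F
  code (eᶠ 1F) = inj₁ 4F
  code (eᵗ 2F) = inj₁ 5F
  code (eᶠ 2F) = inj₁ 6F
  code g       = inj₂ 0F
  code (h 0F)  = inj₂ 1F
  code (h 1F)  = inj₂ 2F
  code (h 2F)  = inj₂ 3F
  code (C 0F)  = inj₂ 4F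
  code (C 1F)  = inj₂ 5F
  code (C 2F)  = inj₂ 6F

  decode : Graph.V Λ → Label
  decode (inj₁ 0F) = p
  decode (inj₁ 1F) = eᵗ 0F
  decode (inj₁ 2F) = eᶠ 0F
  decode (inj₁ 3F) = eᵗ 1F
  decode (inj₁ 4F) = eᶠ 1F
  decode (inj₁ 5F) = eᵗ 2F
  decode (inj₁ 6F) = eᶠ 2F
  decode (inj₂ 0F) = g
  decode (inj₂ 1F) = h 0F
  decode (inj₂ 2F) = h 1F
  decode (inj₂ 3F) = h 2F
  decode (inj₂ 4F) = C 0F
  decode (inj₂ 5F) = C 1F
  decode (inj₂ 6F) = C 2F

  code-decode : ∀ v → code (decode v) ≡ v
  code-decode = from-yes (all⊎? λ v → FiniteSet._≟_ (Graph.vertices Λ) (code (decode v)) v)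

  decode-code : ∀ l → decode (code l) ≡ l
  decode-code p = refl
  decode-code g = refl
  decode-code (h m)  = all₃ {λ m → decode (code (h m)) ≡ h m} refl refl refl m
  decode-code (eᵗ m) = all₃ {λ m → decode (code (eᵗ m)) ≡ eᵗ m} refl refl refl m
  decode-code (eᶠ m) = all₃ {λ m → decode (code (eᶠ m)) ≡ eᶠ m} refl refl refl m
  decode-code (C m)  = all₃ {λ m → decode (code (C m)) ≡ C m} refl refl refl m

  nb : Label → List Label
  nb p      = g ∷ h 0F ∷ h 1F ∷ h 2F ∷ []
  nb g      = p ∷ eᵗ 0F ∷ eᵗ 1F ∷ eᵗ 2F ∷ []
  nb (h m)  = let n , l , _ = triple m in p ∷ eᵗ m ∷ eᶠ n ∷ eᶠ l ∷ []
  nb (eᵗ m) = let n , l , _ = triple m in g ∷ h m ∷ C n ∷ C l ∷ []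
  nb (eᶠ m) = let n , l , _ = triple m in h n ∷ h l ∷ C n ∷ C l ∷ []
  nb (C m)  = let n , l , _ = triple m in eᵗ n ∷ eᵗ l ∷ eᶠ n ∷ eᶠ l ∷ []

  nbᶜ : Graph.V Λ → List (Graph.V Λ)
  nbᶜ v = List.map code (nb (decode v))

  nb⁺ : ∀ v w → Graph.Adj Λ v w → w ∈ nbᶜ v
  nb⁺ = from-yes (all⊎? λ v → all⊎? λ w → Graph.adj? Λ v w →-dec Any.any? (FiniteSet._≟_ (Graph.vertices Λ) w) (nbᶜ v))

  nb⁻ : ∀ v → All (Graph.Adj Λ v) (nbᶜ v)
  nb⁻ = from-yes (all⊎? λ v → All.all? (Graph.adj? Λ v) (nbᶜ v))

-- The neighbours of a vertex p₀ are g, h 0, h 1, h 2; the second common neighbours of two of them are the edges of K₄: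
-- eᵗ m joins g to h m, and eᶠ m is the opposite edge.  Every further neighbour C of eᵗ m is also one of eᶠ m.
module Λ-unique (Γ : Graph) (regular : Graph.Regular Γ 4) (connected : Graph.Connected Γ)
  (triangle-free : ∀ {x y z} → Graph.Adj Γ x y → Graph.Adj Γ y z → Graph.Adj Γ x z → ⊥)
  (two : ∀ {v w z} → v ≢ w → Neighbours.Joined Γ v z → Neighbours.Joined Γ z w → Graph.#commonNeighbours Γ v w ≡ 2)
  (p₀ : Graph.V Γ) where

  open Graph Γ
  open FiniteSet vertices using (#; _≟_)
  open Counting vertices
  open Neighbours Γ
  open Neighbourhoods Γ

  -- The hypothesis `two` expresses lying on the same side by a chain of two joined pairs, here `v`,
  -- `w`, `w`. A proper chain occurs in `opposite`, for two opposite edges of K₄.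
  common : ∀ {v w z} → v ≢ w → Adj v z → Adj w z → #commonNeighbours v w ≡ 2
  common v≢w v~z w~z = two v≢w (_ , v~z , w~z) (_ , w~z , w~z)

  other : ∀ {v w z} → v ≢ w → Adj v z → Adj w z → ∃[ t ] ((Adj v t × Adj w t) × t ≢ z)
  other {v} {w} {z} v≢w v~z w~z = another (λ t → adj? v t ×-dec adj? w t) (≤-reflexive (sym (common v≢w v~z w~z))) z

  no-three : ∀ {v w c d e} → v ≢ w → c ≢ d → c ≢ e → d ≢ e →
             Adj v c → Adj w c → Adj v d → Adj w d → Adj v e → Adj w e → ⊥
  no-three v≢w c≢d c≢e d≢e vc wc = at-most-two (common v≢w vc wc) c≢d c≢e d≢e vc wc

  nbrs₄ : ∀ {v c d e f} → Adj v c → Adj v d → Adj v e → Adj v f →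
          c ≢ d → c ≢ e → c ≢ f → d ≢ e → d ≢ f → e ≢ f → Nbrs v (c ∷ d ∷ e ∷ f ∷ [])
  nbrs₄ {v} c d e f cd ce cf de df ef = nbrs (regular v) (c ∷ d ∷ e ∷ f ∷ [])
    ((cd ∷ ce ∷ cf ∷ []) ∷ (de ∷ df ∷ []) ∷ (ef ∷ []) ∷ [] ∷ [])

  record Star : Set where
    field
      g     : V
      h     : Fin 3 → V
      p~g   : Adj p₀ g
      p~h   : ∀ m → Adj p₀ (h m)
      g≢h   : ∀ {m} → g ≢ h m
      h-inj : ∀ {m n} → m ≢ n → h m ≢ h n

  abstract
    star : Star
    star = go (members (adj? p₀)) (trans (length-members (adj? p₀)) (regular p₀)) (members-unique (adj? p₀)) (∈-members⁻ (adj? p₀))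
      where
      go : ∀ xs → length xs ≡ 4 → Unique xs → (∀ {w} → w ∈ xs → Adj p₀ w) → Star
      go (b₀ ∷ b₁ ∷ b₂ ∷ b₃ ∷ []) refl ((n₁ ∷ n₂ ∷ n₃ ∷ []) ∷ (n₄ ∷ n₅ ∷ []) ∷ (n₆ ∷ []) ∷ [] ∷ []) adj = record
        { g = b₀ ; h = λ { 0F → b₁ ; 1F → b₂ ; 2F → b₃ } ; p~g = adj (here refl)
        ; p~h = λ { 0F → adj (2nd refl) ; 1F → adj (3rd refl) ; 2F → adj (4th refl) }
        ; g≢h = λ { {0F} → n₁ ; {1F} → n₂ ; {2F} → n₃ }
        ; h-inj = λ { {0F} {0F} ne → contradiction refl ne ; {0F} {1F} _ → n₄ ; {0F} {2F} _ → n₅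
                    ; {1F} {0F} _ → ≢-sym n₄ ; {1F} {1F} ne → contradiction refl ne ; {1F} {2F} _ → n₆
                    ; {2F} {0F} _ → ≢-sym n₅ ; {2F} {1F} _ → ≢-sym n₆ ; {2F} {2F} ne → contradiction refl ne } }

  open Star star

  -- `p₀` and `e` already share `b` and `c`: an edge of K₄ has only two ends.
  edge≁ : ∀ {b c d e} → Adj p₀ b → Adj p₀ c → Adj p₀ d → b ≢ c → b ≢ d → c ≢ d → Adj b e → Adj c e → e ≢ p₀ → ¬ Adj d e
  edge≁ pb pc pd bc bd cd be ce e≢p de = no-three (≢-sym e≢p) bc bd cd pb (symm be) pc (symm ce) pd (symm de)

  module _ (m : Fin 3) where
    abstract
      eᵗ-spec : ∃[ e ] ((Adj g e × Adj (h m) e) × e ≢ p₀)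
      eᵗ-spec = other g≢h (symm p~g) (symm (p~h m))

    eᵗ : V
    eᵗ = proj₁ eᵗ-spec

    g~eᵗ : Adj g eᵗ
    g~eᵗ = proj₁ (proj₁ (proj₂ eᵗ-spec))

    h~eᵗ : Adj (h m) eᵗ
    h~eᵗ = proj₂ (proj₁ (proj₂ eᵗ-spec))

    eᵗ≢p : eᵗ ≢ p₀
    eᵗ≢p = proj₂ (proj₂ eᵗ-spec)

    abstract
      eᶠ-spec : ∃[ e ] ((Adj (h (proj₁ (triple m))) e × Adj (h (proj₁ (proj₂ (triple m)))) e) × e ≢ p₀)
      eᶠ-spec = other (h-inj (tri-23 (triple-tri m))) (symm (p~h _)) (symm (p~h _))

    eᶠ : V
    eᶠ = proj₁ eᶠ-spec

    eᶠ≢p : eᶠ ≢ p₀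
    eᶠ≢p = proj₂ (proj₂ eᶠ-spec)

  h~eᶠ : ∀ {m n} → m ≢ n → Adj (h n) (eᶠ m)
  h~eᶠ {m} {n} m≢n with tri-cases (triple-tri m) n
  ... | inj₁ refl = contradiction refl m≢n
  ... | inj₂ (inj₁ refl) = proj₁ (proj₁ (proj₂ (eᶠ-spec m)))
  ... | inj₂ (inj₂ refl) = proj₂ (proj₁ (proj₂ (eᶠ-spec m)))

  h≁eᵗ : ∀ {m n} → m ≢ n → ¬ Adj (h n) (eᵗ m)
  h≁eᵗ {m} {n} m≢n = edge≁ p~g (p~h m) (p~h n) g≢h g≢h (h-inj m≢n) (g~eᵗ m) (h~eᵗ m) (eᵗ≢p m)

  g≁eᶠ : ∀ {m} → ¬ Adj g (eᶠ m)
  g≁eᶠ {m} = edge≁ (p~h _) (p~h _) p~g (h-inj (tri-23 (triple-tri m))) (≢-sym g≢h) (≢-sym g≢h)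
    (h~eᶠ (tri-12 (triple-tri m))) (h~eᶠ (tri-13 (triple-tri m))) (eᶠ≢p m)

  h≁eᶠ : ∀ {m} → ¬ Adj (h m) (eᶠ m)
  h≁eᶠ {m} = edge≁ (p~h _) (p~h _) (p~h m) (h-inj (tri-23 (triple-tri m))) (≢-sym (h-inj (tri-12 (triple-tri m)))) (≢-sym (h-inj (tri-13 (triple-tri m))))
    (h~eᶠ (tri-12 (triple-tri m))) (h~eᶠ (tri-13 (triple-tri m))) (eᶠ≢p m)

  eᵗ≢eᶠ : ∀ {m n} → eᵗ m ≢ eᶠ n
  eᵗ≢eᶠ {m} = apart (g~eᵗ m) g≁eᶠ

  eᵗ-inj : ∀ {m n} → m ≢ n → eᵗ m ≢ eᵗ n
  eᵗ-inj {m} m≢n = apart (h~eᵗ m) (h≁eᵗ (≢-sym m≢n))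

  eᶠ-inj : ∀ {m n} → m ≢ n → eᶠ m ≢ eᶠ n
  eᶠ-inj {m} {n} m≢n = apart (h~eᶠ m≢n) h≁eᶠ

  -- Of the four neighbours of `eᵗ m`, `g` and `h m` are not adjacent to `eᶠ m`. So the two common
  -- neighbours given by `two` are the other two.
  opposite : ∀ {m c} → Adj (eᵗ m) c → c ≢ g → c ≢ h m → Adj (eᶠ m) c
  opposite {m} {c} e~c c≢g c≢h = decidable-stable (adj? (eᶠ m) c) λ e≁c → contradiction
    (≤-trans (s≤s (s≤s (s≤s (≤-reflexive (sym two-common)))))
      (≤-trans (#-mono-+ (λ z → adj? (eᵗ m) z ×-dec adj? (eᶠ m) z) (adj? (eᵗ m)) {g ∷ h m ∷ c ∷ []}
        ((g≢h ∷ ≢-sym c≢g ∷ []) ∷ (≢-sym c≢h ∷ []) ∷ [] ∷ [])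
        (λ { (here refl)                 → symm (g~eᵗ m) , λ (_ , a) → g≁eᶠ (symm a)
           ; (2nd refl)         → symm (h~eᵗ m) , λ (_ , a) → h≁eᶠ (symm a)
           ; (3rd refl) → e~c , λ (_ , a) → e≁c a }) proj₁)
      (≤-reflexive (regular (eᵗ m))))) λ { (s≤s (s≤s (s≤s (s≤s ())))) }
    where
    two-common : #commonNeighbours (eᵗ m) (eᶠ m) ≡ 2
    two-common = two {z = p₀} eᵗ≢eᶠ (g , symm (g~eᵗ m) , p~g) (h (proj₁ (triple m)) , p~h _ , symm (h~eᶠ (tri-12 (triple-tri m))))

  module _ (m : Fin 3) where
    abstract
      C-spec : ∃[ c ] ((Adj (eᵗ (proj₁ (triple m))) c × Adj (eᵗ (proj₁ (proj₂ (triple m)))) c) × c ≢ g)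
      C-spec = other (eᵗ-inj (tri-23 (triple-tri m))) (symm (g~eᵗ _)) (symm (g~eᵗ _))

    C : V
    C = proj₁ C-spec

    C≢g : C ≢ g
    C≢g = proj₂ (proj₂ C-spec)

  eᵗ~C : ∀ {m n} → m ≢ n → Adj (eᵗ m) (C n)
  eᵗ~C {m} {n} m≢n with tri-cases (triple-tri n) m
  ... | inj₁ refl = contradiction refl m≢n
  ... | inj₂ (inj₁ refl) = proj₁ (proj₁ (proj₂ (C-spec n)))
  ... | inj₂ (inj₂ refl) = proj₂ (proj₁ (proj₂ (C-spec n)))

  C≢h : ∀ {m n l} → m ≢ n → m ≢ l → C n ≢ h l
  C≢h m≢n m≢l = apart (eᵗ~C m≢n) (λ a → h≁eᵗ m≢l (symm a))

  eᶠ~C : ∀ {m n} → m ≢ n → Adj (eᶠ m) (C n)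
  eᶠ~C {m} {n} m≢n = let l , t = third m≢n in
    opposite (eᵗ~C m≢n) (C≢g n) (C≢h (≢-sym (tri-23 t)) (≢-sym (tri-13 t)))

  C-nbrs : ∀ {m n l} → Tri m n l → Nbrs (C m) (eᵗ n ∷ eᵗ l ∷ eᶠ n ∷ eᶠ l ∷ [])
  C-nbrs t = nbrs₄ (symm (eᵗ~C n≢m)) (symm (eᵗ~C l≢m)) (symm (eᶠ~C n≢m)) (symm (eᶠ~C l≢m))
    (eᵗ-inj (tri-23 t)) eᵗ≢eᶠ eᵗ≢eᶠ eᵗ≢eᶠ eᵗ≢eᶠ (eᶠ-inj (tri-23 t))
    where
    n≢m = ≢-sym (tri-12 t)
    l≢m = ≢-sym (tri-13 t)

  C≁eᵗ : ∀ {m} → ¬ Adj (C m) (eᵗ m)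
  C≁eᵗ {m} a with Nbrs.exhaustive (C-nbrs (triple-tri m)) a
  ... | here e = eᵗ-inj (tri-12 (triple-tri m)) e
  ... | 2nd e = eᵗ-inj (tri-13 (triple-tri m)) e
  ... | 3rd e = eᵗ≢eᶠ e
  ... | 4th e = eᵗ≢eᶠ e

  C-inj : ∀ {m n} → m ≢ n → C m ≢ C n
  C-inj {m} {n} m≢n = apart (eᵗ~C (≢-sym m≢n)) (C≁eᵗ ∘ symm)

  p-nbrs : Nbrs p₀ (g ∷ h 0F ∷ h 1F ∷ h 2F ∷ [])
  p-nbrs = nbrs₄ p~g (p~h 0F) (p~h 1F) (p~h 2F) g≢h g≢h g≢h (h-inj λ ()) (h-inj λ ()) (h-inj λ ())

  g-nbrs : Nbrs g (p₀ ∷ eᵗ 0F ∷ eᵗ 1F ∷ eᵗ 2F ∷ [])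
  g-nbrs = nbrs₄ (symm p~g) (g~eᵗ 0F) (g~eᵗ 1F) (g~eᵗ 2F) (≢-sym (eᵗ≢p 0F)) (≢-sym (eᵗ≢p 1F)) (≢-sym (eᵗ≢p 2F))
    (eᵗ-inj λ ()) (eᵗ-inj λ ()) (eᵗ-inj λ ())

  h-nbrs : ∀ {m n l} → Tri m n l → Nbrs (h m) (p₀ ∷ eᵗ m ∷ eᶠ n ∷ eᶠ l ∷ [])
  h-nbrs {m} {n} {l} t = nbrs₄ (symm (p~h m)) (h~eᵗ m) (h~eᶠ (≢-sym (tri-12 t))) (h~eᶠ (≢-sym (tri-13 t)))
    (≢-sym (eᵗ≢p m)) (≢-sym (eᶠ≢p n)) (≢-sym (eᶠ≢p l)) eᵗ≢eᶠ eᵗ≢eᶠ (eᶠ-inj (tri-23 t))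

  eᵗ-nbrs : ∀ {m n l} → Tri m n l → Nbrs (eᵗ m) (g ∷ h m ∷ C n ∷ C l ∷ [])
  eᵗ-nbrs {m} {n} {l} t = nbrs₄ (symm (g~eᵗ m)) (symm (h~eᵗ m)) (eᵗ~C (tri-12 t)) (eᵗ~C (tri-13 t))
    g≢h (≢-sym (C≢g n)) (≢-sym (C≢g l)) (≢-sym (C≢h (≢-sym (tri-23 t)) (≢-sym (tri-13 t))))
    (≢-sym (C≢h (tri-23 t) (≢-sym (tri-12 t)))) (C-inj (tri-23 t))

  eᶠ-nbrs : ∀ {m n l} → Tri m n l → Nbrs (eᶠ m) (h n ∷ h l ∷ C n ∷ C l ∷ [])
  eᶠ-nbrs t = nbrs₄ (symm (h~eᶠ (tri-12 t))) (symm (h~eᶠ (tri-13 t))) (eᶠ~C (tri-12 t)) (eᶠ~C (tri-13 t))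
    (h-inj (tri-23 t)) (≢-sym (C≢h (tri-12 t) (tri-12 t))) (≢-sym (C≢h (tri-13 t) (tri-12 t)))
    (≢-sym (C≢h (tri-12 t) (tri-13 t))) (≢-sym (C≢h (tri-13 t) (tri-13 t))) (C-inj (tri-23 t))

  private module L = Λ-labels

  value : L.Label → V
  value L.p      = p₀
  value L.g      = g
  value (L.h m)  = h m
  value (L.eᵗ m) = eᵗ m
  value (L.eᶠ m) = eᶠ m
  value (L.C m)  = C m

  local : ∀ l → Nbrs (value l) (List.map value (L.nb l))
  local L.p      = p-nbrs
  local L.g      = g-nbrs
  local (L.h m)  = h-nbrs (triple-tri m)
  local (L.eᵗ m) = eᵗ-nbrs (triple-tri m)
  local (L.eᶠ m) = eᶠ-nbrs (triple-tri m)
  local (L.C m)  = C-nbrs (triple-tri m)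

  base : ∀ l → value l ≡ p₀ → l ≡ L.p
  base L.p      e = refl
  base L.g      e = contradiction p~g (irrefl (sym e))
  base (L.h m)  e = contradiction (p~h m) (irrefl (sym e))
  base (L.eᵗ m) e = contradiction e (eᵗ≢p m)
  base (L.eᶠ m) e = contradiction e (eᶠ≢p m)
  base (L.C m)  e = contradiction e (apart (eᵗ~C (≢-sym (tri-12 (triple-tri m)))) λ a → triangle-free p~g (g~eᵗ _) (symm a))

  ≅Λ : Γ ≅ Λ
  ≅Λ = Labelled.isomorphism Γ Λ L.code L.decode L.code-decode L.decode-code L.nb L.nb⁺ L.nb⁻ value local connected Λ-connected L.p base

≅-sym : ∀ {Γ Δ : Graph} → Γ ≅ Δ → Δ ≅ Γ
≅-sym {Γ} {Δ} i = bijective⇒≅ {Δ} {Γ} to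
    (λ {v} {w} e → trans (sym (strictlyInverseʳ v)) (trans (cong from e) (strictlyInverseʳ w)))
    (λ v → from v , strictlyInverseˡ v) (λ {v} {w} → Equivalence.to (adjacency v w)) (λ {v} {w} → Equivalence.from (adjacency v w))
  where
  open _≅_ i
  open Inverse bijection

module BipartiteZeroTwo⇒Λ {Γ : Graph} (B : BipartiteZeroTwo 14 4 Γ) where

  open Graph Γ
  open FiniteSet vertices using (#; _≟_)
  open Counting vertices
  open Neighbours Γ
  open BipartiteZeroTwo B renaming (valency to regular)
  open ZeroTwoGraph zeroTwo

  side : V → Bool
  side = proj₁ bipartite

  side-≢ : ∀ {v w} → Adj v w → side v ≢ side w
  side-≢ {v} {w} = proj₂ bipartite v w

  joined-side : ∀ {v w} → Joined v w → side v ≡ side w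
  joined-side (z , vz , wz) = trans (¬-not (side-≢ vz)) (sym (¬-not (side-≢ wz)))

  common : ∀ {v w} → v ≢ w → Joined v w → #commonNeighbours v w ≡ 2
  common {v} {w} v≢w (z , h) with zero-two v w v≢w
  ... | inj₁ e = contradiction (≤-trans (#>0 (λ z → adj? v z ×-dec adj? w z) h) (≤-reflexive e)) λ ()
  ... | inj₂ e = e

  #joined : ∀ v → # (λ w → ¬? (w ≟ v) ×-dec joined? v w) ≡ 6
  #joined v = *-cancelʳ-≡ _ 6 2 (#joined*μ regular common v)

  same? : ∀ s v → Dec (side v ≡ s)
  same? s v = side v ≟ᵇ s

  #side : ∀ s → # (same? s) ≡ 7
  #side s = *-cancelʳ-≡ (# (same? s)) 7 2 (trans (trans (*-comm (# (same? s)) 2) (cong (# (same? s) +_) (+-identityʳ _)))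
    (trans (cong (# (same? s) +_) (sym (equal-sides regular (same? s)
      (λ a e e′ → side-≢ a (trans e (sym e′))) (λ a ne → flip-side a ne)))) (trans (#-complement (same? s)) #vertices)))
    where
    flip-side : ∀ {v w} → Adj v w → side v ≢ s → side w ≡ s
    flip-side a ne = trans (¬-not (≢-sym (side-≢ a))) (sym (¬-not (≢-sym ne)))

  -- The side of `v` has seven vertices. They are `v` and the six joined to it, which leaves no room
  -- for `w` unless it is one of these.
  joined : ∀ {v w} → v ≢ w → side v ≡ side w → Joined v w
  joined {v} {w} v≢w e = decidable-stable (joined? v w) λ ¬J → contradiction
    (≤-trans (s≤s (s≤s (≤-reflexive (sym (#joined v)))))
      (≤-trans (#-mono-+ (λ w → ¬? (w ≟ v) ×-dec joined? v w) (same? (side v)) {v ∷ w ∷ []} ((v≢w ∷ []) ∷ [] ∷ [])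
        (λ { (here refl) → refl , (λ (ne , _) → ne refl) ; (2nd refl) → sym e , λ (_ , J) → ¬J J })
        (λ (_ , J) → sym (joined-side J))) (≤-reflexive (#side (side v))))) (from-no (8 ≤? 7))

  ≅Λ : Γ ≅ Λ
  ≅Λ = Λ-unique.≅Λ Γ regular connected
    (λ xy yz xz → side-≢ xz (joined-side (_ , xy , symm yz)))
    (λ v≢w Jvz Jzw → common v≢w (joined v≢w (trans (joined-side Jvz) (joined-side Jzw))))
    (Inverse.from (FiniteSet.enum vertices) (subst Fin (sym #vertices) 0F))

-- Square 2-(7,4,2) designs and their duals

module Design {D : IncidenceStructure} (S : SquareTwoDesign 7 4 2 D) where

  open IncidenceStructure D
  open SquareTwoDesign S
  private
    module P = Counting points
    module B = Counting blocks
    open FiniteSet points using () renaming (# to #ᴾ; _≟_ to _≟ᴾ_)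
    open FiniteSet blocks using () renaming (# to #ᴮ; _≟_ to _≟ᴮ_)

  #others : ∀ p → #ᴾ (λ q → ¬? (q ≟ᴾ p)) ≡ 6
  #others p = suc-injective (trans (cong (_+ #ᴾ (λ q → ¬? (q ≟ᴾ p))) (sym single)) (trans (P.#-complement (_≟ᴾ p)) #points))
    where
    single : #ᴾ (_≟ᴾ p) ≡ 1
    single = ≤-antisym (P.cover⇒#≤ (_≟ᴾ p) {p ∷ []} here) (P.#>0 (_≟ᴾ p) refl)

  -- Counts the pairs (q, b) with q ≠ p and both points on b: three for each block through `p`, two
  -- for each of the six points q.
  replication : ∀ p → #ᴮ (inc? p) ≡ 4
  replication p = *-cancelʳ-≡ (#ᴮ (inc? p)) 4 3 (trans (≤-antisym
    (DoubleCounting.double-count blocks points (inc? p) (λ q → ¬? (q ≟ᴾ p)) (λ b q → inc? q b) 3 2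
      (λ b pb → ≤-reflexive (sym (rest b pb))) (λ q q≢p → ≤-reflexive (balanced p q (≢-sym q≢p))))
    (DoubleCounting.double-count points blocks (λ q → ¬? (q ≟ᴾ p)) (inc? p) inc? 2 3
      (λ q q≢p → ≤-reflexive (sym (balanced p q (≢-sym q≢p)))) (λ b pb → ≤-reflexive (rest b pb))))
    (cong (_* 2) (#others p)))
    where
    rest : ∀ b → Inc p b → #ᴾ (λ q → ¬? (q ≟ᴾ p) ×-dec inc? q b) ≡ 3
    rest b pb = suc-injective (trans (≤-antisym
      (P.#-mono-+ (λ q → ¬? (q ≟ᴾ p) ×-dec inc? q b) (λ q → inc? q b) {p ∷ []} ([] ∷ []) (λ { (here refl) → pb , λ (ne , _) → ne refl }) proj₂)
      (P.#-≤-suc (λ q → inc? q b) (λ q → ¬? (q ≟ᴾ p) ×-dec inc? q b) {p} sub)) (block-size b))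
      where
      sub : ∀ {q} → Inc q b → q ≡ p ⊎ (q ≢ p × Inc q b)
      sub {q} qb with q ≟ᴾ p
      ... | yes e = inj₁ e
      ... | no ne = inj₂ (ne , qb)

  meet? : ∀ b c p → Dec (Inc p b × Inc p c)
  meet? b c p = inc? p b ×-dec inc? p c

  only-two : ∀ {p q b c d} → p ≢ q → b ≢ c → Inc p b → Inc q b → Inc p c → Inc q c → Inc p d → Inc q d → d ≡ b ⊎ d ≡ c
  only-two {p} {q} {b} {c} {d} p≢q b≢c pb qb pc qc pd qd with d ≟ᴮ b | d ≟ᴮ c
  ... | yes e | _ = inj₁ e
  ... | no _  | yes e = inj₂ e
  ... | no d≢b | no d≢c = contradiction (≤-trans
    (B.unique⇒≤# (λ b → inc? p b ×-dec inc? q b) {d ∷ b ∷ c ∷ []} ((d≢b ∷ d≢c ∷ []) ∷ (b≢c ∷ []) ∷ [] ∷ [])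
      λ { (here refl) → pd , qd ; (2nd refl) → pb , qb ; (3rd refl) → pc , qc })
    (≤-reflexive (balanced p q p≢q))) λ { (s≤s (s≤s ())) }

  -- Three points in b ∩ c would lie on 2 + 3·2 = 8 blocks.
  no-triple : ∀ {b c x y z} → b ≢ c → x ≢ y → x ≢ z → y ≢ z →
              Inc x b → Inc x c → Inc y b → Inc y c → Inc z b → Inc z c → ⊥
  no-triple {b} {c} {x} {y} {z} b≢c x≢y x≢z y≢z xb xc yb yc zb zc = contradiction (begin
    2 + (2 + 4)  ≡⟨ cong₂ _+_ (sym (two z (≢-sym x≢z))) (cong₂ _+_ (sym (two y (≢-sym x≢y))) (sym (replication x))) ⟩
    #ᴮ (only z) + (#ᴮ (only y) + #ᴮ (inc? x))  ≡⟨ cong₂ _+_ (sym (B.length-members (only z))) (cong (_+ #ᴮ (inc? x)) (sym (B.length-members (only y)))) ⟩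
    length Z + (length Y + #ᴮ (inc? x))  ≤⟨ +-monoʳ-≤ (length Z) (B.#-mono-+ (inc? x) XY? (B.members-unique (only y))
                                                         (λ i → let yd , x∉ = B.∈-members⁻ (only y) i in inj₂ yd , x∉) inj₁) ⟩
    length Z + #ᴮ XY?  ≤⟨ B.#-mono-+ XY? (λ _ → yes tt) (B.members-unique (only z)) (λ i → tt , fresh (B.∈-members⁻ (only z) i)) (λ _ → tt) ⟩
    #ᴮ {λ _ → ⊤} (λ _ → yes tt)  ≡⟨ B.#-all ⟩
    size blocks  ≡⟨ #blocks ⟩
    7  ∎) (from-no (8 ≤? 7))
    where
    open ≤-Reasoning
    only : ∀ y d → Dec (Inc y d × ¬ Inc x d)
    only y d = inc? y d ×-dec ¬? (inc? x d)
    XY? = λ d → inc? x d ⊎-dec inc? y d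
    Y = B.members (only y)
    Z = B.members (only z)
    two : ∀ y → y ≢ x → #ᴮ (only y) ≡ 2
    two y y≢x = +-cancelˡ-≡ 2 _ _ (trans (cong (_+ #ᴮ (only y)) (sym (balanced y x y≢x))) (trans (sym (B.#-split (inc? y) (inc? x))) (replication y)))
    fresh : ∀ {d} → Inc z d × ¬ Inc x d → ¬ (Inc x d ⊎ Inc y d)
    fresh (zd , x∉) (inj₁ xd) = x∉ xd
    fresh (zd , x∉) (inj₂ yd) with only-two (≢-sym y≢z) b≢c zb yb zc yc zd yd
    ... | inj₁ refl = x∉ xb
    ... | inj₂ refl = x∉ xc

  meet≤2 : ∀ {b c} → b ≢ c → #ᴾ (meet? b c) ≤ 2
  meet≤2 {b} {c} b≢c = go (P.members (meet? b c)) (P.length-members (meet? b c)) (P.members-unique (meet? b c)) (P.∈-members⁻ (meet? b c))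
    where
    go : ∀ xs → length xs ≡ #ᴾ (meet? b c) → Unique xs → (∀ {p} → p ∈ xs → Inc p b × Inc p c) → #ᴾ (meet? b c) ≤ 2
    go []           e _ _ = ≤-trans (≤-reflexive (sym e)) z≤n
    go (_ ∷ [])     e _ _ = ≤-trans (≤-reflexive (sym e)) (s≤s z≤n)
    go (_ ∷ _ ∷ []) e _ _ = ≤-reflexive (sym e)
    go (x ∷ y ∷ z ∷ _) e ((xy ∷ xz ∷ _) ∷ (yz ∷ _) ∷ _) h =
      let xb , xc = h (here refl) ; yb , yc = h (2nd refl) ; zb , zc = h (3rd refl)
      in ⊥-elim (no-triple b≢c xy xz yz xb xc yb yc zb zc)

  meets? : ∀ b c → Dec (∃[ p ] (Inc p b × Inc p c))
  meets? b c = map′ (P.#>0⁻ (meet? b c)) (λ (_ , h) → P.#>0 (meet? b c) h) (1 ≤? #ᴾ (meet? b c))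

  -- The four points of `b` lie on three further blocks each, and a block other than `b` takes up at
  -- most two of these twelve incidences. So six blocks besides `b` meet it, and a disjoint `c`
  -- would be an eighth block.
  meets : ∀ {b c} → b ≢ c → ∃[ p ] (Inc p b × Inc p c)
  meets {b} {c} b≢c = decidable-stable (meets? b c) λ none → contradiction (≤-trans
    (s≤s (s≤s (*-cancelʳ-≤ 6 (#ᴮ S?) 2 (≤-trans (≤-reflexive (cong (_* 3) (sym (block-size b))))
      (DoubleCounting.double-count points blocks (λ p → inc? p b) S? inc? 3 2 lo (λ d (d≢b , _) → meet≤2 (≢-sym d≢b)))))))
    (≤-trans (B.#-mono-+ S? (λ _ → yes tt) {b ∷ c ∷ []} ((b≢c ∷ []) ∷ [] ∷ [])
      (λ { (here refl) → tt , (λ (ne , _) → ne refl) ; (2nd refl) → tt , λ (_ , m) → none m }) (λ _ → tt))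
      (≤-reflexive (trans B.#-all #blocks)))) (from-no (8 ≤? 7))
    where
    S? = λ d → ¬? (d ≟ᴮ b) ×-dec meets? b d
    lo : ∀ p → Inc p b → 3 ≤ #ᴮ (λ d → S? d ×-dec inc? p d)
    lo p pb = ≤-pred (≤-trans (≤-reflexive (sym (replication p))) (B.#-≤-suc (inc? p) (λ d → S? d ×-dec inc? p d) {b} sub))
      where
      sub : ∀ {d} → Inc p d → d ≡ b ⊎ ((d ≢ b × ∃[ q ] (Inc q b × Inc q d)) × Inc p d)
      sub {d} pd with d ≟ᴮ b
      ... | yes e = inj₁ e
      ... | no ne = inj₂ ((ne , p , pb , pd) , pd)

  -- If b ∩ c = {p}, the three other points of b lie on the two blocks d ≠ b, c through p, one on each: 3 ≤ 2.
  meet≥2 : ∀ {b c} → b ≢ c → 2 ≤ #ᴾ (meet? b c)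
  meet≥2 {b} {c} b≢c = ≮⇒≥ λ <2 → go (meets b≢c) <2
    where
    go : ∃[ p ] (Inc p b × Inc p c) → #ᴾ (meet? b c) < 2 → ⊥
    go (p , pb , pc) <2 = contradiction (begin
        3 * 1  ≤⟨ *-monoˡ-≤ 1 (≤-pred (≤-trans (≤-reflexive (sym (block-size b))) (P.#-≤-suc (λ q → inc? q b) Q? {p} split-p))) ⟩
        #ᴾ Q? * 1  ≤⟨ DoubleCounting.double-count points blocks Q? R? inc? 1 1 lo hi ⟩
        #ᴮ R? * 1  ≤⟨ *-monoˡ-≤ 1 (≤-pred (≤-pred (≤-trans (B.#-mono-+ R? (inc? p) {b ∷ c ∷ []} ((b≢c ∷ []) ∷ [] ∷ [])
                        (λ { (here refl) → pb , (λ (_ , ne , _) → ne refl) ; (2nd refl) → pc , λ (_ , _ , ne) → ne refl }) proj₁)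
                        (≤-reflexive (replication p))))) ⟩
        2 * 1  ∎) λ { (s≤s (s≤s ())) }
      where
      open ≤-Reasoning
      Q? = λ q → inc? q b ×-dec ¬? (q ≟ᴾ p)
      R? = λ d → inc? p d ×-dec (¬? (d ≟ᴮ b) ×-dec ¬? (d ≟ᴮ c))
      split-p : ∀ {q} → Inc q b → q ≡ p ⊎ (Inc q b × q ≢ p)
      split-p {q} qb with q ≟ᴾ p
      ... | yes e = inj₁ e
      ... | no ne = inj₂ (qb , ne)
      lo : ∀ q → Inc q b × q ≢ p → 1 ≤ #ᴮ (λ d → R? d ×-dec inc? q d)
      lo q (qb , q≢p) =
        let d , (pd , qd) , d≢b = B.another (λ d → inc? p d ×-dec inc? q d) (≤-reflexive (sym (balanced p q (≢-sym q≢p)))) b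
        in B.#>0 (λ d → R? d ×-dec inc? q d) {d} ((pd , d≢b , λ { refl → <⇒≱ <2 (P.unique⇒≤# (meet? b c) {p ∷ q ∷ []} ((≢-sym q≢p ∷ []) ∷ [] ∷ [])
             λ { (here refl) → pb , pc ; (2nd refl) → qb , qd }) }) , qd)
      hi : ∀ d → Inc p d × d ≢ b × d ≢ c → #ᴾ (λ q → Q? q ×-dec inc? q d) ≤ 1
      hi d (pd , d≢b , _) = ≤-pred (≤-trans (P.#-mono-+ (λ q → Q? q ×-dec inc? q d) (meet? b d) {p ∷ []} ([] ∷ [])
        (λ { (here refl) → (pb , pd) , λ ((_ , ne) , _) → ne refl }) (λ ((qb , _) , qd) → qb , qd)) (meet≤2 (≢-sym d≢b)))

  -- Gives the blocks the same regularity as the points, so that `Λ-unique` applies to the incidence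
  -- graph.
  dual-square : SquareTwoDesign 7 4 2 (dual D)
  dual-square = record { #points = #blocks ; #blocks = #points ; block-size = replication
                       ; balanced = λ b c b≢c → ≤-antisym (meet≤2 b≢c) (meet≥2 b≢c) }

#-inj₁ : ∀ (A B : FiniteSet) {P : Carrier A ⊎ Carrier B → Set} (P? : ∀ v → Dec (P v)) → (∀ {b} → ¬ P (inj₂ b)) →
         FiniteSet.# (A ⊎FS B) P? ≡ FiniteSet.# A (P? ∘ inj₁)
#-inj₁ A B {P} P? none = ≤-antisym
  (Counting₂.#-surjective A (A ⊎FS B) (P? ∘ inj₁) P? inj₁ (λ {v} → onto v))
  (Counting₂.#-injective A (A ⊎FS B) (P? ∘ inj₁) P? inj₁ id (λ { _ _ refl → refl }))
  where
  onto : ∀ v → P v → ∃[ a ] (P (inj₁ a) × inj₁ a ≡ v)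
  onto (inj₁ a) pa = a , pa , refl
  onto (inj₂ b) pb = contradiction pb none

#-inj₂ : ∀ (A B : FiniteSet) {P : Carrier A ⊎ Carrier B → Set} (P? : ∀ v → Dec (P v)) → (∀ {a} → ¬ P (inj₁ a)) →
         FiniteSet.# (A ⊎FS B) P? ≡ FiniteSet.# B (P? ∘ inj₂)
#-inj₂ A B {P} P? none = ≤-antisym
  (Counting₂.#-surjective B (A ⊎FS B) (P? ∘ inj₂) P? inj₂ (λ {v} → onto v))
  (Counting₂.#-injective B (A ⊎FS B) (P? ∘ inj₂) P? inj₂ id (λ { _ _ refl → refl }))
  where
  onto : ∀ v → P v → ∃[ b ] (P (inj₂ b) × inj₂ b ≡ v)
  onto (inj₂ b) pb = b , pb , refl
  onto (inj₁ a) pa = contradiction pa none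

module Design⇒Λ {D : IncidenceStructure} (S : SquareTwoDesign 7 4 2 D) where

  open IncidenceStructure D
  private
    module S = SquareTwoDesign S
    module S′ = SquareTwoDesign (Design.dual-square S)
    G = incidenceGraph D
  open Graph G
  open Neighbours G

  regular : Regular 4
  regular (inj₁ p) = trans (#-inj₂ points blocks (adj? (inj₁ p)) (λ ())) (S′.block-size p)
  regular (inj₂ b) = trans (#-inj₁ points blocks (adj? (inj₂ b)) (λ ())) (S.block-size b)

  triangle-free : ∀ {x y z} → Adj x y → Adj y z → Adj x z → ⊥
  triangle-free {inj₁ _} {inj₂ _} {inj₁ _} _ _ ()
  triangle-free {inj₁ _} {inj₂ _} {inj₂ _} _ () _
  triangle-free {inj₂ _} {inj₁ _} {inj₁ _} _ () _
  triangle-free {inj₂ _} {inj₁ _} {inj₂ _} _ _ ()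
  triangle-free {inj₁ _} {inj₁ _} () _ _
  triangle-free {inj₂ _} {inj₂ _} () _ _

  common₁ : ∀ p q → p ≢ q → #commonNeighbours (inj₁ p) (inj₁ q) ≡ 2
  common₁ p q p≢q = trans (#-inj₂ points blocks (λ z → adj? (inj₁ p) z ×-dec adj? (inj₁ q) z) (λ ())) (S.balanced p q p≢q)

  common₂ : ∀ b c → b ≢ c → #commonNeighbours (inj₂ b) (inj₂ c) ≡ 2
  common₂ b c b≢c = trans (#-inj₁ points blocks (λ z → adj? (inj₂ b) z ×-dec adj? (inj₂ c) z) (λ ())) (S′.balanced b c b≢c)

  two : ∀ {v w z} → v ≢ w → Joined v z → Joined z w → #commonNeighbours v w ≡ 2
  two {inj₁ p} {inj₁ q} v≢w _ _ = common₁ p q (v≢w ∘ cong inj₁)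
  two {inj₂ b} {inj₂ c} v≢w _ _ = common₂ b c (v≢w ∘ cong inj₂)
  two {inj₁ _} {inj₂ _} {inj₁ _} _ _ (inj₁ _ , () , _)
  two {inj₁ _} {inj₂ _} {inj₁ _} _ _ (inj₂ _ , _ , ())
  two {inj₁ _} {inj₂ _} {inj₂ _} _ (inj₁ _ , () , _) _
  two {inj₁ _} {inj₂ _} {inj₂ _} _ (inj₂ _ , _ , ()) _
  two {inj₂ _} {inj₁ _} {inj₁ _} _ (inj₁ _ , _ , ()) _
  two {inj₂ _} {inj₁ _} {inj₁ _} _ (inj₂ _ , () , _) _
  two {inj₂ _} {inj₁ _} {inj₂ _} _ _ (inj₁ _ , _ , ())
  two {inj₂ _} {inj₁ _} {inj₂ _} _ _ (inj₂ _ , () , _)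

  walk₂ : ∀ v w → (v ≢ w → #commonNeighbours v w ≡ 2) → ∃[ n ] Walk v w n
  walk₂ v w h with FiniteSet._≟_ vertices v w
  ... | yes refl = 0 , []
  ... | no v≢w = let z , vz , wz = Counting.#>0⁻ vertices (λ z → adj? v z ×-dec adj? w z) (≤-trans (s≤s z≤n) (≤-reflexive (sym (h v≢w))))
                   in 2 , vz ∷ symm {w} {z} wz ∷ []

  connected : Connected
  connected (inj₁ p) (inj₁ q) = walk₂ (inj₁ p) (inj₁ q) λ ne → common₁ p q (ne ∘ cong inj₁)
  connected (inj₂ b) (inj₂ c) = walk₂ (inj₂ b) (inj₂ c) λ ne → common₂ b c (ne ∘ cong inj₂)
  connected (inj₁ p) (inj₂ c) =
    let b , pb = Counting.#>0⁻ blocks (inc? p) (≤-trans (s≤s z≤n) (≤-reflexive (sym (S′.block-size p))))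
        n , w = connected (inj₂ b) (inj₂ c) in suc n , _∷_ {inj₁ p} {inj₂ b} pb w
  connected (inj₂ b) (inj₁ q) =
    let p , pb = Counting.#>0⁻ points (λ p → inc? p b) (≤-trans (s≤s z≤n) (≤-reflexive (sym (S.block-size b))))
        n , w = connected (inj₁ p) (inj₁ q) in suc n , _∷_ {inj₂ b} {inj₁ p} pb w

  Λ≅ : Λ ≅ incidenceGraph D
  Λ≅ = ≅-sym {G} {Λ} (Λ-unique.≅Λ G regular connected (λ {x} {y} {z} → triangle-free {x} {y} {z}) (λ {v} {w} {z} → two {v} {w} {z})
    (inj₁ (Inverse.from (FiniteSet.enum points) (subst Fin (sym S.#points) 0F))))

-- Order and valency as invariants

≅-order : ∀ {Γ Δ : Graph} → Γ ≅ Δ → Graph.order Γ ≡ Graph.order Δ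
≅-order {Γ} {Δ} i = ↔⇒≡ (FiniteSet.enum (Graph.vertices Δ) ↔-∘ (_≅_.bijection i ↔-∘ ↔-sym (FiniteSet.enum (Graph.vertices Γ))))

≅-valency : ∀ {Γ Δ : Graph} {k l} → Γ ≅ Δ → Graph.Regular Γ k → Graph.Regular Δ l → Graph.V Γ → k ≡ l
≅-valency {Γ} {Δ} i rΓ rΔ v = trans (sym (rΓ v)) (trans (≤-antisym
    (Counting₂.#-injective Γ.vertices Δ.vertices (Γ.adj? v) (Δ.adj? (to v)) to (λ {w} → Equivalence.to (adjacency v w))
      (λ {w} {w′} _ _ e → trans (sym (strictlyInverseʳ w)) (trans (cong from e) (strictlyInverseʳ w′))))
    (Counting₂.#-surjective Γ.vertices Δ.vertices (Γ.adj? v) (Δ.adj? (to v)) to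
      λ {w} a → from w , Equivalence.from (adjacency v (from w)) (subst (Δ.Adj (to v)) (sym (strictlyInverseˡ w)) a) , strictlyInverseˡ w))
    (rΔ (to v)))
  where
  module Γ = Graph Γ
  module Δ = Graph Δ
  open _≅_ i
  open Inverse bijection

cube-regular : Graph.Regular (cube 5) 5
cube-regular = from-yes (allBits? 5 λ v → Graph.degree (cube 5) v ≟ⁿ 5)

-- Counts the pairs of a point and its group: one for each point, n for each group.
GDD-size : ∀ {n m k λ₁ λ₂ S} → GDD n m k λ₁ λ₂ S → size (IncidenceStructure.points S) ≡ m * n
GDD-size {n} {m} {S = S} D = begin
    size points  ≡⟨ *-identityʳ _ ⟨
    size points * 1  ≡⟨ cong (_* 1) (Counting.#-all points) ⟨
    FiniteSet.# points {λ _ → ⊤} (λ _ → yes tt) * 1  ≡⟨ ≤-antisym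
      (DoubleCounting.double-count points (finFS m) (λ _ → yes tt) (λ _ → yes tt) at? 1 n (λ p _ → ≤-reflexive (sym (one p))) (λ j _ → ≤-reflexive (grp j)))
      (DoubleCounting.double-count (finFS m) points (λ _ → yes tt) (λ _ → yes tt) (λ j p → at? p j) n 1 (λ j _ → ≤-reflexive (sym (grp j))) (λ p _ → ≤-reflexive (one p))) ⟩
    FiniteSet.# (finFS m) {λ _ → ⊤} (λ _ → yes tt) * n  ≡⟨ cong (_* n) (Counting.#-all (finFS m)) ⟩
    m * n  ∎
  where
  open IncidenceStructure S
  open GDD D
  open ≡-Reasoning
  at? : ∀ p j → Dec (group p ≡ j)
  at? p j = group p ≟ᶠ j
  one : ∀ p → FiniteSet.# (finFS m) (λ j → yes tt ×-dec at? p j) ≡ 1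
  one p = ≤-antisym (Counting.cover⇒#≤ (finFS m) (λ j → yes tt ×-dec at? p j) {group p ∷ []} (λ (_ , e) → here (sym e)))
                    (Counting.#>0 (finFS m) (λ j → yes tt ×-dec at? p j) {group p} (tt , refl))
  grp : ∀ j → FiniteSet.# points (λ p → yes tt ×-dec at? p j) ≡ n
  grp j = trans (Counting.#-cong points (λ p → yes tt ×-dec at? p j) (λ p → at? p j) proj₂ (tt ,_)) (group-size j)

GDDDP-order : ∀ {n m k λ₁ λ₂ S} → GDDDP n m k λ₁ λ₂ S → Graph.order (incidenceGraph S) ≡ m * n + m * n
GDDDP-order (D , D′) = cong₂ _+_ (GDD-size D) (GDD-size D′)

-- Reduction to distance 4 and the final classification

odd-half : ∀ k → ¬ (2 ∣ k) → k ≡ suc ((k ∸ 1) / 2 + (k ∸ 1) / 2)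
odd-half zero    odd = contradiction (divides 0 refl) odd
odd-half (suc k) odd = cong suc (sym (trans (double (k / 2)) (m/n*n≡m (half k odd))))
  where
  double : ∀ n → n + n ≡ n * 2
  double n = trans (cong (n +_) (sym (+-identityʳ n))) (*-comm 2 n)
  half : ∀ k → ¬ (2 ∣ suc k) → 2 ∣ k
  half zero          _   = divides 0 refl
  half (suc zero)    odd = contradiction (divides 1 refl) odd
  half (suc (suc k)) odd with half k (λ { (divides q e) → odd (divides (suc q) (cong (2 +_) e)) })
  ... | divides q e = divides (suc q) (cong (2 +_) e)

module _ {Γ : Graph} where

  open Graph Γ

  -- A final segment of a geodesic is a geodesic, so a diameter of at least 4 provides a pair at
  -- distance exactly 4.
  distance-4 : ∀ m {x y} → Distance x y (m + 4) → ∃[ x′ ] Distance x′ y 4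
  distance-4 zero    D             = _ , D
  distance-4 (suc m) (a ∷ w , low) = distance-4 m (w , λ n w′ → ≤-pred (low (suc n) (a ∷ w′)))

module Trichotomy {Γ : Graph} {v k lam μ : ℕ} (AR : AmplyRegular Γ v k lam μ) (k≡2μ+1 : k ≡ suc (μ + μ)) (2≤μ : 2 ≤ μ)
  (connected : Graph.Connected Γ) {x u : Graph.V Γ} (dist : Graph.Distance Γ x u 4) where

  open Graph Γ
  open FiniteSet vertices using (#; _≟_)
  open Counting vertices
  open Neighbours Γ
  open AmplyRegular AR

  F : Far x u
  F = far dist

  lam≡0 : lam ≡ 0
  lam≡0 = go (proj₁ dist)
    where
    go : Walk x u 4 → lam ≡ 0
    go (x~a ∷ a~y ∷ y~b ∷ b~u ∷ []) = TriangleFree.lam≡0 AR k≡2μ+1 2≤μ F x~a a~y y~b (symm b~u)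

  regular′ : Regular (suc (μ + μ))
  regular′ w = trans (regular w) k≡2μ+1

  triangle-free : ∀ {p q r} → Adj p q → Adj q r → Adj p r → ⊥
  triangle-free {p} {q} {r} pq qr pr = contradiction (≤-trans (#>0 (λ z → adj? p z ×-dec adj? q z) (pr , qr))
    (≤-reflexive (trans (adjacent p q pq) lam≡0))) λ ()

  common : ∀ {p q} → p ≢ q → Joined p q → #commonNeighbours p q ≡ μ
  common p≢q J@(z , pz , qz) = TriangleFree.common≡μ AR k≡2μ+1 2≤μ p≢q (λ pq → triangle-free pq qz pz) J

  open Antipodal Γ 2≤μ regular′ common

  -- The failure of `Tight` in positive form, so that a finite search either produces the witnesses
  -- or proves tightness.
  Branch : V → V → Set
  Branch x u = ∃[ a ] ((Adj x a × Near u a) × ∃[ z ] (Adj a z × z ≢ x × ¬ Joined u z))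

  exists? : {P : V → Set} → (∀ v → Dec (P v)) → Dec (∃[ v ] P v)
  exists? P? = map′ (#>0⁻ P?) (λ (_ , h) → #>0 P? h) (1 ≤? # P?)

  branch? : ∀ x u → Dec (Branch x u)
  branch? x u = exists? λ a → (adj? x a ×-dec exists? (λ y → adj? a y ×-dec joined? u y)) ×-dec
                              exists? (λ z → adj? a z ×-dec (¬? (z ≟ x) ×-dec ¬? (joined? u z)))

  ¬branch⇒tight : ∀ {x u} → ¬ Branch x u → Tight x u
  ¬branch⇒tight {u = u} none {a} {z} x~a near a~z z≢x =
    decidable-stable (joined? u z) λ ¬J → none (a , (x~a , near) , z , a~z , z≢x , ¬J)

  -- `a` is at distance 3 from `u`, and `x` and `z` are two of its neighbours outside Γ₂(u). They
  -- first force μ = 2 and then become the two vertices `x` of a frame.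
  branch⇒models : ∀ {x u} → Far x u → Branch x u → Γ ≅ cube 5 ⊎ Γ ≅ K₂ □ Λ
  branch⇒models {x} {u} F (a , (x~a , y , a~y , b , u~b , y~b) , z , a~z , z≢x , ¬Jz) =
    models (≤-antisym (MuGraph.branching⇒μ≡2 Γ 2≤μ regular′ common
      u≁a ¬Ja (symm x~a) a~z (≢-sym z≢x) ¬Jx ¬Jz a~y y~b u~b) 2≤μ) regular′ common
    where
    open Far F
    u≁a : ¬ Adj u a
    u≁a = no2 x~a
    ¬Ja : ¬ Joined u a
    ¬Ja (_ , p , q) = no3 x~a q p
    ¬Jx : ¬ Joined u x
    ¬Jx (_ , p , q) = no2 q p
    models : ∀ {μ} → μ ≡ 2 → Regular (suc (μ + μ)) → (∀ {p q} → p ≢ q → Joined p q → #commonNeighbours p q ≡ μ) →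
             Γ ≅ cube 5 ⊎ Γ ≅ K₂ □ Λ
    models refl reg com = iso (Rectagraph.Classify.classify Γ reg com (Rectagraph.config Γ reg com
        (Rectagraph.frame-exists Γ reg com (λ { refl → no1 x~a }) u≁a ¬Ja (symm x~a) a~z (≢-sym z≢x) ¬Jx ¬Jz a~y y~b u~b)))
      where
      iso : Rectagraph.Cube Γ reg com ⊎ (∃[ i ] ∃[ j ] ∃[ k ] Rectagraph.Twist Γ reg com i j k) → Γ ≅ cube 5 ⊎ Γ ≅ K₂ □ Λ
      iso (inj₁ C)               = inj₁ (Models.≅cube Γ reg triangle-free com connected C)
      iso (inj₂ (_ , _ , _ , C)) = inj₂ (Models.≅prism Γ reg triangle-free com connected C)

  trichotomy : (Γ ≅ cube 5 ⊎ Γ ≅ K₂ □ Λ) ⊎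
               Σ[ S ∈ IncidenceStructure ] (GDDDP 2 (suc (suc (μ + μ))) (suc (μ + μ)) 0 μ S × Γ ≅ incidenceGraph S)
  trichotomy = go (branch? x u) (branch? u x)
    where
    start : Walk x u 4 → ∃[ a ] (Adj x a × Near u a)
    start (x~a ∷ a~y ∷ y~b ∷ b~u ∷ []) = _ , x~a , _ , a~y , _ , symm b~u , y~b
    go : Dec (Branch x u) → Dec (Branch u x) → (Γ ≅ cube 5 ⊎ Γ ≅ K₂ □ Λ) ⊎
         Σ[ S ∈ IncidenceStructure ] (GDDDP 2 (suc (suc (μ + μ))) (suc (μ + μ)) 0 μ S × Γ ≅ incidenceGraph S)
    go (yes B) _ = inj₁ (branch⇒models F B)
    go (no _)  (yes B) = inj₁ (branch⇒models (far-sym F) B)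
    go (no ¬B) (no ¬B′) = inj₂ (GDDDP-structure F (¬branch⇒tight ¬B) (¬branch⇒tight ¬B′) (start (proj₁ dist)) connected)

theorem1p2 : Σ[ Λ ∈ Graph ]
    ( BipartiteZeroTwo 14 4 Λ
    × (∀ Λ′ → BipartiteZeroTwo 14 4 Λ′ → Λ′ ≅ Λ)
    × (Σ[ D ∈ IncidenceStructure ] SquareTwoDesign 7 4 2 D)
    × (∀ D → SquareTwoDesign 7 4 2 D → Λ ≅ incidenceGraph D)
    × Graph.Diameter (K₂ □ Λ) 4
    × AmplyRegular (K₂ □ Λ) 28 5 0 2
    × (∀ (k v lam μ d : ℕ) (Γ : Graph)
    → 5 ≤ k
    → ¬ (2 ∣ k)
    → Graph.Connected Γ
    → AmplyRegular Γ v k lam μ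
    → Graph.Diameter Γ d
    → 4 ≤ d
    → μ ≡ (k ∸ 1) / 2
    → ExactlyOneOf
    (Γ ≅ cube 5)
    (Γ ≅ K₂ □ Λ)
    (Σ[ S ∈ IncidenceStructure ]
    (GDDDP 2 (k + 1) k 0 ((k ∸ 1) / 2) S × Γ ≅ incidenceGraph S))))
theorem1p2 = Λ , Λ-bipartite-zero-two , (λ _ → BipartiteZeroTwo⇒Λ.≅Λ) , (D₇ , D₇-square) , (λ _ → Design⇒Λ.Λ≅)
           , Δ-diameter , Δ-amply-regular , main
  where
  main : ∀ (k v lam μ d : ℕ) (Γ : Graph) → 5 ≤ k → ¬ (2 ∣ k) → Graph.Connected Γ → AmplyRegular Γ v k lam μ → Graph.Diameter Γ d →
         4 ≤ d → μ ≡ (k ∸ 1) / 2 → ExactlyOneOf (Γ ≅ cube 5) (Γ ≅ K₂ □ Λ)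
           (Σ[ S ∈ IncidenceStructure ] (GDDDP 2 (k + 1) k 0 ((k ∸ 1) / 2) S × Γ ≅ incidenceGraph S))
  main k v lam μ d Γ 5≤k odd connected AR (_ , x , u , dist) 4≤d refl
    with distance-4 {Γ} (d ∸ 4) (subst (Graph.Distance Γ x u) (sym (m∸n+n≡m 4≤d)) dist)
  ... | x′ , dist′ = conclude (Trichotomy.trichotomy AR k≡ 2≤μ connected dist′)
    where
    k≡ : k ≡ suc (μ + μ)
    k≡ = odd-half k odd

    2≤μ : 2 ≤ μ
    2≤μ = ≮⇒≥ λ μ<2 → contradiction (≤-trans 5≤k (≤-trans (≤-reflexive k≡) (s≤s (+-mono-≤ (≤-pred μ<2) (≤-pred μ<2))))) λ { (s≤s (s≤s (s≤s ()))) }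

    GDDDP-case : Set₁
    GDDDP-case = Σ[ S ∈ IncidenceStructure ] (GDDDP 2 (k + 1) k 0 μ S × Γ ≅ incidenceGraph S)

    -- Each of the first two cases fixes k = 5. Then the third has order 4(k + 1) = 24, against 32
    -- and 28, so the order separates all three.
    cube-order : Γ ≅ cube 5 → k ≡ 5 × Graph.order Γ ≡ 32
    cube-order i = ≅-valency {Γ} {cube 5} i (AmplyRegular.regular AR) cube-regular x , ≅-order {Γ} {cube 5} i

    prism-order : Γ ≅ K₂ □ Λ → k ≡ 5 × Graph.order Γ ≡ 28
    prism-order i = ≅-valency {Γ} {Δ} i (AmplyRegular.regular AR) Δ-regular x , ≅-order {Γ} {Δ} i

    GDDDP-order′ : GDDDP-case → k ≡ 5 → Graph.order Γ ≡ 24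
    GDDDP-order′ (S , D , i) k≡5 = trans (≅-order {Γ} {incidenceGraph S} i) (trans (GDDDP-order D) (cong (λ k → (k + 1) * 2 + (k + 1) * 2) k≡5))

    cube≢prism : Γ ≅ cube 5 → ¬ (Γ ≅ K₂ □ Λ)
    cube≢prism i j = contradiction (trans (sym (proj₂ (cube-order i))) (proj₂ (prism-order j))) λ ()

    cube≢GDDDP : Γ ≅ cube 5 → ¬ GDDDP-case
    cube≢GDDDP i g = contradiction (trans (sym (proj₂ (cube-order i))) (GDDDP-order′ g (proj₁ (cube-order i)))) λ ()

    prism≢GDDDP : Γ ≅ K₂ □ Λ → ¬ GDDDP-case
    prism≢GDDDP i g = contradiction (trans (sym (proj₂ (prism-order i))) (GDDDP-order′ g (proj₁ (prism-order i)))) λ ()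

    conclude : (Γ ≅ cube 5 ⊎ Γ ≅ K₂ □ Λ) ⊎
               Σ[ S ∈ IncidenceStructure ] (GDDDP 2 (suc (suc (μ + μ))) (suc (μ + μ)) 0 μ S × Γ ≅ incidenceGraph S) →
               ExactlyOneOf (Γ ≅ cube 5) (Γ ≅ K₂ □ Λ) GDDDP-case
    conclude (inj₁ (inj₁ i)) = inj₁ (i , cube≢prism i , cube≢GDDDP i)
    conclude (inj₁ (inj₂ i)) = inj₂ (inj₁ ((λ j → cube≢prism j i) , i , prism≢GDDDP i))
    conclude (inj₂ (S , D , i))  = inj₂ (inj₂ ((λ j → cube≢GDDDP j g) , (λ j → prism≢GDDDP j g) , g))
      where
      g : GDDDP-case
      g = S , subst₂ (λ m k → GDDDP 2 m k 0 μ S) (trans (sym (+-comm (suc (μ + μ)) 1)) (cong (_+ 1) (sym k≡))) (sym k≡) D , i
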